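{- Let $G$ be an $\{\mathrm{ISK4},\mathrm{wheel}\}$-free trigraph. Then at least one of the following holds: $G$ is a series-parallel trigraph; $G$ is a complete bipartite trigraph; $G$ is a line trigraph; $G$ admits a clique-cutset; $G$ admits a stable 2-cutset.
   Context: A trigraph $G$ is a finite set $V(G)$ together with a function $\theta_G$ from the 2-element subsets of $V(G)$ to $\{ -1,0,1\}$. For distinct $u,v$: they are strongly adjacent if $\theta_G(uv)=1$, semi-adjacent if $\theta_G(uv)=0$, strongly anti-adjacent if $\theta_G(uv)=-1$; adjacent if $\theta_G(uv)\ge 0$ and anti-adjacent if $\theta_G(uv)\le 0$. A graph is a trigraph with no semi-adjacent pairs. A realization of $G$ is a graph on $V(G)$ obtained by turning each semi-adjacent pair into an edge or a non-edge (keeping strongly adjacent pairs as edges and strongly anti-adjacent pairs as non-edges); the full realization turns all semi-adjacent pairs into edges. $G[X]$ denotes the induced subtrigraph on $X\subseteq V(G)$, and $G\setminus X=G[V(G)\setminus X]$. For a graph $H$, $G$ is $H$-free if no realization of $G$ has an induced subgraph isomorphic to $H$; $G$ is $\{\mathrm{ISK4},\mathrm{wheel}\}$-free if no realization of $G$ has an induced subgraph isomorphic to a subdivision of $K_4$ or to a wheel (a chordless cycle plus a vertex with at least three neighbors on the cycle). A trigraph is connected if its full realization is connected. A cutset of $G$ is a (possibly empty) set $C\subseteq V(G)$ such that $G\setminus C$ is disconnected. A clique-cutset is a cutset that is a strong clique (a set of pairwise strongly adjacent vertices). A stable 2-cutset is a cutset that is a stable set (pairwise anti-adjacent vertices) of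 size two. $G$ is series-parallel if its full realization contains no subdivision of $K_4$ as a subgraph. $G$ is a complete bipartite trigraph if $V(G)$ can be partitioned into two strongly stable sets (pairwise strongly anti-adjacent) that are strongly complete to each other (every pair across is strongly adjacent). A line trigraph of a graph $H$ is a trigraph whose full realization is isomorphic to the line graph of $H$ and all of whose triangles (sets of three pairwise adjacent vertices) are strong (pairwise strongly adjacent); $G$ is a line trigraph if it is a line trigraph of some graph. -}

module Defs where

open import Data.Nat using (ℕ; zero; suc; _%_)
open import Data.Fin using (Fin; toℕ; _≟_)
open import Data.Bool using (Bool; true; false)
open import Data.Product using (Σ; ∃; _×_; _,_; proj₁; proj₂)
open import Data.Sum using (_⊎_)
open import Data.Empty using (⊥)
open import Data.List using (List; []; _∷_; _++_)
open import Data.List.Membership.Propositional using (_∈_)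
open import Data.List.Relation.Unary.Unique.Propositional using (Unique)
open import Relation.Nullary using (¬_; yes; no)
open import Relation.Binary.PropositionalEquality using (_≡_; _≢_; refl; sym)
open import Function.Bundles using (_⇔_)
open import Function.Definitions using (Injective)
open import Data.Fin.Subset using (Subset; _∪_; ⁅_⁆) renaming (_∈_ to _∈ₛ_; _∉_ to _∉ₛ_)

record Graph (m : ℕ) : Set where
  field
    adj     : Fin m → Fin m → Bool
    adj-sym : ∀ u v → adj u v ≡ adj v u
    adj-irr : ∀ v → adj v v ≡ false
open Graph public

InducedCopy : ∀ {k n} → Graph k → Graph n → Set
InducedCopy {k} {n} H R =
  Σ (Fin k → Fin n) λ f → Injective _≡_ _≡_ f ×
    (∀ i j → adj R (f i) (f j) ≡ adj H i j)

SubgraphCopy : ∀ {k n} → Graph k → Graph n → Set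
SubgraphCopy {k} {n} H R =
  Σ (Fin k → Fin n) λ f → Injective _≡_ _≡_ f ×
    (∀ i j → adj H i j ≡ true → adj R (f i) (f j) ≡ true)

k4edge : Fin 6 → Fin 4 × Fin 4
k4edge Fin.zero = (Fin.zero , Fin.suc Fin.zero)
k4edge (Fin.suc Fin.zero) = (Fin.zero , Fin.suc (Fin.suc Fin.zero))
k4edge (Fin.suc (Fin.suc Fin.zero)) = (Fin.zero , Fin.suc (Fin.suc (Fin.suc Fin.zero)))
k4edge (Fin.suc (Fin.suc (Fin.suc Fin.zero))) = (Fin.suc Fin.zero , Fin.suc (Fin.suc Fin.zero))
k4edge (Fin.suc (Fin.suc (Fin.suc (Fin.suc Fin.zero)))) = (Fin.suc Fin.zero , Fin.suc (Fin.suc (Fin.suc Fin.zero)))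
k4edge (Fin.suc (Fin.suc (Fin.suc (Fin.suc (Fin.suc Fin.zero))))) = (Fin.suc (Fin.suc Fin.zero) , Fin.suc (Fin.suc (Fin.suc Fin.zero)))

Consec : ∀ {A : Set} → List A → A → A → Set
Consec (x ∷ y ∷ xs) u v = (u ≡ x × v ≡ y) ⊎ Consec (y ∷ xs) u v
Consec _ u v = ⊥

record IsSubdivK4 {m : ℕ} (H : Graph m) : Set where
  field
    branch   : Fin 4 → Fin m
    branch-inj : Injective _≡_ _≡_ branch
    interior : Fin 6 → List (Fin m)
  path : Fin 6 → List (Fin m)
  path e = branch (proj₁ (k4edge e)) ∷ (interior e ++ (branch (proj₂ (k4edge e)) ∷ []))
  field
    path-simple : ∀ e → Unique (path e)
    interior-avoids-branch : ∀ e v k → v ∈ interior e → v ≢ branch k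
    interiors-disjoint : ∀ e e' v → v ∈ interior e → v ∈ interior e' → e ≡ e'
    covers : ∀ v → (∃ λ k → v ≡ branch k) ⊎ (∃ λ e → v ∈ interior e)
    edges  : ∀ u v → (adj H u v ≡ true) ⇔
               (∃ λ e → Consec (path e) u v ⊎ Consec (path e) v u)

CycAdj : ∀ {k} → Fin (suc k) → Fin (suc k) → Set
CycAdj {k} i j = (suc (toℕ i) % suc k ≡ toℕ j) ⊎ (suc (toℕ j) % suc k ≡ toℕ i)

record IsWheel {m : ℕ} (H : Graph m) : Set where
  field
    len    : ℕ                                -- cycle length is 3 + len
    cyc    : Fin (suc (suc (suc len))) → Fin m
    cyc-inj : Injective _≡_ _≡_ cyc
    centre : Fin m
    centre-off : ∀ i → cyc i ≢ centre
    covers : ∀ v → v ≡ centre ⊎ (∃ λ i → v ≡ cyc i)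
    chordless : ∀ i j → (adj H (cyc i) (cyc j) ≡ true) ⇔ CycAdj i j
    n₁ n₂ n₃ : Fin (suc (suc (suc len)))
    n-distinct : n₁ ≢ n₂ × n₁ ≢ n₃ × n₂ ≢ n₃
    n-adj : adj H centre (cyc n₁) ≡ true × adj H centre (cyc n₂) ≡ true
            × adj H centre (cyc n₃) ≡ true

-- θ values: 1 = strongAdj, 0 = semiAdj, -1 = strongAnti
data Adjacency : Set where
  strongAdj semiAdj strongAnti : Adjacency

record Trigraph (n : ℕ) : Set where
  field
    θ     : Fin n → Fin n → Adjacency
    θ-sym : ∀ u v → θ u v ≡ θ v u
open Trigraph public

IsRealization : ∀ {n} → Trigraph n → Graph n → Set
IsRealization {n} G R = ∀ u v → u ≢ v →
  (θ G u v ≡ strongAdj → adj R u v ≡ true) ×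
  (θ G u v ≡ strongAnti → adj R u v ≡ false)

notAnti : Adjacency → Bool
notAnti strongAnti = false
notAnti _ = true

fullAdj : ∀ {n} → Trigraph n → Fin n → Fin n → Bool
fullAdj G u v with u ≟ v
... | yes _ = false
... | no _ = notAnti (θ G u v)

private
  fullAdj-sym : ∀ {n} (G : Trigraph n) u v → fullAdj G u v ≡ fullAdj G v u
  fullAdj-sym G u v with u ≟ v | v ≟ u
  ... | yes _ | yes _ = refl
  ... | yes refl | no q = Data.Empty.⊥-elim (q refl)
    where import Data.Empty
  ... | no p | yes refl = Data.Empty.⊥-elim (p refl)
    where import Data.Empty
  ... | no _ | no _ rewrite θ-sym G u v = refl

  fullAdj-irr : ∀ {n} (G : Trigraph n) v → fullAdj G v v ≡ false
  fullAdj-irr G v with v ≟ v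
  ... | yes _ = refl
  ... | no p = Data.Empty.⊥-elim (p refl)
    where import Data.Empty

full : ∀ {n} → Trigraph n → Graph n
full G = record { adj = fullAdj G ; adj-sym = fullAdj-sym G ; adj-irr = fullAdj-irr G }

HasInducedSubdivK4 : ∀ {n} → Graph n → Set
HasInducedSubdivK4 R = ∃ λ m → Σ (Graph m) λ H → IsSubdivK4 H × InducedCopy H R

HasInducedWheel : ∀ {n} → Graph n → Set
HasInducedWheel R = ∃ λ m → Σ (Graph m) λ H → IsWheel H × InducedCopy H R

ISK4WheelFree : ∀ {n} → Trigraph n → Set
ISK4WheelFree {n} G = ∀ (R : Graph n) → IsRealization G R →
  ¬ HasInducedSubdivK4 R × ¬ HasInducedWheel R

SeriesParallel : ∀ {n} → Trigraph n → Set
SeriesParallel G = ¬ (∃ λ m → Σ (Graph m) λ H → IsSubdivK4 H × SubgraphCopy H (full G))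

CompleteBipartite : ∀ {n} → Trigraph n → Set
CompleteBipartite {n} G = Σ (Fin n → Bool) λ side → ∀ u v → u ≢ v →
  (side u ≡ side v → θ G u v ≡ strongAnti) ×
  (side u ≢ side v → θ G u v ≡ strongAdj)

SameEdge : ∀ {h} → Fin h × Fin h → Fin h × Fin h → Set
SameEdge (a , b) (c , d) = (a ≡ c × b ≡ d) ⊎ (a ≡ d × b ≡ c)

ShareEnd : ∀ {h} → Fin h × Fin h → Fin h × Fin h → Set
ShareEnd (a , b) (c , d) = a ≡ c ⊎ a ≡ d ⊎ b ≡ c ⊎ b ≡ d

-- G is a line trigraph of H: `ends` is a bijection from V(G) onto E(H)
-- that is an isomorphism from the full realization of G to L(H), and all
-- triangles of G are strong.
IsLineTrigraphOf : ∀ {n h} → Trigraph n → Graph h → Set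
IsLineTrigraphOf {n} {h} G H =
  (Σ (Fin n → Fin h × Fin h) λ ends →
     (∀ i → adj H (proj₁ (ends i)) (proj₂ (ends i)) ≡ true) ×
     (∀ i j → SameEdge (ends i) (ends j) → i ≡ j) ×
     (∀ a b → adj H a b ≡ true → ∃ λ i → SameEdge (ends i) (a , b)) ×
     (∀ i j → i ≢ j → (fullAdj G i j ≡ true) ⇔ ShareEnd (ends i) (ends j)))
  × (∀ u v w → u ≢ v → u ≢ w → v ≢ w →
       θ G u v ≢ strongAnti → θ G u w ≢ strongAnti → θ G v w ≢ strongAnti →
       θ G u v ≡ strongAdj × θ G u w ≡ strongAdj × θ G v w ≡ strongAdj)

LineTrigraph : ∀ {n} → Trigraph n → Set
LineTrigraph G = ∃ λ h → Σ (Graph h) λ H → IsLineTrigraphOf G H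

data ReachOutside {n} (G : Trigraph n) (C : Subset n) : Fin n → Fin n → Set where
  here : ∀ {u} → u ∉ₛ C → ReachOutside G C u u
  step : ∀ {u v w} → ReachOutside G C u v → fullAdj G v w ≡ true → w ∉ₛ C →
         ReachOutside G C u w

Cutset : ∀ {n} → Trigraph n → Subset n → Set
Cutset {n} G C = Σ (Fin n) λ u → Σ (Fin n) λ v →
  u ∉ₛ C × v ∉ₛ C × ¬ ReachOutside G C u v

CliqueCutset : ∀ {n} → Trigraph n → Set
CliqueCutset {n} G = Σ (Subset n) λ C →
  (∀ u v → u ∈ₛ C → v ∈ₛ C → u ≢ v → θ G u v ≡ strongAdj) × Cutset G C

-- stable 2-cutset {a, b}: a ≠ b anti-adjacent (θ ≤ 0)
Stable2Cutset : ∀ {n} → Trigraph n → Set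
Stable2Cutset {n} G = Σ (Fin n) λ a → Σ (Fin n) λ b →
  a ≢ b × θ G a b ≢ strongAdj × Cutset G (⁅ a ⁆ ∪ ⁅ b ⁆)

{-# OPTIONS --safe #-}

-- Two vertices always form a strong clique or a stable set, so without the last two outcomes
-- the full realization F has no cutset of size at most two (and at least four vertices, since
-- smaller trigraphs are series-parallel).
--
-- The engine is a statement about a chordless cycle C of an {ISK4, wheel}-free graph: a chordless
-- path disjoint from C cannot have exactly three neighbours on C, and neither can a connected set
-- if C is not a triangle.  Hence no edge of F lies in two triangles.  Used both in F and in F minus
-- a semi-adjacent pair, it also shows that every triangle of G is strong.
--
-- If F has a claw centred at v, some hole C passes through v, and some leaf x of the claw is off C
-- and not adjacent to the neighbours of v on C.  Following the component of x off C, one finds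
-- either a triangle cutset or a K₃,₃, and a K₃,₃ extends to a complete bipartite graph spanning F.
-- If F has no claw, every vertex lies in exactly two maximal cliques, so F is the line graph of
-- the graph whose vertices are these cliques.
module Submission where

open import Defs
open import Data.Nat using (ℕ)
open import Data.Sum using (_⊎_)
import Algebra.Solver.CommutativeMonoid as CommutativeMonoidSolver
import Algebra.Solver.Monoid as MonoidSolver
open import Data.Bool using (Bool; true; false)
import Data.Bool as Bool
open import Data.Empty using (⊥; ⊥-elim)
open import Data.Fin using (Fin; zero; suc; toℕ; _≟_; combine; funToFin; finToFun)
import Data.Fin.Properties as Fin
open import Data.Fin.Properties using (toℕ-injective; toℕ<n; injective⇒≤; finToFun-funToFin)
open import Data.Fin.Subset using (Subset; _∪_; ⁅_⁆) renaming (_∈_ to _∈ₛ_; _∉_ to _∉ₛ_)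
open import Data.Fin.Subset.Properties using (x∈p∪q⁻; x∈p∪q⁺; x∈⁅y⁆⇒x≡y; x∈⁅x⁆) renaming (_∈?_ to _∈ₛ?_)
open import Data.List using (List; []; _∷_; _++_; [_]; length; lookup; reverse; map; tabulate)
import Data.List.Membership.DecPropositional as DecMembership
open import Data.List.Membership.Propositional using (_∈_; _∉_; mapWith∈; find; lose)
open import Data.List.Membership.Propositional.Properties
open import Data.List.Properties using (++-assoc; ++-identityʳ; ++-monoid; map-++; unfold-reverse; reverse-++)
open import Data.List.Relation.Binary.Permutation.Propositional using (_↭_; ↭⇒↭ₛ; ↭-sym; ↭-trans; ↭-refl; prep)
open import Data.List.Relation.Binary.Permutation.Propositional.Properties using (++-comm; ++-commutativeMonoid; ++⁺ˡ; ++⁺ʳ; ↭-length; ↭-reverse; ∈-resp-↭)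
import Data.List.Relation.Binary.Permutation.Setoid.Properties as SetoidPerm
open import Data.List.Relation.Unary.All using (All; []; _∷_)
import Data.List.Relation.Unary.All as All
import Data.List.Relation.Unary.All.Properties as All
open import Data.List.Relation.Unary.AllPairs using ([]; _∷_)
open import Data.List.Relation.Unary.Any using (Any; here; there; index)
import Data.List.Relation.Unary.Any as Any
import Data.List.Relation.Unary.Any.Properties as Any
open import Data.List.Relation.Unary.Any.Properties using (lookup-index)
open import Data.List.Relation.Unary.Unique.Propositional using (Unique)
import Data.List.Relation.Unary.Unique.Propositional.Properties as Unique
open import Data.Nat using (zero; suc; _+_; _^_; _%_; _≤_; _<_; z≤n; s≤s; _≤?_)
open import Data.Nat.DivMod using (m<n⇒m%n≡m; n%n≡0)
import Data.Nat.Properties as ℕ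
open import Data.Product using (∃; _×_; _,_; proj₁; proj₂)
open import Data.Sum using (inj₁; inj₂)
import Data.Sum as Sum
open import Function using (_∘_)
open import Function.Bundles using (_⇔_; mk⇔)
open import Function.Definitions using (Injective)
open import Relation.Binary.PropositionalEquality using (_≡_; _≢_; refl; sym; trans; cong; cong₂; subst; subst₂; setoid)
open import Relation.Nullary using (¬_; Dec; yes; no; does)
open import Relation.Nullary.Decidable using (_⊎-dec_; _×-dec_; ¬?; dec-true)

-- Why exactly three attachments: two merely give a theta, and four do occur, since in K₃,₃ the ends
-- of an edge off a square see all four of its vertices. That pattern, two attachments at each end
-- of a path, is the source of every K₃,₃ below. Removing an edge from K₃,₃ leaves a subdivision of
-- K₄ in which the ends of that edge have degree two. This forces a K₃,₃ to grow into a complete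
-- bipartite graph, and, applied after deleting a semi-adjacent pair, it makes all pairs across the
-- two sides strongly adjacent. A connected set may well have three neighbours on a triangle, as the
-- prism shows, so the component argument needs a longer hole. The triangle cutset comes from the
-- one case that the pattern above leaves open, a common neighbour of the ends of an edge of the
-- hole. No edge lies in two triangles, so a walk that avoids this neighbour as well meets no second
-- one. All case distinctions are constructive: claws are found by exhaustive search, cutsets
-- through decidable reachability.

First Last : ∀ {A : Set} → List A → A → Set
First []      _ = ⊥
First (x ∷ _) u = u ≡ x
Last []           _ = ⊥
Last (x ∷ [])     u = u ≡ x
Last (x ∷ y ∷ ys) u = Last (y ∷ ys) u

-- Lists as paths and cycles: consecutive entries under concatenation, rotation and reversal.

module _ {A : Set} where

  Link : List A → A → A → Set
  Link L u v = Consec L u v ⊎ Consec L v u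

  -- The successor relation of the closed list, kept oriented so that rotating the list preserves
  -- it; adjacency on a hole is this relation or its converse.
  Cyclic : List A → A → A → Set
  Cyclic L u v = Consec L u v ⊎ (Last L u × First L v)

  Apart : List A → List A → Set
  Apart P Q = ∀ {u} → u ∈ P → u ∈ Q → ⊥

  first-∈ : ∀ {P} {u : A} → First P u → u ∈ P
  first-∈ {_ ∷ _} refl = here refl

  last-∈ : ∀ {P} {u : A} → Last P u → u ∈ P
  last-∈ {_ ∷ []}     refl = here refl
  last-∈ {_ ∷ _ ∷ _} l    = there (last-∈ l)

  last-exists : ∀ x (P : List A) → ∃ (Last (x ∷ P))
  last-exists x []      = x , refl
  last-exists x (y ∷ P) = last-exists y P

  first-unique : ∀ P {u v : A} → First P u → First P v → u ≡ v
  first-unique (_ ∷ _) p q = trans p (sym q)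

  last-unique : ∀ P {u v : A} → Last P u → Last P v → u ≡ v
  last-unique (_ ∷ [])    p q = trans p (sym q)
  last-unique (_ ∷ y ∷ P) p q = last-unique (y ∷ P) p q

  consec-∈ˡ : ∀ P {u v : A} → Consec P u v → u ∈ P
  consec-∈ˡ (_ ∷ _ ∷ _) (inj₁ (refl , _)) = here refl
  consec-∈ˡ (_ ∷ y ∷ P) (inj₂ c)          = there (consec-∈ˡ (y ∷ P) c)

  consec-∈ʳ : ∀ P {u v : A} → Consec P u v → v ∈ P
  consec-∈ʳ (_ ∷ _ ∷ _) (inj₁ (_ , refl)) = there (here refl)
  consec-∈ʳ (_ ∷ y ∷ P) (inj₂ c)          = there (consec-∈ʳ (y ∷ P) c)

  first-++ˡ : ∀ {P Q} {u : A} → First P u → First (P ++ Q) u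
  first-++ˡ {_ ∷ _} f = f

  first-prefix : ∀ X {y : A} {Y v} → First (X ++ y ∷ Y) v → First (X ++ [ y ]) v
  first-prefix []      e = e
  first-prefix (_ ∷ _) e = e

  last-++ʳ : ∀ P {Q} {u : A} → Last Q u → Last (P ++ Q) u
  last-++ʳ []          l = l
  last-++ʳ (_ ∷ [])    {_ ∷ _} l = l
  last-++ʳ (_ ∷ y ∷ P) l = last-++ʳ (y ∷ P) l

  last-++⁻ : ∀ P {y Q} {u : A} → Last (P ++ y ∷ Q) u → Last (y ∷ Q) u
  last-++⁻ []          l = l
  last-++⁻ (_ ∷ [])    l = l
  last-++⁻ (_ ∷ y ∷ P) l = last-++⁻ (y ∷ P) l

  consec-++ˡ : ∀ P {Q} {u v : A} → Consec P u v → Consec (P ++ Q) u v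
  consec-++ˡ (_ ∷ _ ∷ _) (inj₁ e) = inj₁ e
  consec-++ˡ (_ ∷ y ∷ P) (inj₂ c) = inj₂ (consec-++ˡ (y ∷ P) c)

  consec-∷ : ∀ x Q {u v : A} → Consec Q u v → Consec (x ∷ Q) u v
  consec-∷ x (_ ∷ _) c = inj₂ c

  consec-++ʳ : ∀ P {Q} {u v : A} → Consec Q u v → Consec (P ++ Q) u v
  consec-++ʳ []      c = c
  consec-++ʳ (x ∷ P) c = consec-∷ x (P ++ _) (consec-++ʳ P c)

  consec-++ᵐ : ∀ P {Q} {u v : A} → Last P u → First Q v → Consec (P ++ Q) u v
  consec-++ᵐ (x ∷ [])    {_ ∷ _} l f = inj₁ (l , f)
  consec-++ᵐ (_ ∷ y ∷ P) l f = inj₂ (consec-++ᵐ (y ∷ P) l f)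

  consec-++⁻ : ∀ P {Q} {u v : A} → Consec (P ++ Q) u v →
               Consec P u v ⊎ Consec Q u v ⊎ (Last P u × First Q v)
  consec-++⁻ []                  c        = inj₂ (inj₁ c)
  consec-++⁻ (_ ∷ [])    {_ ∷ _} (inj₁ e) = inj₂ (inj₂ e)
  consec-++⁻ (_ ∷ [])    {_ ∷ _} (inj₂ c) = inj₂ (inj₁ c)
  consec-++⁻ (_ ∷ y ∷ P)         (inj₁ e) = inj₁ (inj₁ e)
  consec-++⁻ (_ ∷ y ∷ P)         (inj₂ c) = Sum.map₁ inj₂ (consec-++⁻ (y ∷ P) c)

  consec-split : ∀ P {y Q} {u v : A} → Consec (P ++ y ∷ Q) u v →
                 Consec (P ++ [ y ]) u v ⊎ Consec (y ∷ Q) u v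
  consec-split P c with consec-++⁻ P c
  ... | inj₁ c′              = inj₁ (consec-++ˡ P c′)
  ... | inj₂ (inj₁ c′)       = inj₂ c′
  ... | inj₂ (inj₂ (l , f)) = inj₁ (consec-++ᵐ P l f)

  consec-joinˡ : ∀ P {y Q} {u v : A} → Consec (P ++ [ y ]) u v → Consec (P ++ y ∷ Q) u v
  consec-joinˡ P {y} {Q} {u} {v} c =
    subst (λ L → Consec L u v) (++-assoc P [ y ] Q) (consec-++ˡ (P ++ [ y ]) c)

  cyclic-++⁻ : ∀ x P y Q {u v : A} → Cyclic ((x ∷ P) ++ (y ∷ Q)) u v →
    Consec (x ∷ P) u v ⊎ Consec (y ∷ Q) u v ⊎
    (Last (x ∷ P) u × First (y ∷ Q) v) ⊎ (Last (y ∷ Q) u × First (x ∷ P) v)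
  cyclic-++⁻ x P y Q (inj₁ c) with consec-++⁻ (x ∷ P) c
  ... | inj₁ c′        = inj₁ c′
  ... | inj₂ (inj₁ c′) = inj₂ (inj₁ c′)
  ... | inj₂ (inj₂ e)  = inj₂ (inj₂ (inj₁ e))
  cyclic-++⁻ x P y Q (inj₂ (l , f)) = inj₂ (inj₂ (inj₂ (last-++⁻ (x ∷ P) l , f)))

  cyclic-++⁺ : ∀ x P y Q {u v : A} →
    Consec (x ∷ P) u v ⊎ Consec (y ∷ Q) u v ⊎
    (Last (x ∷ P) u × First (y ∷ Q) v) ⊎ (Last (y ∷ Q) u × First (x ∷ P) v) →
    Cyclic ((x ∷ P) ++ (y ∷ Q)) u v
  cyclic-++⁺ x P y Q (inj₁ c)                     = inj₁ (consec-++ˡ (x ∷ P) c)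
  cyclic-++⁺ x P y Q (inj₂ (inj₁ c))              = inj₁ (consec-++ʳ (x ∷ P) c)
  cyclic-++⁺ x P y Q (inj₂ (inj₂ (inj₁ (l , f)))) = inj₁ (consec-++ᵐ (x ∷ P) l f)
  cyclic-++⁺ x P y Q (inj₂ (inj₂ (inj₂ (l , f)))) = inj₂ (last-++ʳ (x ∷ P) l , f)

  cyclic-rotate : ∀ P Q {u v : A} → Cyclic (P ++ Q) u v → Cyclic (Q ++ P) u v
  cyclic-rotate []      Q {u} {v} c = subst (λ L → Cyclic L u v) (sym (++-identityʳ Q)) c
  cyclic-rotate (x ∷ P) []  {u} {v} c = subst (λ L → Cyclic L u v) (++-identityʳ (x ∷ P)) c
  cyclic-rotate (x ∷ P) (y ∷ Q) c = cyclic-++⁺ y Q x P (turn (cyclic-++⁻ x P y Q c))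
    where
    turn : ∀ {a b c d : Set} → a ⊎ b ⊎ c ⊎ d → b ⊎ a ⊎ d ⊎ c
    turn (inj₁ x)               = inj₂ (inj₁ x)
    turn (inj₂ (inj₁ x))        = inj₁ x
    turn (inj₂ (inj₂ (inj₁ x))) = inj₂ (inj₂ (inj₂ x))
    turn (inj₂ (inj₂ (inj₂ x))) = inj₂ (inj₂ (inj₁ x))

  first-reverse : ∀ P {u : A} → Last P u → First (reverse P) u
  last-reverse  : ∀ P {u : A} → First P u → Last (reverse P) u
  first-reverse (x ∷ [])    l = l
  first-reverse (x ∷ y ∷ P) {u} l = subst (λ L → First L u) (sym (unfold-reverse x (y ∷ P)))
    (first-++ˡ {reverse (y ∷ P)} (first-reverse (y ∷ P) l))
  last-reverse (x ∷ P) {u} e = subst (λ L → Last L u) (sym (unfold-reverse x P)) (last-++ʳ (reverse P) e)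

  first-reverse⁻ : ∀ P {u : A} → First (reverse P) u → Last P u
  first-reverse⁻ (x ∷ []) f = f
  first-reverse⁻ (x ∷ y ∷ P) {u} f with last-exists y P
  ... | l , lst = subst (Last (y ∷ P)) (first-unique (reverse (x ∷ y ∷ P)) (first-reverse (x ∷ y ∷ P) lst) f) lst

  last-reverse⁻ : ∀ P {u : A} → Last (reverse P) u → First P u
  last-reverse⁻ (x ∷ P) l = last-unique (reverse (x ∷ P)) l (last-reverse (x ∷ P) refl)

  consec-reverse : ∀ P {u v : A} → Consec P u v → Consec (reverse P) v u
  consec-reverse (x ∷ y ∷ P) {u} {v} c =
    subst (λ L → Consec L v u) (sym (unfold-reverse x (y ∷ P))) (go c)
    where
    go : Consec (x ∷ y ∷ P) u v → Consec (reverse (y ∷ P) ++ [ x ]) v u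
    go (inj₁ (refl , refl)) = consec-++ᵐ (reverse (y ∷ P)) (last-reverse (y ∷ P) refl) refl
    go (inj₂ c′)            = consec-++ˡ (reverse (y ∷ P)) (consec-reverse (y ∷ P) c′)

  consec-reverse⁻ : ∀ P {u v : A} → Consec (reverse P) v u → Consec P u v
  consec-reverse⁻ (x ∷ P) {u} {v} c
    with consec-++⁻ (reverse P) (subst (λ L → Consec L v u) (unfold-reverse x P) c)
  ... | inj₁ c′             = consec-∷ x P (consec-reverse⁻ P c′)
  ... | inj₂ (inj₂ (l , refl)) = consec-++ᵐ [ x ] refl (last-reverse⁻ P l)

  ∈-reverse : ∀ {P} {u : A} → u ∈ reverse P → u ∈ P
  ∈-reverse {P} = ∈-resp-↭ (↭-reverse P)

  ∈-reverse⁺ : ∀ {P} {u : A} → u ∈ P → u ∈ reverse P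
  ∈-reverse⁺ {P} = ∈-resp-↭ (↭-sym (↭-reverse P))

  unique-resp-↭ : ∀ {P Q : List A} → P ↭ Q → Unique P → Unique Q
  unique-resp-↭ p = SetoidPerm.Unique-resp-↭ (setoid A) (↭⇒↭ₛ p)

  unique-++ˡ : ∀ P {Q : List A} → Unique (P ++ Q) → Unique P
  unique-++ˡ []      _       = []
  unique-++ˡ (x ∷ P) (a ∷ u) = All.++⁻ˡ P a ∷ unique-++ˡ P u

  unique-++ʳ : ∀ P {Q : List A} → Unique (P ++ Q) → Unique Q
  unique-++ʳ []      u       = u
  unique-++ʳ (x ∷ P) (_ ∷ u) = unique-++ʳ P u

  unique-apart : ∀ P {Q : List A} → Unique (P ++ Q) → Apart P Q
  unique-apart (x ∷ P) (a ∷ u) (here refl) q = All.lookup (All.++⁻ʳ P a) q refl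
  unique-apart (x ∷ P) (a ∷ u) (there p)   q = unique-apart P u p q

  unique-++ : ∀ {P Q : List A} → Unique P → Unique Q → Apart P Q → Unique (P ++ Q)
  unique-++ p q d = Unique.++⁺ p q (λ (x , y) → d x y)

  ∉⇒unique-∷ : ∀ {x} {P : List A} → x ∉ P → Unique P → Unique (x ∷ P)
  ∉⇒unique-∷ x∉ u = All.tabulate (λ { y∈ refl → x∉ y∈ }) ∷ u

  lookup-injective : ∀ {L : List A} → Unique L → ∀ {i j} → lookup L i ≡ lookup L j → i ≡ j
  lookup-injective {_ ∷ _} _ {zero} {zero} _ = refl
  lookup-injective {_ ∷ L} (a ∷ _) {zero} {suc j} e = ⊥-elim (All.lookup a (∈-lookup j) e)
  lookup-injective {_ ∷ L} (a ∷ _) {suc i} {zero} e = ⊥-elim (All.lookup a (∈-lookup i) (sym e))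
  lookup-injective {_ ∷ L} (_ ∷ u) {suc i} {suc j} e = cong suc (lookup-injective u e)

  module _ {P : A → Set} (P? : ∀ x → Dec (P x)) where

    first-split : ∀ {L} → Any P L → ∃ λ X → ∃ λ s → ∃ λ Y → L ≡ X ++ s ∷ Y × P s × All (¬_ ∘ P) X
    first-split {x ∷ L} a with P? x | a
    ... | yes p | _       = [] , x , L , refl , p , []
    ... | no ¬p | here p  = ⊥-elim (¬p p)
    ... | no ¬p | there b with first-split b
    ...   | X , s , Y , refl , ps , np = x ∷ X , s , Y , refl , ps , ¬p ∷ np

    last-split : ∀ {L} → Any P L → ∃ λ X → ∃ λ s → ∃ λ Y → L ≡ X ++ s ∷ Y × P s × All (¬_ ∘ P) Y
    last-split {x ∷ L} a with Any.any? P? L | a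
    ... | yes b | _       with last-split b
    ...   | X , s , Y , refl , ps , np = x ∷ X , s , Y , refl , ps , np
    last-split {x ∷ L} a | no ¬b | here p  = [] , x , L , refl , p , All.¬Any⇒All¬ L ¬b
    last-split {x ∷ L} a | no ¬b | there b = ⊥-elim (¬b b)

-- Positions of consecutive entries, and finite families of lists.

module _ {A : Set} where

  consec-index : ∀ L {u v : A} → Consec L u v →
    ∃ λ i → ∃ λ j → lookup L i ≡ u × lookup L j ≡ v × suc (toℕ i) ≡ toℕ j
  consec-index (x ∷ y ∷ L) (inj₁ (refl , refl)) = zero , suc zero , refl , refl , refl
  consec-index (x ∷ y ∷ L) (inj₂ c) with consec-index (y ∷ L) c
  ... | i , j , p , q , e = suc i , suc j , p , q , cong suc e

  index-consec : ∀ (L : List A) i j → suc (toℕ i) ≡ toℕ j → Consec L (lookup L i) (lookup L j)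
  index-consec (x ∷ y ∷ L) zero    (suc zero) _ = inj₁ (refl , refl)
  index-consec (x ∷ y ∷ L) (suc i) (suc j)    e = inj₂ (index-consec (y ∷ L) i j (ℕ.suc-injective e))

  last-index : ∀ L {u : A} → Last L u → ∃ λ i → lookup L i ≡ u × suc (toℕ i) ≡ length L
  last-index (x ∷ [])    refl = zero , refl , refl
  last-index (x ∷ y ∷ L) l with last-index (y ∷ L) l
  ... | i , p , e = suc i , p , cong suc e

  index-last : ∀ (L : List A) i → suc (toℕ i) ≡ length L → Last L (lookup L i)
  index-last (x ∷ [])    zero    _ = refl
  index-last (x ∷ y ∷ L) (suc i) e = index-last (y ∷ L) i (ℕ.suc-injective e)

  -- Matches `Cyclic` with the modular arithmetic of `CycAdj`: the remainder changes the successor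
  -- only at the last position, which is the wrap-around case.
  cyclic-index : ∀ x xs → let L = x ∷ xs in Unique L → ∀ i j →
    Cyclic L (lookup L i) (lookup L j) → suc (toℕ i) % length L ≡ toℕ j
  cyclic-index x xs uq i j (inj₁ c) with consec-index (x ∷ xs) c
  ... | i′ , j′ , p , q , e with lookup-injective uq {i′} {i} p | lookup-injective uq {j′} {j} q
  ... | refl | refl = trans (m<n⇒m%n≡m (subst (_< length (x ∷ xs)) (sym e) (toℕ<n j))) e
  cyclic-index x xs uq i j (inj₂ (l , f)) with last-index (x ∷ xs) l
  ... | i′ , p , e with lookup-injective uq {i′} {i} p | lookup-injective uq {j} {zero} f
  ... | refl | refl = trans (cong (_% length (x ∷ xs)) e) (n%n≡0 (length (x ∷ xs)))

  index-cyclic : ∀ x xs → let L = x ∷ xs in ∀ i j →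
    suc (toℕ i) % length L ≡ toℕ j → Cyclic L (lookup L i) (lookup L j)
  index-cyclic x xs i j e with ℕ.m≤n⇒m<n∨m≡n (toℕ<n i)
  ... | inj₁ lt = inj₁ (index-consec (x ∷ xs) i j (trans (sym (m<n⇒m%n≡m lt)) e))
  ... | inj₂ eq = inj₂ (index-last (x ∷ xs) i eq , cong (lookup (x ∷ xs)) j≡0)
    where
    j≡0 : j ≡ zero
    j≡0 = toℕ-injective (trans (sym e) (trans (cong (_% length (x ∷ xs)) eq) (n%n≡0 (length (x ∷ xs)))))

  flatten : ∀ {k} → (Fin k → List A) → List A
  flatten {ℕ.zero} f = []
  flatten {suc k}  f = f zero ++ flatten (f ∘ suc)

  ∈-flatten : ∀ {k} (f : Fin k → List A) e {v} → v ∈ f e → v ∈ flatten f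
  ∈-flatten f zero    m = ∈-++⁺ˡ m
  ∈-flatten f (suc e) m = ∈-++⁺ʳ (f zero) (∈-flatten (f ∘ suc) e m)

  flatten-∈ : ∀ {k} (f : Fin k → List A) {v} → v ∈ flatten f → ∃ λ e → v ∈ f e
  flatten-∈ {suc k} f m with ∈-++⁻ (f zero) m
  ... | inj₁ p = zero , p
  ... | inj₂ p with flatten-∈ (f ∘ suc) p
  ...   | e , q = suc e , q

  flatten-unique : ∀ {k} (f : Fin k → List A) → Unique (flatten f) → ∀ e → Unique (f e)
  flatten-unique f u zero    = unique-++ˡ (f zero) u
  flatten-unique f u (suc e) = flatten-unique (f ∘ suc) (unique-++ʳ (f zero) u) e

  flatten-disjoint : ∀ {k} (f : Fin k → List A) → Unique (flatten f) →
                     ∀ e e′ {v} → v ∈ f e → v ∈ f e′ → e ≡ e′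
  flatten-disjoint f u zero    zero     p q = refl
  flatten-disjoint f u zero    (suc e′) p q = ⊥-elim (unique-apart (f zero) u p (∈-flatten (f ∘ suc) e′ q))
  flatten-disjoint f u (suc e) zero     p q = ⊥-elim (unique-apart (f zero) u q (∈-flatten (f ∘ suc) e p))
  flatten-disjoint f u (suc e) (suc e′) p q =
    cong suc (flatten-disjoint (f ∘ suc) (unique-++ʳ (f zero) u) e e′ p q)

consec-map : ∀ {A B : Set} (f : A → B) L {u v} → Consec L u v → Consec (map f L) (f u) (f v)
consec-map f (_ ∷ _ ∷ _) (inj₁ (p , q)) = inj₁ (cong f p , cong f q)
consec-map f (_ ∷ y ∷ L) (inj₂ c)       = inj₂ (consec-map f (y ∷ L) c)

consec-map⁻ : ∀ {A B : Set} {f : A → B} → Injective _≡_ _≡_ f →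
              ∀ L {u v} → Consec (map f L) (f u) (f v) → Consec L u v
consec-map⁻ inj (_ ∷ _ ∷ _) (inj₁ (p , q)) = inj₁ (inj p , inj q)
consec-map⁻ inj (_ ∷ y ∷ L) (inj₂ c)       = inj₂ (consec-map⁻ inj (y ∷ L) c)

tabulate-injective : ∀ {A : Set} {k} (f : Fin k → A) → Unique (tabulate f) → Injective _≡_ _≡_ f
tabulate-injective f (a ∷ u) {zero}  {zero}  e = refl
tabulate-injective f (a ∷ u) {zero}  {suc j} e = ⊥-elim (All.lookup a (∈-tabulate⁺ j) e)
tabulate-injective f (a ∷ u) {suc i} {zero}  e = ⊥-elim (All.lookup a (∈-tabulate⁺ i) (sym e))
tabulate-injective f (a ∷ u) {suc i} {suc j} e = cong suc (tabulate-injective (f ∘ suc) u e)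

pullback : ∀ {m n} → Graph n → (Fin m → Fin n) → Graph m
pullback R f = record
  { adj     = λ i j → adj R (f i) (f j)
  ; adj-sym = λ i j → adj-sym R (f i) (f j)
  ; adj-irr = λ i → adj-irr R (f i)
  }

k4edge-proper : ∀ e → proj₁ (k4edge e) ≢ proj₂ (k4edge e)
k4edge-proper zero                               ()
k4edge-proper (suc zero)                         ()
k4edge-proper (suc (suc zero))                   ()
k4edge-proper (suc (suc (suc zero)))             ()
k4edge-proper (suc (suc (suc (suc zero))))       ()
k4edge-proper (suc (suc (suc (suc (suc zero))))) ()

-- Lists of vertices that certify an induced wheel or an induced subdivision of K₄.

module Certificates {n : ℕ} (R : Graph n) where

  V : Set
  V = Fin n

  infix 4 _~_ _~?_
  _~_ : V → V → Set
  u ~ v = adj R u v ≡ true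

  _~?_ : ∀ u v → Dec (u ~ v)
  u ~? v = adj R u v Bool.≟ true

  ~-sym : ∀ {u v} → u ~ v → v ~ u
  ~-sym {u} {v} e = trans (adj-sym R v u) e

  ~-irr : ∀ {u} → ¬ (u ~ u)
  ~-irr {u} e with trans (sym e) (adj-irr R u)
  ... | ()

  ~⇒≢ : ∀ {u v} → u ~ v → u ≢ v
  ~⇒≢ e refl = ~-irr e

  -- Triangles count as holes here. This is what lets the results on attachments be applied to a
  -- triangle, as in the proof that no edge lies in two triangles.
  record Hole (L : List V) : Set where
    constructor mkHole
    field
      uniq      : Unique L
      edge      : ∀ {u v} → Cyclic L u v → u ~ v
      chordless : ∀ {u v} → u ∈ L → v ∈ L → u ~ v → Cyclic L u v ⊎ Cyclic L v u
      long      : 3 ≤ length L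

  -- The induced subgraph is indexed by positions in `x ∷ L`, so `zero` is the centre and `suc`
  -- itself enumerates the rim.
  hole-wheel : ∀ {L x u v w} → Hole L → x ∉ L → u ∈ L → v ∈ L → w ∈ L →
               u ≢ v → u ≢ w → v ≢ w → x ~ u → x ~ v → x ~ w → HasInducedWheel R
  hole-wheel {L@(a ∷ b ∷ c ∷ rest)} {x} (mkHole uq ed ch lg) x∉ u∈ v∈ w∈ u≢v u≢w v≢w xu xv xw =
    suc (length L) , pullback R f , wheel , f , f-inj , λ i j → refl
    where
    f : Fin (suc (length L)) → V
    f = lookup (x ∷ L)
    f-inj : Injective _≡_ _≡_ f
    f-inj = lookup-injective (∉⇒unique-∷ x∉ uq)
    at : ∀ {y} (p : y ∈ L) → lookup L (index p) ≡ y
    at p = sym (lookup-index p)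
    apart : ∀ {y z} (p : y ∈ L) (q : z ∈ L) → y ≢ z → index p ≢ index q
    apart p q ne e = ne (trans (sym (at p)) (trans (cong (lookup L) e) (at q)))
    hit : ∀ {y} (p : y ∈ L) → x ~ y → x ~ lookup L (index p)
    hit p = subst (x ~_) (sym (at p))
    covers : ∀ (i : Fin (suc (length L))) → i ≡ zero ⊎ (∃ λ j → i ≡ suc j)
    covers zero    = inj₁ refl
    covers (suc j) = inj₂ (j , refl)
    wheel : IsWheel (pullback R f)
    wheel = record
      { len        = length rest
      ; cyc        = suc
      ; cyc-inj    = λ { refl → refl }
      ; centre     = zero
      ; centre-off = λ i ()
      ; covers     = covers
      ; chordless  = λ i j → mk⇔
          (λ e → Sum.map (cyclic-index a (b ∷ c ∷ rest) uq i j) (cyclic-index a (b ∷ c ∷ rest) uq j i)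
                   (ch (∈-lookup i) (∈-lookup j) e))
          (λ { (inj₁ e) → ed (index-cyclic a (b ∷ c ∷ rest) i j e)
             ; (inj₂ e) → ~-sym (ed (index-cyclic a (b ∷ c ∷ rest) j i e)) })
      ; n₁ = index u∈ ; n₂ = index v∈ ; n₃ = index w∈
      ; n-distinct = apart u∈ v∈ u≢v , apart u∈ w∈ u≢w , apart v∈ w∈ v≢w
      ; n-adj      = hit u∈ xu , hit v∈ xv , hit w∈ xw
      }
  hole-wheel {_ ∷ []}     (mkHole _ _ _ (s≤s ()))
  hole-wheel {_ ∷ _ ∷ []} (mkHole _ _ _ (s≤s (s≤s ())))

  -- One duplicate-free list of all branch and interior vertices carries every disjointness
  -- condition of `IsSubdivK4`. The induced subgraph lives on positions in this list, and the
  -- interior lists are pulled back to positions along their membership proofs.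
  six-paths : (branch : Fin 4 → V) (interior : Fin 6 → List V) →
    let path = λ e → branch (proj₁ (k4edge e)) ∷ (interior e ++ [ branch (proj₂ (k4edge e)) ])
        L    = tabulate branch ++ flatten interior in
    Unique L →
    (∀ e {u v} → Consec (path e) u v → u ~ v) →
    (∀ {u v} → u ∈ L → v ∈ L → u ~ v → ∃ λ e → Link (path e) u v) →
    HasInducedSubdivK4 R
  six-paths branch interior uq ed ch =
    length L , pullback R f , subdiv , f , f-inj , λ i j → refl
    where
    L : List V
    L = tabulate branch ++ flatten interior
    f : Fin (length L) → V
    f = lookup L
    f-inj : Injective _≡_ _≡_ f
    f-inj = lookup-injective uq
    pull : ∀ xs → (∀ {v} → v ∈ xs → v ∈ L) → List (Fin (length L))
    pull xs s = mapWith∈ xs (index ∘ s)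
    map-pull : ∀ xs (s : ∀ {v} → v ∈ xs → v ∈ L) → map f (pull xs s) ≡ xs
    map-pull xs s = trans (map-mapWith∈ xs (index ∘ s) f)
      (trans (mapWith∈-cong xs _ _ (λ p → sym (lookup-index (s p)))) (mapWith∈-id xs))
    branch∈ : ∀ k → branch k ∈ L
    branch∈ k = ∈-++⁺ˡ (∈-tabulate⁺ {f = branch} k)
    int∈ : ∀ e {v} → v ∈ interior e → v ∈ L
    int∈ e m = ∈-++⁺ʳ (tabulate branch) (∈-flatten interior e m)
    br : Fin 4 → Fin (length L)
    br k = index (branch∈ k)
    f-br : ∀ k → f (br k) ≡ branch k
    f-br k = sym (lookup-index (branch∈ k))
    int : Fin 6 → List (Fin (length L))
    int e = pull (interior e) (int∈ e)
    f-int : ∀ e {i} → i ∈ int e → f i ∈ interior e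
    f-int e {i} m = subst (f i ∈_) (map-pull (interior e) (int∈ e)) (∈-map⁺ f m)
    path : Fin 6 → List V
    path e = branch (proj₁ (k4edge e)) ∷ (interior e ++ [ branch (proj₂ (k4edge e)) ])
    pathₘ : Fin 6 → List (Fin (length L))
    pathₘ e = br (proj₁ (k4edge e)) ∷ (int e ++ [ br (proj₂ (k4edge e)) ])
    map-path : ∀ e → map f (pathₘ e) ≡ path e
    map-path e = cong₂ _∷_ (f-br _) (trans (map-++ f (int e) _)
      (cong₂ (λ a b → a ++ [ b ]) (map-pull (interior e) (int∈ e)) (f-br _)))
    branch-inj : Injective _≡_ _≡_ branch
    branch-inj = tabulate-injective branch (unique-++ˡ (tabulate branch) uq)
    avoid : ∀ e k → branch k ∉ interior e
    avoid e k m = unique-apart (tabulate branch) uq (∈-tabulate⁺ {f = branch} k) (∈-flatten interior e m)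
    path-uq : ∀ e → Unique (path e)
    path-uq e = ∉⇒unique-∷
      (λ m → Sum.[ avoid e _ , (λ { (here eq) → k4edge-proper e (branch-inj eq) }) ]′ (∈-++⁻ (interior e) m))
      (unique-++ (flatten-unique interior (unique-++ʳ (tabulate branch) uq) e) ([] ∷ [])
        (λ { m (here refl) → avoid e _ m }))
    ∈-pull : ∀ e i → f i ∈ interior e → i ∈ int e
    ∈-pull e i m with ∈-map⁻ f (subst (f i ∈_) (sym (map-pull (interior e) (int∈ e))) m)
    ... | j , j∈ , eq = subst (_∈ int e) (sym (f-inj eq)) j∈
    covers : ∀ i → (∃ λ k → i ≡ br k) ⊎ (∃ λ e → i ∈ int e)
    covers i with ∈-++⁻ (tabulate branch) (∈-lookup {xs = L} i)
    ... | inj₁ m with ∈-tabulate⁻ m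
    ...   | k , eq = inj₁ (k , f-inj (trans eq (sym (f-br k))))
    covers i | inj₂ m with flatten-∈ interior m
    ...   | e , m′ = inj₂ (e , ∈-pull e i m′)
    push : ∀ e {i j} → Consec (path e) (f i) (f j) → Consec (pathₘ e) i j
    push e {i} {j} c = consec-map⁻ f-inj (pathₘ e) (subst (λ P → Consec P (f i) (f j)) (sym (map-path e)) c)
    pop : ∀ e {i j} → Consec (pathₘ e) i j → f i ~ f j
    pop e {i} {j} c = ed e (subst (λ P → Consec P (f i) (f j)) (map-path e) (consec-map f (pathₘ e) c))
    subdiv : IsSubdivK4 (pullback R f)
    subdiv = record
      { branch     = br
      ; branch-inj = λ {k} {l} e → branch-inj (trans (sym (f-br k)) (trans (cong f e) (f-br l)))
      ; interior   = int
      ; path-simple = λ e → Unique.map⁻ (subst Unique (sym (map-path e)) (path-uq e))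
      ; interior-avoids-branch = λ { e i k m refl → avoid e k (subst (_∈ interior e) (f-br k) (f-int e m)) }
      ; interiors-disjoint = λ e e′ i p q →
          flatten-disjoint interior (unique-++ʳ (tabulate branch) uq) e e′ (f-int e p) (f-int e′ q)
      ; covers     = covers
      ; edges      = λ i j → mk⇔
          (λ a → let (e , l) = ch (∈-lookup i) (∈-lookup j) a in e , Sum.map (push e) (push e) l)
          (λ { (e , inj₁ c) → pop e c ; (e , inj₂ c) → ~-sym (pop e c) })
      }

-- Chordless paths and holes: cutting, gluing, and a first source of subdivisions of K₄.

module Paths {n : ℕ} (R : Graph n) where
  open Certificates R public

  record Path (P : List V) : Set where
    constructor mkPath
    field
      uniq      : Unique P
      edge      : ∀ {u v} → Consec P u v → u ~ v
      chordless : ∀ {u v} → u ∈ P → v ∈ P → u ~ v → Link P u v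

  path-[] : Path []
  path-[] = mkPath [] (λ ()) (λ ())

  path-[_] : ∀ x → Path [ x ]
  path-[ x ] = mkPath ([] ∷ []) (λ ()) (λ { (here refl) (here refl) e → ⊥-elim (~-irr e) })

  path-++ : ∀ {P Q} → Path P → Path Q → Apart P Q →
    (∀ {u v} → Last P u → First Q v → u ~ v) →
    (∀ {u v} → u ∈ P → v ∈ Q → u ~ v → Last P u × First Q v) → Path (P ++ Q)
  path-++ {P} {Q} (mkPath up ep cp) (mkPath uq eq cq) apart join cross =
    mkPath (unique-++ up uq apart) ed ch
    where
    ed : ∀ {u v} → Consec (P ++ Q) u v → u ~ v
    ed c with consec-++⁻ P c
    ... | inj₁ c′              = ep c′
    ... | inj₂ (inj₁ c′)       = eq c′
    ... | inj₂ (inj₂ (l , f)) = join l f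
    ch : ∀ {u v} → u ∈ P ++ Q → v ∈ P ++ Q → u ~ v → Link (P ++ Q) u v
    ch u∈ v∈ e with ∈-++⁻ P u∈ | ∈-++⁻ P v∈
    ... | inj₁ p | inj₁ q = Sum.map (consec-++ˡ P) (consec-++ˡ P) (cp p q e)
    ... | inj₂ p | inj₂ q = Sum.map (consec-++ʳ P) (consec-++ʳ P) (cq p q e)
    ... | inj₁ p | inj₂ q = let (l , f) = cross p q e in inj₁ (consec-++ᵐ P l f)
    ... | inj₂ p | inj₁ q = let (l , f) = cross q p (~-sym e) in inj₂ (consec-++ᵐ P l f)

  path-++ˡ : ∀ P {Q} → Path (P ++ Q) → Path P
  path-++ˡ P {Q} (mkPath uq ed ch) = mkPath (unique-++ˡ P uq) (ed ∘ consec-++ˡ P) ch′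
    where
    inside : ∀ {u v} → u ∈ P → v ∈ P → Consec (P ++ Q) u v → Consec P u v
    inside u∈ v∈ c with consec-++⁻ P c
    ... | inj₁ c′              = c′
    ... | inj₂ (inj₁ c′)       = ⊥-elim (unique-apart P uq u∈ (consec-∈ˡ Q c′))
    ... | inj₂ (inj₂ (_ , f)) = ⊥-elim (unique-apart P uq v∈ (first-∈ f))
    ch′ : ∀ {u v} → u ∈ P → v ∈ P → u ~ v → Link P u v
    ch′ u∈ v∈ e = Sum.map (inside u∈ v∈) (inside v∈ u∈) (ch (∈-++⁺ˡ u∈) (∈-++⁺ˡ v∈) e)

  path-++ʳ : ∀ P {Q} → Path (P ++ Q) → Path Q
  path-++ʳ P {Q} (mkPath uq ed ch) = mkPath (unique-++ʳ P uq) (ed ∘ consec-++ʳ P) ch′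
    where
    inside : ∀ {u v} → u ∈ Q → v ∈ Q → Consec (P ++ Q) u v → Consec Q u v
    inside u∈ v∈ c with consec-++⁻ P c
    ... | inj₁ c′              = ⊥-elim (unique-apart P uq (consec-∈ˡ P c′) u∈)
    ... | inj₂ (inj₁ c′)       = c′
    ... | inj₂ (inj₂ (l , _)) = ⊥-elim (unique-apart P uq (last-∈ l) u∈)
    ch′ : ∀ {u v} → u ∈ Q → v ∈ Q → u ~ v → Link Q u v
    ch′ u∈ v∈ e = Sum.map (inside u∈ v∈) (inside v∈ u∈) (ch (∈-++⁺ʳ P u∈) (∈-++⁺ʳ P v∈) e)

  path-cross : ∀ P {Q} → Path (P ++ Q) → ∀ {u v} → u ∈ P → v ∈ Q → u ~ v → Last P u × First Q v
  path-cross P {Q} (mkPath uq ed ch) u∈ v∈ e with ch (∈-++⁺ˡ u∈) (∈-++⁺ʳ P v∈) e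
  ... | inj₁ c with consec-++⁻ P c
  ...   | inj₁ c′        = ⊥-elim (unique-apart P uq (consec-∈ʳ P c′) v∈)
  ...   | inj₂ (inj₁ c′) = ⊥-elim (unique-apart P uq u∈ (consec-∈ˡ Q c′))
  ...   | inj₂ (inj₂ lf) = lf
  path-cross P {Q} (mkPath uq ed ch) u∈ v∈ e | inj₂ c with consec-++⁻ P c
  ...   | inj₁ c′              = ⊥-elim (unique-apart P uq (consec-∈ˡ P c′) v∈)
  ...   | inj₂ (inj₁ c′)       = ⊥-elim (unique-apart P uq u∈ (consec-∈ʳ Q c′))
  ...   | inj₂ (inj₂ (l , f)) = ⊥-elim (unique-apart P uq (last-∈ l) v∈)

  path-reverse : ∀ {P} → Path P → Path (reverse P)
  path-reverse {P} (mkPath uq ed ch) = mkPath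
    (unique-resp-↭ (↭-sym (↭-reverse P)) uq)
    (~-sym ∘ ed ∘ consec-reverse⁻ P)
    (λ u∈ v∈ e → Sum.swap (Sum.map (consec-reverse P) (consec-reverse P) (ch (∈-reverse u∈) (∈-reverse v∈) e)))

  hole-rotate : ∀ P Q → Hole (P ++ Q) → Hole (Q ++ P)
  hole-rotate P Q (mkHole uq ed ch lg) = mkHole
    (unique-resp-↭ (++-comm P Q) uq)
    (ed ∘ cyclic-rotate Q P)
    (λ u∈ v∈ e → Sum.map (cyclic-rotate P Q) (cyclic-rotate P Q)
       (ch (∈-resp-↭ (++-comm Q P) u∈) (∈-resp-↭ (++-comm Q P) v∈) e))
    (subst (3 ≤_) (↭-length (++-comm P Q)) lg)

  -- The witness `w` makes Q nonempty; otherwise the closing edge of the hole would join the two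
  -- ends of P.
  hole-path : ∀ P Q {w} → w ∈ Q → Hole (P ++ Q) → Path P
  hole-path [] Q _ _ = path-[]
  hole-path (x ∷ P) (y ∷ Q) _ (mkHole uq ed ch _) = mkPath
    (unique-++ˡ (x ∷ P) uq) (λ c → ed (inj₁ (consec-++ˡ (x ∷ P) c)))
    (λ u∈ v∈ e → Sum.map (inside u∈ v∈) (inside v∈ u∈) (ch (∈-++⁺ˡ u∈) (∈-++⁺ˡ v∈) e))
    where
    inside : ∀ {u v} → u ∈ x ∷ P → v ∈ x ∷ P → Cyclic ((x ∷ P) ++ (y ∷ Q)) u v → Consec (x ∷ P) u v
    inside u∈ v∈ c with cyclic-++⁻ x P y Q c
    ... | inj₁ c′                     = c′
    ... | inj₂ (inj₁ c′)              = ⊥-elim (unique-apart (x ∷ P) uq u∈ (consec-∈ˡ (y ∷ Q) c′))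
    ... | inj₂ (inj₂ (inj₁ (_ , f))) = ⊥-elim (unique-apart (x ∷ P) uq v∈ (first-∈ {P = y ∷ Q} f))
    ... | inj₂ (inj₂ (inj₂ (l , _))) = ⊥-elim (unique-apart (x ∷ P) uq u∈ (last-∈ {P = y ∷ Q} l))

  hole-cross : ∀ P Q → Hole (P ++ Q) → ∀ {u v} → u ∈ P → v ∈ Q → u ~ v →
               (Last P u × First Q v) ⊎ (First P u × Last Q v)
  hole-cross (x ∷ P) (y ∷ Q) (mkHole uq ed ch _) {u} {v} u∈ v∈ e with ch (∈-++⁺ˡ u∈) (∈-++⁺ʳ (x ∷ P) v∈) e
  ... | inj₁ c with cyclic-++⁻ x P y Q c
  ...   | inj₁ c′                     = ⊥-elim (unique-apart (x ∷ P) uq (consec-∈ʳ (x ∷ P) c′) v∈)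
  ...   | inj₂ (inj₁ c′)              = ⊥-elim (unique-apart (x ∷ P) uq u∈ (consec-∈ˡ (y ∷ Q) c′))
  ...   | inj₂ (inj₂ (inj₁ lf))       = inj₁ lf
  ...   | inj₂ (inj₂ (inj₂ (l , _))) = ⊥-elim (unique-apart (x ∷ P) uq u∈ (last-∈ {P = y ∷ Q} l))
  hole-cross (x ∷ P) (y ∷ Q) (mkHole uq ed ch _) {u} {v} u∈ v∈ e | inj₂ c with cyclic-++⁻ x P y Q c
  ...   | inj₁ c′                     = ⊥-elim (unique-apart (x ∷ P) uq (consec-∈ˡ (x ∷ P) c′) v∈)
  ...   | inj₂ (inj₁ c′)              = ⊥-elim (unique-apart (x ∷ P) uq u∈ (consec-∈ʳ (y ∷ Q) c′))
  ...   | inj₂ (inj₂ (inj₁ (l , _))) = ⊥-elim (unique-apart (x ∷ P) uq (last-∈ {P = x ∷ P} l) v∈)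
  ...   | inj₂ (inj₂ (inj₂ (l , f))) = inj₂ (f , l)

  -- The members `p` and `q` say that both paths are nonempty. The only edges allowed between the
  -- paths are the two that close the cycle, so no chord can arise.
  hole-glue : ∀ {P Q p q} → Path P → Path Q → Apart P Q → p ∈ P → q ∈ Q → 3 ≤ length (P ++ Q) →
    (∀ {u v} → Last P u → First Q v → u ~ v) →
    (∀ {u v} → First P u → Last Q v → u ~ v) →
    (∀ {u v} → u ∈ P → v ∈ Q → u ~ v → (Last P u × First Q v) ⊎ (First P u × Last Q v)) →
    Hole (P ++ Q)
  hole-glue {x ∷ P} {y ∷ Q} (mkPath up ep cp) (mkPath uq eq cq) apart _ _ lg join wrap cross =
    mkHole (unique-++ up uq apart) (ed ∘ cyclic-++⁻ x P y Q) ch lg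
    where
    ed : ∀ {u v} → _ → u ~ v
    ed (inj₁ c)                     = ep c
    ed (inj₂ (inj₁ c))              = eq c
    ed (inj₂ (inj₂ (inj₁ (l , f)))) = join l f
    ed (inj₂ (inj₂ (inj₂ (l , f)))) = ~-sym (wrap f l)
    mix : ∀ {u v} → (Last (x ∷ P) u × First (y ∷ Q) v) ⊎ (First (x ∷ P) u × Last (y ∷ Q) v) →
          Cyclic ((x ∷ P) ++ (y ∷ Q)) u v ⊎ Cyclic ((x ∷ P) ++ (y ∷ Q)) v u
    mix (inj₁ lf)       = inj₁ (cyclic-++⁺ x P y Q (inj₂ (inj₂ (inj₁ lf))))
    mix (inj₂ (f , l)) = inj₂ (cyclic-++⁺ x P y Q (inj₂ (inj₂ (inj₂ (l , f)))))
    ch : ∀ {u v} → u ∈ (x ∷ P) ++ (y ∷ Q) → v ∈ (x ∷ P) ++ (y ∷ Q) → u ~ v →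
         Cyclic ((x ∷ P) ++ (y ∷ Q)) u v ⊎ Cyclic ((x ∷ P) ++ (y ∷ Q)) v u
    ch u∈ v∈ e with ∈-++⁻ (x ∷ P) u∈ | ∈-++⁻ (x ∷ P) v∈
    ... | inj₁ p | inj₁ q = Sum.map (cyclic-++⁺ x P y Q ∘ inj₁) (cyclic-++⁺ x P y Q ∘ inj₁) (cp p q e)
    ... | inj₂ p | inj₂ q = Sum.map (cyclic-++⁺ x P y Q ∘ inj₂ ∘ inj₁) (cyclic-++⁺ x P y Q ∘ inj₂ ∘ inj₁) (cq p q e)
    ... | inj₁ p | inj₂ q = mix (cross p q e)
    ... | inj₂ p | inj₁ q = Sum.swap (mix (cross q p (~-sym e)))

  -- The branch vertices are a, b, x and c. The hole supplies the three subdivided edges among a, b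
  -- and c, the vertex x splits P into two more, and W is the sixth; W may be empty, in which case b
  -- sees x.
  hole-tripod-isk4 : ∀ {a α b β c γ P₁ x P₂ W f l} →
    let L = a ∷ α ++ b ∷ β ++ c ∷ γ ; P = P₁ ++ x ∷ P₂ ; leg = b ∷ W ++ [ x ] in
    Hole L → Path P → Unique W → Apart L P → Apart L W → Apart P W →
    First P f → Last P l → a ~ f → c ~ l →
    (∀ {u v} → Consec leg u v → u ~ v) →
    (∀ {u v} → u ∈ L → v ∈ P → u ~ v → (u ≡ a × v ≡ f) ⊎ (u ≡ c × v ≡ l) ⊎ Consec leg u v) →
    (∀ {u v} → u ∈ L → v ∈ W → u ~ v → Consec leg u v) →
    (∀ {u v} → u ∈ P → v ∈ W → u ~ v → Consec leg v u) →
    (∀ {u v} → u ∈ W → v ∈ W → u ~ v → Link W u v) →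
    HasInducedSubdivK4 R
  hole-tripod-isk4 {a} {α} {b} {β} {c} {γ} {P₁} {x} {P₂} {W} {f} {l}
    (mkHole uL eL cL _) (mkPath uP eP cP) uW L#P L#W P#W fst lst a~f c~l eW LP LW PW WW =
    six-paths branch interior (unique-resp-↭ perm (unique-++ uL (unique-++ uP uW P#W) L#PW)) ed
      (λ u∈ v∈ → ch (part u∈) (part v∈))
    where
    L = a ∷ α ++ b ∷ β ++ c ∷ γ
    P = P₁ ++ x ∷ P₂
    open CommutativeMonoidSolver (++-commutativeMonoid {A = V}) using (solve; _⊜_; _⊕_; id)
    branch : Fin 4 → V
    branch zero                   = a
    branch (suc zero)             = b
    branch (suc (suc zero))       = x
    branch (suc (suc (suc zero))) = c
    interior : Fin 6 → List V
    interior zero                               = α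
    interior (suc zero)                         = P₁
    -- `k4edge` orients this edge from a to c, whereas the hole runs from c through γ back to a.
    interior (suc (suc zero))                   = reverse γ
    interior (suc (suc (suc zero)))             = W
    interior (suc (suc (suc (suc zero))))       = β
    interior (suc (suc (suc (suc (suc zero))))) = P₂
    path : Fin 6 → List V
    path e = branch (proj₁ (k4edge e)) ∷ (interior e ++ [ branch (proj₂ (k4edge e)) ])
    e₀₁ e₀₂ e₀₃ e₁₂ e₁₃ e₂₃ : Fin 6
    e₀₁ = zero
    e₀₂ = suc zero
    e₀₃ = suc (suc zero)
    e₁₂ = suc (suc (suc zero))
    e₁₃ = suc (suc (suc (suc zero)))
    e₂₃ = suc (suc (suc (suc (suc zero))))
    perm : L ++ (P ++ W) ↭ tabulate branch ++ flatten interior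
    perm = ↭-trans
      (solve 10 (λ a α b β c γ P₁ x P₂ W →
         ((a ⊕ (α ⊕ (b ⊕ (β ⊕ (c ⊕ γ))))) ⊕ ((P₁ ⊕ (x ⊕ P₂)) ⊕ W)) ⊜
         (a ⊕ (b ⊕ (x ⊕ (c ⊕ (α ⊕ (P₁ ⊕ (γ ⊕ (W ⊕ (β ⊕ (P₂ ⊕ id)))))))))))
         ↭-refl [ a ] α [ b ] β [ c ] γ P₁ [ x ] P₂ W)
      (prep a (prep b (prep x (prep c (++⁺ˡ α (++⁺ˡ P₁ (++⁺ʳ _ (↭-sym (↭-reverse γ)))))))))
    L#PW : Apart L (P ++ W)
    L#PW u∈ v∈ = Sum.[ L#P u∈ , L#W u∈ ]′ (∈-++⁻ P v∈)
    part : ∀ {u} → u ∈ tabulate branch ++ flatten interior → u ∈ L ⊎ u ∈ P ⊎ u ∈ W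
    part u∈ = Sum.map₂ (∈-++⁻ P) (∈-++⁻ L (∈-resp-↭ (↭-sym perm) u∈))
    rev : reverse (c ∷ γ ++ [ a ]) ≡ path e₀₃
    rev = trans (reverse-++ (c ∷ γ) [ a ]) (cong (a ∷_) (unfold-reverse c γ))
    first-extend : ∀ Q {y Q′ v} → First (Q ++ [ y ]) v → First (Q ++ y ∷ Q′) v
    first-extend []      e = e
    first-extend (_ ∷ _) e = e
    ed : ∀ e {u v} → Consec (path e) u v → u ~ v
    ed zero c = eL (inj₁ (consec-joinˡ (a ∷ α) c))
    ed (suc zero) k with consec-++⁻ [ a ] k
    ... | inj₂ (inj₁ k′) = eP (consec-joinˡ P₁ k′)
    ... | inj₂ (inj₂ (refl , k′)) = subst (a ~_) (first-unique P fst (first-extend P₁ k′)) a~f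
    ed (suc (suc zero)) {u} {v} k
      with consec-++⁻ (c ∷ γ) {[ a ]} (consec-reverse⁻ (c ∷ γ ++ [ a ]) (subst (λ Q → Consec Q u v) (sym rev) k))
    ... | inj₁ k′ = ~-sym (eL (inj₁ (consec-++ʳ (a ∷ α) (consec-++ʳ (b ∷ β) k′))))
    ... | inj₂ (inj₂ (k′ , refl)) = ~-sym (eL (inj₂ (last-++ʳ (a ∷ α) (last-++ʳ (b ∷ β) k′) , refl)))
    ed (suc (suc (suc zero))) k = eW k
    ed (suc (suc (suc (suc zero)))) k = eL (inj₁ (consec-++ʳ (a ∷ α) (consec-joinˡ (b ∷ β) k)))
    ed (suc (suc (suc (suc (suc zero))))) k with consec-++⁻ (x ∷ P₂) k
    ... | inj₁ k′ = eP (consec-++ʳ P₁ k′)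
    ... | inj₂ (inj₂ (k′ , refl)) = ~-sym (subst (c ~_) (last-unique P lst (last-++ʳ P₁ k′)) c~l)
    flip : ∀ {u v} → (∃ λ e → Link (path e) u v) → ∃ λ e → Link (path e) v u
    flip (e , k) = e , Sum.swap k
    back : ∀ {u v} → Consec (c ∷ γ ++ [ a ]) u v → ∃ λ e → Link (path e) u v
    back {u} {v} k = e₀₃ , inj₂ (subst (λ Q → Consec Q v u) rev (consec-reverse (c ∷ γ ++ [ a ]) k))
    onL : ∀ {u v} → Cyclic L u v → ∃ λ e → Link (path e) u v
    onL (inj₁ k) with consec-split (a ∷ α) k
    ... | inj₁ k′ = e₀₁ , inj₁ k′
    ... | inj₂ k′ with consec-split (b ∷ β) k′
    ...   | inj₁ k″ = e₁₃ , inj₁ k″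
    ...   | inj₂ k″ = back (consec-++ˡ (c ∷ γ) k″)
    onL (inj₂ (k , refl)) = back (consec-++ᵐ (c ∷ γ) (last-++⁻ (b ∷ β) (last-++⁻ (a ∷ α) k)) refl)
    onP : ∀ {u v} → Consec P u v → ∃ λ e → Link (path e) u v
    onP k with consec-split P₁ k
    ... | inj₁ k′ = e₀₂ , inj₁ (consec-∷ a _ k′)
    ... | inj₂ k′ = e₂₃ , inj₁ (consec-++ˡ (x ∷ P₂) k′)
    onLP : ∀ {u v} → (u ≡ a × v ≡ f) ⊎ (u ≡ c × v ≡ l) ⊎ Consec (b ∷ W ++ [ x ]) u v → ∃ λ e → Link (path e) u v
    onLP (inj₁ (refl , refl))        = e₀₂ , inj₁ (consec-++ᵐ [ a ] refl (first-prefix P₁ fst))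
    onLP (inj₂ (inj₁ (refl , refl))) = e₂₃ , inj₂ (consec-++ᵐ (x ∷ P₂) (last-++⁻ P₁ lst) refl)
    onLP (inj₂ (inj₂ k))             = e₁₂ , inj₁ k
    ch : ∀ {u v} → u ∈ L ⊎ u ∈ P ⊎ u ∈ W → v ∈ L ⊎ v ∈ P ⊎ v ∈ W → u ~ v → ∃ λ e → Link (path e) u v
    ch (inj₁ p) (inj₁ q) e = Sum.[ onL , flip ∘ onL ]′ (cL p q e)
    ch (inj₁ p) (inj₂ (inj₁ q)) e = onLP (LP p q e)
    ch (inj₁ p) (inj₂ (inj₂ q)) e = e₁₂ , inj₁ (LW p q e)
    ch (inj₂ (inj₁ p)) (inj₁ q) e = flip (onLP (LP q p (~-sym e)))
    ch (inj₂ (inj₁ p)) (inj₂ (inj₁ q)) e = Sum.[ onP , flip ∘ onP ]′ (cP p q e)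
    ch (inj₂ (inj₁ p)) (inj₂ (inj₂ q)) e = e₁₂ , inj₂ (PW p q e)
    ch (inj₂ (inj₂ p)) (inj₁ q) e = e₁₂ , inj₂ (LW q p (~-sym e))
    ch (inj₂ (inj₂ p)) (inj₂ (inj₁ q)) e = e₁₂ , inj₁ (PW q p (~-sym e))
    ch (inj₂ (inj₂ p)) (inj₂ (inj₂ q)) e =
      e₁₂ , Sum.map (consec-∷ b _ ∘ consec-++ˡ W) (consec-∷ b _ ∘ consec-++ˡ W) (WW p q e)

-- The trichotomy behind the counting arguments: one neighbour on a path serves as the foot of a
-- tripod, two lead to a new hole or new attachments, and three give a wheel.
data Occurrences {A : Set} (P : A → Set) : List A → Set where
  one  : ∀ X x Y → P x → (∀ {p} → p ∈ X ++ x ∷ Y → P p → p ≡ x) → Occurrences P (X ++ x ∷ Y)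
  two  : ∀ X x Y y Z → P x → P y → x ≢ y →
         (∀ {p} → p ∈ X ++ x ∷ Y ++ y ∷ Z → P p → p ≡ x ⊎ p ≡ y) → Occurrences P (X ++ x ∷ Y ++ y ∷ Z)
  many : ∀ {L x y z} → x ∈ L → y ∈ L → z ∈ L → x ≢ y → x ≢ z → y ≢ z → P x → P y → P z → Occurrences P L

-- `Occurrences` without the positions, so that L need not be matched against a concatenation.
data Tally {A : Set} (P : A → Set) (L : List A) : Set where
  one  : ∀ {x} → x ∈ L → P x → (∀ {p} → p ∈ L → P p → p ≡ x) → Tally P L
  two  : ∀ {x y} → x ∈ L → y ∈ L → P x → P y → x ≢ y → (∀ {p} → p ∈ L → P p → p ≡ x ⊎ p ≡ y) → Tally P L
  many : ∀ {x y z} → x ∈ L → y ∈ L → z ∈ L → x ≢ y → x ≢ z → y ≢ z → P x → P y → P z → Tally P L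

tally : ∀ {A : Set} {P : A → Set} {L} → Occurrences P L → Tally P L
tally (one X x Y px only)          = one (∈-insert X) px only
tally (two X x Y y Z px py ne only) = two (∈-insert X) (∈-++⁺ʳ X (∈-insert (x ∷ Y))) px py ne only
tally (many x∈ y∈ z∈ p q r a b c)  = many x∈ y∈ z∈ p q r a b c

module _ {A : Set} where

  ∈-mid : ∀ X {x : A} {Y p} → p ∈ X ++ x ∷ Y → p ∈ X ⊎ p ≡ x ⊎ p ∈ Y
  ∈-mid X m with ∈-++⁻ X m
  ... | inj₁ q         = inj₁ q
  ... | inj₂ (here e)  = inj₂ (inj₁ e)
  ... | inj₂ (there q) = inj₂ (inj₂ q)

  headOr : List A → A → A
  headOr []      y = y
  headOr (x ∷ _) _ = x

  first-headOr : ∀ X {y : A} {Y} → First (X ++ y ∷ Y) (headOr X y)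
  first-headOr []      = refl
  first-headOr (_ ∷ _) = refl

  occurrences : ∀ {P : A → Set} → (∀ x → Dec (P x)) → ∀ {L} → Unique L → Any P L → Occurrences P L
  occurrences {P} P? uq a with first-split P? a
  ... | X , x , Y , refl , px , nX with Any.any? P? Y
  ... | no ¬b = one X x Y px only
    where
    only : ∀ {p} → p ∈ X ++ x ∷ Y → P p → p ≡ x
    only m pp with ∈-mid X m
    ... | inj₁ q        = ⊥-elim (All.lookup nX q pp)
    ... | inj₂ (inj₁ e) = e
    ... | inj₂ (inj₂ q) = ⊥-elim (¬b (lose q pp))
  ... | yes b with first-split P? b
  ... | Y , y , Z , refl , py , nY with Any.any? P? Z
  ... | no ¬c = two X x Y y Z px py x≢y only
    where
    x≢y : x ≢ y
    x≢y refl = unique-apart [ x ] (unique-++ʳ X uq) (here refl) (∈-insert Y)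
    only : ∀ {p} → p ∈ X ++ x ∷ Y ++ y ∷ Z → P p → p ≡ x ⊎ p ≡ y
    only m pp with ∈-mid X m
    ... | inj₁ q        = ⊥-elim (All.lookup nX q pp)
    ... | inj₂ (inj₁ e) = inj₁ e
    ... | inj₂ (inj₂ q) with ∈-mid Y q
    ...   | inj₁ q′        = ⊥-elim (All.lookup nY q′ pp)
    ...   | inj₂ (inj₁ e)  = inj₂ e
    ...   | inj₂ (inj₂ q′) = ⊥-elim (¬c (lose q′ pp))
  ... | yes c with find c
  ... | z , z∈ , pz = many (∈-insert X) (∈-++⁺ʳ X (there (∈-insert Y)))
      (∈-++⁺ʳ X (there (∈-++⁺ʳ Y (there z∈)))) x≢y x≢z y≢z px py pz
    where
    x≢y : x ≢ y
    x≢y refl = unique-apart [ x ] (unique-++ʳ X uq) (here refl) (∈-insert Y)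
    x≢z : x ≢ z
    x≢z refl = unique-apart [ x ] (unique-++ʳ X uq) (here refl) (∈-++⁺ʳ Y (there z∈))
    y≢z : y ≢ z
    y≢z refl = unique-apart [ y ] (unique-++ʳ Y (unique-++ʳ [ x ] (unique-++ʳ X uq))) (here refl) z∈

  three-members : ∀ {L} {u v w : A} → u ∈ L → v ∈ L → w ∈ L → u ≢ v → u ≢ w → v ≢ w → 3 ≤ length L
  three-members {_ ∷ _ ∷ _ ∷ _} _ _ _ _ _ _ = s≤s (s≤s (s≤s z≤n))
  three-members {_ ∷ []} (here refl) (here refl) _ p _ _ = ⊥-elim (p refl)
  three-members {_ ∷ _ ∷ []} (here refl) (here refl) _ p _ _ = ⊥-elim (p refl)
  three-members {_ ∷ _ ∷ []} (here refl) (there _) (here refl) _ p _ = ⊥-elim (p refl)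
  three-members {_ ∷ _ ∷ []} _ (there (here refl)) (there (here refl)) _ _ p = ⊥-elim (p refl)
  three-members {_ ∷ _ ∷ []} (there (here refl)) (there (here refl)) _ p _ _ = ⊥-elim (p refl)
  three-members {_ ∷ _ ∷ []} (there (here refl)) _ (there (here refl)) _ p _ = ⊥-elim (p refl)
  three-members {_ ∷ _ ∷ []} _ (here refl) (here refl) _ _ p = ⊥-elim (p refl)

-- Chordless paths with three attachments on a hole.

module Attachments {n : ℕ} (R : Graph n)
  (isk4-free : ¬ HasInducedSubdivK4 R) (wheel-free : ¬ HasInducedWheel R) where
  open Paths R public

  no-wheel : ∀ {L x u v w} → Hole L → x ∉ L → u ∈ L → v ∈ L → w ∈ L →
             u ≢ v → u ≢ w → v ≢ w → x ~ u → x ~ v → x ~ w → ⊥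
  no-wheel h x∉ u∈ v∈ w∈ a b c d e f = wheel-free (hole-wheel h x∉ u∈ v∈ w∈ a b c d e f)

  Meets : V → List V → Set
  Meets u P = Any (u ~_) P

  meets? : ∀ u P → Dec (Meets u P)
  meets? u = Any.any? (u ~?_)

  -- The neighbours of b on P are counted. A single one gives a tripod with empty leg. Three give a
  -- wheel with centre b, whose rim is P closed up by the arc of the hole from c through γ to a, an
  -- arc that avoids b.
  three-ends-ordered : ∀ {a α b β c γ P f l} → let L = a ∷ α ++ b ∷ β ++ c ∷ γ in
    Hole L → Path P → Apart L P → First P f → Last P l → a ~ f → c ~ l → Meets b P →
    (∀ {u v} → u ∈ L → v ∈ P → u ~ v → (u ≡ a × v ≡ f) ⊎ (u ≡ c × v ≡ l) ⊎ u ≡ b) → ⊥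
  three-ends-ordered {a} {α} {b} {β} {c} {γ} {P} {f} {l} hole path L#P fst lst a~f c~l meet cross =
    go (occurrences (b ~?_) (Path.uniq path) meet) β refl
    where
    L = a ∷ α ++ b ∷ β ++ c ∷ γ
    uL : Unique L
    uL = Hole.uniq hole
    a∈L : a ∈ L
    a∈L = here refl
    b∈L : b ∈ L
    b∈L = ∈-insert (a ∷ α)
    c∈L : c ∈ L
    c∈L = ∈-++⁺ʳ (a ∷ α) (∈-insert (b ∷ β))
    γ⊂L : ∀ {u} → u ∈ c ∷ γ → u ∈ L
    γ⊂L m = ∈-++⁺ʳ (a ∷ α) (∈-++⁺ʳ (b ∷ β) m)
    hole′ : Hole ((c ∷ γ ++ [ a ]) ++ (α ++ b ∷ β))
    hole′ = subst Hole (cong (c ∷_) (sym (++-assoc γ [ a ] (α ++ b ∷ β))))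
      (hole-rotate (a ∷ α ++ b ∷ β) (c ∷ γ) (subst Hole (cong (a ∷_) (sym (++-assoc α (b ∷ β) (c ∷ γ)))) hole))
    arc : Path (c ∷ γ ++ [ a ])
    arc = hole-path (c ∷ γ ++ [ a ]) (α ++ b ∷ β) (∈-insert α) hole′
    b∉arc : b ∉ c ∷ γ ++ [ a ]
    b∉arc m = unique-apart (c ∷ γ ++ [ a ]) (Hole.uniq hole′) m (∈-insert α)
    arc⊂L : ∀ {u} → u ∈ c ∷ γ ++ [ a ] → u ∈ L
    arc⊂L m with ∈-++⁻ (c ∷ γ) m
    ... | inj₁ p           = γ⊂L p
    ... | inj₂ (here refl) = a∈L
    a≢c : a ≢ c
    a≢c refl = unique-apart [ a ] uL (here refl) (∈-++⁺ʳ α (∈-insert (b ∷ β)))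
    P#arc : Apart P (c ∷ γ ++ [ a ])
    P#arc p q = L#P (arc⊂L q) p
    rim : Hole (P ++ (c ∷ γ ++ [ a ]))
    rim = hole-glue path arc P#arc (first-∈ fst) (here refl)
      (three-members (∈-++⁺ˡ (first-∈ fst)) (∈-++⁺ʳ P (here refl)) (∈-++⁺ʳ P (∈-insert (c ∷ γ)))
         (λ { refl → L#P c∈L (first-∈ fst) }) (λ { refl → L#P a∈L (first-∈ fst) }) (a≢c ∘ sym))
      (λ { x refl → ~-sym (subst (c ~_) (last-unique P lst x) c~l) })
      (λ x y → ~-sym (subst₂ _~_ (sym (last-unique (c ∷ γ ++ [ a ]) y (last-++ʳ (c ∷ γ) refl))) (first-unique P fst x) a~f))
      rim-cross
      where
      rim-cross : ∀ {u v} → u ∈ P → v ∈ c ∷ γ ++ [ a ] → u ~ v →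
        (Last P u × First (c ∷ γ ++ [ a ]) v) ⊎ (First P u × Last (c ∷ γ ++ [ a ]) v)
      rim-cross u∈ v∈ e with cross (arc⊂L v∈) u∈ (~-sym e)
      ... | inj₁ (refl , refl)        = inj₂ (fst , last-++ʳ (c ∷ γ) refl)
      ... | inj₂ (inj₁ (refl , refl)) = inj₁ (lst , refl)
      ... | inj₂ (inj₂ refl)          = ⊥-elim (b∉arc v∈)
    b∉rim : b ∉ P ++ (c ∷ γ ++ [ a ])
    b∉rim m = Sum.[ L#P b∈L , b∉arc ]′ (∈-++⁻ P m)
    go : Occurrences (b ~_) P → ∀ β′ → β ≡ β′ → ⊥
    go (one P₁ x P₂ b~x only) _ _ = isk4-free (hole-tripod-isk4 hole path [] L#P (λ _ ()) (λ _ ()) fst lst a~f c~l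
      (λ { (inj₁ (refl , refl)) → b~x }) LP (λ _ ()) (λ _ ()) (λ ()))
      where
      LP : ∀ {u v} → u ∈ L → v ∈ P₁ ++ x ∷ P₂ → u ~ v → (u ≡ a × v ≡ f) ⊎ (u ≡ c × v ≡ l) ⊎ Consec (b ∷ x ∷ []) u v
      LP u∈ v∈ e with cross u∈ v∈ e
      ... | inj₁ k           = inj₁ k
      ... | inj₂ (inj₁ k)    = inj₂ (inj₁ k)
      ... | inj₂ (inj₂ refl) = inj₂ (inj₂ (inj₁ (refl , only v∈ e)))
    go (many x∈ y∈ z∈ x≢y x≢z y≢z bx by bz) _ _ =
      no-wheel rim b∉rim (∈-++⁺ˡ x∈) (∈-++⁺ˡ y∈) (∈-++⁺ˡ z∈) x≢y x≢z y≢z bx by bz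
    -- With β empty, b also sees c, its third neighbour on the rim.
    go (two P₁ x P₂ y P₃ b~x b~y x≢y only) [] refl =
      no-wheel rim b∉rim (∈-++⁺ˡ x∈) (∈-++⁺ˡ y∈) (∈-++⁺ʳ P (here refl)) x≢y
        (λ { refl → L#P c∈L x∈ }) (λ { refl → L#P c∈L y∈ }) b~x b~y
        (Hole.edge hole (inj₁ (consec-++ʳ (a ∷ α) (inj₁ (refl , refl)))))
      where
      x∈ : x ∈ P
      x∈ = ∈-insert P₁
      y∈ : y ∈ P
      y∈ = ∈-++⁺ʳ P₁ (∈-insert (x ∷ P₂))
    -- Now b does not see the arc that starts at c by way of β. The vertices x, b, the reverse of α,
    -- a and P₁ form a new hole; the rest of P continued by c and γ is a path from a neighbour of x
    -- to a neighbour of a, and the edge from b to y is the leg. The branch vertices are x, b, y and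
    -- a.
    go (two P₁ x P₂ y P₃ b~x b~y x≢y only) (b₁ ∷ β₁) refl =
      isk4-free (hole-tripod-isk4 {x} {[]} {b} {reverse α} {a} {P₁} {P₂} {y} {P₃ ++ c ∷ γ} {[]}
        hole₂ path₂ [] apart₂ (λ _ ()) (λ _ ()) fst₂ lst₂ x~f₂ a~l₂
        (λ { (inj₁ (refl , refl)) → b~y }) LP (λ _ ()) (λ _ ()) (λ ()))
      where
      x∈ : x ∈ P
      x∈ = ∈-insert P₁
      front rear side : List V
      front = P₁ ++ [ x ]
      rear  = P₂ ++ y ∷ P₃
      side  = a ∷ α ++ [ b ]
      P≡ : P ≡ front ++ rear
      P≡ = sym (++-assoc P₁ [ x ] rear)
      path′ : Path (front ++ rear)
      path′ = subst Path P≡ path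
      front⊂P : ∀ {u} → u ∈ front → u ∈ P
      front⊂P {u} m = subst (u ∈_) (sym P≡) (∈-++⁺ˡ m)
      rear⊂P : ∀ {u} → u ∈ rear → u ∈ P
      rear⊂P {u} m = subst (u ∈_) (sym P≡) (∈-++⁺ʳ front m)
      front#rear : Apart front rear
      front#rear = unique-apart front (Path.uniq path′)
      L≡ : L ≡ side ++ (β ++ c ∷ γ)
      L≡ = cong (a ∷_) (sym (++-assoc α [ b ] (β ++ c ∷ γ)))
      holeₛ : Hole (side ++ (β ++ c ∷ γ))
      holeₛ = subst Hole L≡ hole
      side⊂L : ∀ {u} → u ∈ side → u ∈ L
      side⊂L {u} m = subst (u ∈_) (sym L≡) (∈-++⁺ˡ m)
      side#γ : Apart side (c ∷ γ)
      side#γ p q = unique-apart side (Hole.uniq holeₛ) p (∈-++⁺ʳ β q)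
      rev : reverse side ≡ b ∷ reverse α ++ [ a ]
      rev = trans (reverse-++ (a ∷ α) [ b ]) (cong (b ∷_) (unfold-reverse a α))
      side′ : List V
      side′ = b ∷ reverse α ++ [ a ]
      side′⊂ : ∀ {u} → u ∈ side′ → u ∈ side
      side′⊂ {u} m = ∈-reverse (subst (u ∈_) (sym rev) m)
      f₀ : First front f
      f₀ = first-prefix P₁ fst
      last-rear : Last rear l
      last-rear = lastOf P₂ (subst (λ Q → Last Q l) P≡ lst)
        where
        lastOf : ∀ Q → Last (front ++ (Q ++ y ∷ P₃)) l → Last (Q ++ y ∷ P₃) l
        lastOf []      = last-++⁻ front
        lastOf (_ ∷ _) = last-++⁻ front
      hole₁ : Hole (side′ ++ front)
      hole₁ = hole-glue (subst Path rev (path-reverse (hole-path side (β ++ c ∷ γ) (∈-insert β) holeₛ)))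
        (path-++ˡ front path′) (λ p q → L#P (side⊂L (side′⊂ p)) (front⊂P q))
        (here refl) (∈-insert P₁)
        (three-members (here refl) (∈-++⁺ˡ (∈-insert (b ∷ reverse α))) (∈-++⁺ʳ side′ (∈-insert P₁))
          (λ { refl → unique-apart (a ∷ α) uL (here refl) (here refl) })
          (λ { refl → L#P b∈L x∈ }) (λ { refl → L#P a∈L x∈ }))
        (λ p q → subst₂ _~_ (last-unique side′ (last-++ʳ (b ∷ reverse α) refl) p) (first-unique front f₀ q) a~f)
        (λ { refl q → subst (b ~_) (last-unique front (last-++ʳ P₁ refl) q) b~x })
        x₁
        where
        x₁ : ∀ {u v} → u ∈ side′ → v ∈ front → u ~ v →
             (Last side′ u × First front v) ⊎ (First side′ u × Last front v)
        x₁ u∈ v∈ e with cross (side⊂L (side′⊂ u∈)) (front⊂P v∈) e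
        ... | inj₁ (refl , refl)        = inj₁ (last-++ʳ (b ∷ reverse α) refl , f₀)
        ... | inj₂ (inj₁ (refl , refl)) = ⊥-elim (side#γ (side′⊂ u∈) (here refl))
        ... | inj₂ (inj₂ refl) with only (front⊂P v∈) e
        ...   | inj₁ refl = inj₂ (refl , last-++ʳ P₁ refl)
        ...   | inj₂ refl = ⊥-elim (front#rear v∈ (∈-insert P₂))
      hole₂ : Hole (x ∷ b ∷ reverse α ++ a ∷ P₁)
      hole₂ = hole-rotate (b ∷ reverse α ++ a ∷ P₁) [ x ] (subst Hole
        (cong (b ∷_) (trans (++-assoc (reverse α) [ a ] front) (sym (++-assoc (reverse α) (a ∷ P₁) [ x ])))) hole₁)
      path₂ : Path (P₂ ++ y ∷ P₃ ++ c ∷ γ)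
      path₂ = subst Path (++-assoc P₂ (y ∷ P₃) (c ∷ γ)) (path-++ (path-++ʳ front path′)
        (path-++ˡ (c ∷ γ) arc) (λ p q → L#P (γ⊂L q) (rear⊂P p))
        (λ { p refl → ~-sym (subst (c ~_) (last-unique rear last-rear p) c~l) })
        (λ u∈ v∈ e → x₂ u∈ v∈ (cross (γ⊂L v∈) (rear⊂P u∈) (~-sym e))))
        where
        x₂ : ∀ {u v} → u ∈ rear → v ∈ c ∷ γ → (v ≡ a × u ≡ f) ⊎ (v ≡ c × u ≡ l) ⊎ v ≡ b → Last rear u × First (c ∷ γ) v
        x₂ u∈ v∈ (inj₁ (refl , _))           = ⊥-elim (side#γ (here refl) v∈)
        x₂ u∈ v∈ (inj₂ (inj₁ (refl , refl))) = last-rear , refl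
        x₂ u∈ v∈ (inj₂ (inj₂ refl))          = ⊥-elim (side#γ (∈-insert (a ∷ α)) v∈)
      split₂ : ∀ {u} → u ∈ P₂ ++ y ∷ P₃ ++ c ∷ γ → u ∈ rear ⊎ u ∈ c ∷ γ
      split₂ {u} m = ∈-++⁻ rear (subst (u ∈_) (sym (++-assoc P₂ (y ∷ P₃) (c ∷ γ))) m)
      parts : ∀ {u} → u ∈ x ∷ b ∷ reverse α ++ a ∷ P₁ → u ∈ side ⊎ u ∈ front
      parts (here refl) = inj₂ (∈-insert P₁)
      parts (there m) with ∈-mid (b ∷ reverse α) m
      ... | inj₁ (here refl)    = inj₁ (∈-insert (a ∷ α))
      ... | inj₁ (there k)      = inj₁ (there (∈-++⁺ˡ (∈-reverse {P = α} k)))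
      ... | inj₂ (inj₁ refl)    = inj₁ (here refl)
      ... | inj₂ (inj₂ k)       = inj₂ (∈-++⁺ˡ k)
      apart₂ : Apart (x ∷ b ∷ reverse α ++ a ∷ P₁) (P₂ ++ y ∷ P₃ ++ c ∷ γ)
      apart₂ p q with parts p | split₂ q
      ... | inj₁ s | inj₁ r = L#P (side⊂L s) (rear⊂P r)
      ... | inj₁ s | inj₂ g = side#γ s g
      ... | inj₂ t | inj₁ r = front#rear t r
      ... | inj₂ t | inj₂ g = L#P (γ⊂L g) (front⊂P t)
      f₂ l₂ : V
      f₂ = headOr P₂ y
      l₂ = proj₁ (last-exists c γ)
      fst₂ : First (P₂ ++ y ∷ P₃ ++ c ∷ γ) f₂
      fst₂ = first-headOr P₂
      fst-rear : First rear f₂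
      fst-rear = first-headOr P₂
      lst-γ : Last (c ∷ γ) l₂
      lst-γ = proj₂ (last-exists c γ)
      lst₂ : Last (P₂ ++ y ∷ P₃ ++ c ∷ γ) l₂
      lst₂ = last-++ʳ P₂ (last-++ʳ (y ∷ P₃) lst-γ)
      x~f₂ : x ~ f₂
      x~f₂ = Path.edge path′ (consec-++ᵐ front (last-++ʳ P₁ refl) fst-rear)
      a~l₂ : a ~ l₂
      a~l₂ = ~-sym (Hole.edge hole (inj₂ (last-++ʳ (a ∷ α) (last-++ʳ (b ∷ β) lst-γ) , refl)))
      LP : ∀ {u v} → u ∈ x ∷ b ∷ reverse α ++ a ∷ P₁ → v ∈ P₂ ++ y ∷ P₃ ++ c ∷ γ → u ~ v →
           (u ≡ x × v ≡ f₂) ⊎ (u ≡ a × v ≡ l₂) ⊎ Consec (b ∷ y ∷ []) u v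
      LP u∈ v∈ e with parts u∈ | split₂ v∈
      ... | inj₂ t | inj₁ r = let (k , m) = path-cross front path′ t r e in
            inj₁ (last-unique front k (last-++ʳ P₁ refl) , first-unique rear m fst-rear)
      ... | inj₂ t | inj₂ g with cross (γ⊂L g) (front⊂P t) (~-sym e)
      ...   | inj₁ (refl , _)           = ⊥-elim (side#γ (here refl) g)
      ...   | inj₂ (inj₁ (refl , refl)) = ⊥-elim (front#rear t (last-∈ last-rear))
      ...   | inj₂ (inj₂ refl)          = ⊥-elim (side#γ (∈-insert (a ∷ α)) g)
      LP u∈ v∈ e | inj₁ s | inj₁ r with cross (side⊂L s) (rear⊂P r) e
      ...   | inj₁ (refl , refl)        = ⊥-elim (front#rear (first-∈ f₀) r)
      ...   | inj₂ (inj₁ (refl , refl)) = ⊥-elim (side#γ s (here refl))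
      ...   | inj₂ (inj₂ refl) with only (rear⊂P r) e
      ...     | inj₁ refl = ⊥-elim (front#rear (∈-insert P₁) r)
      ...     | inj₂ refl = inj₂ (inj₂ (inj₁ (refl , refl)))
      LP u∈ v∈ e | inj₁ s | inj₂ g with hole-cross side (β ++ c ∷ γ) holeₛ s (∈-++⁺ʳ β g) e
      ...   | inj₁ (_ , refl) = ⊥-elim (unique-apart β (unique-++ʳ side (Hole.uniq holeₛ)) (here refl) g)
      ...   | inj₂ (refl , k) = inj₂ (inj₁ (refl , last-unique (c ∷ γ) (last-++⁻ β k) lst-γ))

  hole-from : ∀ {L a} → Hole L → a ∈ L →
    ∃ λ X → Hole (a ∷ X) × (∀ {u} → u ∈ a ∷ X → u ∈ L) × (∀ {u} → u ∈ L → u ∈ a ∷ X)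
  hole-from {a = a} hole a∈ with ∈-∃++ a∈
  ... | X , Y , refl = Y ++ X , hole-rotate X (a ∷ Y) hole ,
        ∈-resp-↭ (++-comm (a ∷ Y) X) , ∈-resp-↭ (++-comm X (a ∷ Y))

  data CyclicOrder (L : List V) (a b c : V) : Set where
    order : ∀ α β γ → Hole (a ∷ α ++ b ∷ β ++ c ∷ γ) →
            (∀ {u} → u ∈ a ∷ α ++ b ∷ β ++ c ∷ γ → u ∈ L) → CyclicOrder L a b c

  -- The hole is only rotated, never reflected, so both orders remain. A later argument about a path
  -- from a to c passes from one to the other by reversing that path.
  cyclic-order : ∀ {L a b c} → Hole L → a ∈ L → b ∈ L → c ∈ L → a ≢ b → a ≢ c → b ≢ c →
                 CyclicOrder L a b c ⊎ CyclicOrder L c b a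
  cyclic-order {L} {a} {b} {c} hole a∈ b∈ c∈ a≢b a≢c b≢c with hole-from hole a∈
  ... | X , h , sub , sup with sup b∈ | sup c∈
  ... | here e | _      = ⊥-elim (a≢b (sym e))
  ... | _      | here e = ⊥-elim (a≢c (sym e))
  ... | there b∈X | there c∈X with ∈-∃++ b∈X
  ... | α , β , refl with ∈-mid α c∈X
  ... | inj₂ (inj₁ e) = ⊥-elim (b≢c (sym e))
  ... | inj₂ (inj₂ c∈β) with ∈-∃++ c∈β
  ...   | β₁ , β₂ , refl = inj₁ (order α β₁ β₂ h sub)
  cyclic-order {L} {a} {b} {c} hole a∈ b∈ c∈ a≢b a≢c b≢c
      | X , h , sub , sup | there b∈X | there c∈X | α , β , refl | inj₁ c∈α with ∈-∃++ c∈α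
  ...   | α₁ , α₂ , refl = inj₂ (order α₂ β α₁ (subst Hole eq (hole-rotate (a ∷ α₁) (c ∷ α₂ ++ b ∷ β) (subst Hole eq₀ h)))
            (λ {u} m → sub (subst (u ∈_) (sym eq₀) (∈-resp-↭ (++-comm (c ∷ α₂ ++ b ∷ β) (a ∷ α₁)) (subst (u ∈_) (sym eq) m)))))
    where
    eq₀ : a ∷ (α₁ ++ c ∷ α₂) ++ b ∷ β ≡ (a ∷ α₁) ++ (c ∷ α₂ ++ b ∷ β)
    eq₀ = cong (a ∷_) (++-assoc α₁ (c ∷ α₂) (b ∷ β))
    eq : (c ∷ α₂ ++ b ∷ β) ++ a ∷ α₁ ≡ c ∷ α₂ ++ b ∷ β ++ a ∷ α₁
    eq = cong (c ∷_) (++-assoc α₂ (b ∷ β) (a ∷ α₁))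

  three-ends : ∀ {L a b c P f l} → Hole L → a ∈ L → b ∈ L → c ∈ L → a ≢ b → a ≢ c → b ≢ c →
    Path P → Apart L P → First P f → Last P l → a ~ f → c ~ l → Meets b P →
    (∀ {u v} → u ∈ L → v ∈ P → u ~ v → (u ≡ a × v ≡ f) ⊎ (u ≡ c × v ≡ l) ⊎ u ≡ b) → ⊥
  three-ends {P = P} hole a∈ b∈ c∈ a≢b a≢c b≢c path L#P fst lst a~f c~l meet cross
    with cyclic-order hole a∈ b∈ c∈ a≢b a≢c b≢c
  ... | inj₁ (order α β γ h sub) =
        three-ends-ordered h path (λ p → L#P (sub p)) fst lst a~f c~l meet (λ p → cross (sub p))
  ... | inj₂ (order α β γ h sub) =
        three-ends-ordered h (path-reverse path) (λ p q → L#P (sub p) (∈-reverse q))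
          (first-reverse P lst) (last-reverse P fst) c~l a~f (Any.reverse⁺ meet)
          (λ p q e → Sum.assocʳ (Sum.map₁ Sum.swap (Sum.assocˡ (cross (sub p) (∈-reverse q) e))))

  -- Shrinking P from both ends leaves a path in which some attachment is seen by
  -- the first vertex only and another one by the last vertex only.
  three-attachments : ∀ {L P a b c} → Hole L → Path P → Apart L P →
    a ∈ L → b ∈ L → c ∈ L → a ≢ b → a ≢ c → b ≢ c →
    (∀ {u v} → u ∈ L → v ∈ P → u ~ v → u ≡ a ⊎ u ≡ b ⊎ u ≡ c) →
    Meets a P → Meets b P → Meets c P → ⊥
  three-attachments {L} {P} {a} {b} {c} hole path L#P a∈ b∈ c∈ a≢b a≢c b≢c cross =
    shrink P path (λ p → p)
    where
    Ends : V → V → V → Set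
    Ends a b c = a ∈ L × b ∈ L × c ∈ L × a ≢ b × a ≢ c × b ≢ c ×
      (∀ {u v} → u ∈ L → v ∈ P → u ~ v → u ≡ a ⊎ u ≡ b ⊎ u ≡ c)
    swap-bc : ∀ {a b c} → Ends a b c → Ends a c b
    swap-bc (p , q , r , x , y , z , k) = p , r , q , y , x , z ∘ sym , λ u v e → Sum.map₂ Sum.swap (k u v e)
    turn : ∀ {a b c} → Ends a b c → Ends b c a
    turn (p , q , r , x , y , z , k) = q , r , p , z , x ∘ sym , y ∘ sym , λ u v e → Sum.assocʳ (Sum.swap (k u v e))
    ends : Ends a b c
    ends = a∈ , b∈ , c∈ , a≢b , a≢c , b≢c , cross
    close : ∀ {a b c f l} → Ends a b c → ∀ {Q} → Path Q → (∀ {u} → u ∈ Q → u ∈ P) → First Q f → Last Q l →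
      a ~ f → (∀ {u} → u ∈ Q → a ~ u → u ≡ f) → c ~ l → (∀ {u} → u ∈ Q → c ~ u → u ≡ l) → Meets b Q → ⊥
    close {a} {b} {c} {f} {l} (a∈ , b∈ , c∈ , a≢b , a≢c , b≢c , cross) {Q} path sub fst lst a~f onlyᵃ c~l onlyᶜ meet =
      three-ends hole a∈ b∈ c∈ a≢b a≢c b≢c path (λ x y → L#P x (sub y)) fst lst a~f c~l meet cr
      where
      cr : ∀ {u v} → u ∈ L → v ∈ Q → u ~ v → (u ≡ a × v ≡ f) ⊎ (u ≡ c × v ≡ l) ⊎ u ≡ b
      cr u∈ v∈ e with cross u∈ (sub v∈) e
      ... | inj₁ refl        = inj₁ (refl , onlyᵃ v∈ e)
      ... | inj₂ (inj₁ refl) = inj₂ (inj₂ refl)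
      ... | inj₂ (inj₂ refl) = inj₂ (inj₁ (refl , onlyᶜ v∈ e))
    prefix : ∀ X {s Y} {u : V} → u ∈ X ++ [ s ] → u ∈ X ++ s ∷ Y
    prefix X m with ∈-++⁻ X m
    ... | inj₁ k           = ∈-++⁺ˡ k
    ... | inj₂ (here refl) = ∈-insert X
    only-last : ∀ {c} X {s u} → All (λ v → ¬ c ~ v) X → u ∈ X ++ [ s ] → c ~ u → u ≡ s
    only-last X none m e with ∈-++⁻ X m
    ... | inj₁ k           = ⊥-elim (All.lookup none k e)
    ... | inj₂ (here refl) = refl
    cut : ∀ {a b c f} → Ends a b c → ∀ {Q} → Path Q → (∀ {u} → u ∈ Q → u ∈ P) → First Q f →
          a ~ f → (∀ {u} → u ∈ Q → a ~ u → u ≡ f) → Meets b Q → Meets c Q → ⊥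
    cut {a} {b} {c} {f} ends path sub fst a~f onlyᵃ mb mc with first-split (c ~?_) mc
    ... | X , s , Y , refl , c~s , c≁X with meets? b (X ++ [ s ])
    ... | yes mb′ = close ends (path-++ˡ (X ++ [ s ]) (subst Path (sym (++-assoc X [ s ] Y)) path))
          (sub ∘ prefix X) (first-prefix X fst) (last-++ʳ X refl) a~f (onlyᵃ ∘ prefix X) c~s (only-last X c≁X) mb′
    -- The first neighbour of b lies beyond that of c, so the path is prolonged up to it: b now
    -- belongs to the last vertex and c becomes the attachment in between.
    ... | no ¬mb′ with first-split (b ~?_) (Sum.[ ⊥-elim ∘ ¬mb′ , (λ k → k) ]′ (Any.++⁻ (X ++ [ s ]) (subst (Meets b) (sym (++-assoc X [ s ] Y)) mb)))
    ... | X′ , s′ , Y′ , refl , b~s′ , b≁X′ = close (swap-bc ends)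
          (path-++ˡ (Z ++ [ s′ ]) (subst Path eq path)) (λ {u} m → sub (subst (u ∈_) (sym eq₁) (prefix Z m)))
          (first-prefix Z (subst (λ T → First T f) eq₁ fst)) (last-++ʳ Z refl) a~f
          (λ {u} m → onlyᵃ (subst (u ∈_) (sym eq₁) (prefix Z m))) b~s′
          (only-last Z (All.++⁺ (All.++⁻ˡ X b≁) (All.++⁺ (All.++⁻ʳ X b≁) b≁X′)))
          (Any.++⁺ˡ (Any.++⁺ʳ X (here c~s)))
      where
      Z : List V
      Z = X ++ s ∷ X′
      eq₁ : X ++ s ∷ X′ ++ s′ ∷ Y′ ≡ Z ++ s′ ∷ Y′
      eq₁ = sym (++-assoc X (s ∷ X′) (s′ ∷ Y′))
      eq : X ++ s ∷ X′ ++ s′ ∷ Y′ ≡ (Z ++ [ s′ ]) ++ Y′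
      eq = trans eq₁ (sym (++-assoc Z [ s′ ] Y′))
      b≁ : All (λ v → ¬ b ~ v) (X ++ [ s ])
      b≁ = All.¬Any⇒All¬ (X ++ [ s ]) ¬mb′
    at : ∀ {x p Q} → Meets x (p ∷ Q) → ¬ Meets x Q → x ~ p
    at (here k)  _ = k
    at (there k) n = ⊥-elim (n k)
    only : ∀ {x p Q} → ¬ Meets x Q → ∀ {u} → u ∈ p ∷ Q → x ~ u → u ≡ p
    only n (here e)  _ = e
    only n (there m) e = ⊥-elim (n (lose m e))
    shrink : ∀ Q → Path Q → (∀ {u} → u ∈ Q → u ∈ P) → Meets a Q → Meets b Q → Meets c Q → ⊥
    -- As long as all three attachments see the tail, p is dropped. As soon as one of them does not,
    -- p is its only neighbour on the path.
    shrink (p ∷ Q) path sub ma mb mc with meets? a Q | meets? b Q | meets? c Q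
    ... | yes ka | yes kb | yes kc = shrink Q (path-++ʳ [ p ] path) (sub ∘ there) ka kb kc
    ... | no ¬a | _ | _ = cut ends path sub refl (at ma ¬a) (only ¬a) mb mc
    ... | _ | no ¬b | _ = cut (turn ends) path sub refl (at mb ¬b) (only ¬b) mc ma
    ... | _ | _ | no ¬c = cut (turn (turn ends)) path sub refl (at mc ¬c) (only ¬c) ma mb

-- Walks inside a set of vertices, and the chordless paths extracted from them.

last-∷⁻ : ∀ {A : Set} {Q} {x f u : A} → First Q f → Last (x ∷ Q) u → Last Q u
last-∷⁻ {Q = _ ∷ _} _ l = l

last-∷ : ∀ {A : Set} {Q} {x f u : A} → First Q f → Last Q u → Last (x ∷ Q) u
last-∷ {Q = _ ∷ _} _ l = l

module Walks {n : ℕ} (R : Graph n) where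
  open Paths R public
  open import Data.List.Membership.DecPropositional (_≟_ {n}) public using (_∈?_)

  data Walk (D : V → Set) : V → V → Set where
    stop : ∀ {x} → D x → Walk D x x
    move : ∀ {x y z} → D x → x ~ y → Walk D y z → Walk D x z

  module _ {D : V → Set} where

    walk-start : ∀ {x y} → Walk D x y → D x
    walk-start (stop d)     = d
    walk-start (move d _ _) = d

    walk-++ : ∀ {x y z} → Walk D x y → Walk D y z → Walk D x z
    walk-++ (stop _)     w′ = w′
    walk-++ (move d e w) w′ = move d e (walk-++ w w′)

    walk-snoc : ∀ {x y z} → Walk D x y → y ~ z → D z → Walk D x z
    walk-snoc w e d = walk-++ w (end w)
      where
      end : ∀ {x} → Walk D x _ → Walk D _ _
      end (stop d′)     = move d′ e (stop d)
      end (move _ _ w′) = end w′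

    walk-sym : ∀ {x y} → Walk D x y → Walk D y x
    walk-sym (stop d)     = stop d
    walk-sym (move d e w) = walk-snoc (walk-sym w) (~-sym e) d

    walk-map : ∀ {D′ : V → Set} → (∀ {v} → D v → D′ v) → ∀ {x y} → Walk D x y → Walk D′ x y
    walk-map f (stop d)     = stop (f d)
    walk-map f (move d e w) = move (f d) e (walk-map f w)

    -- Stops at the first vertex of S. This turns a walk towards a hole, a path or a single vertex
    -- into one that stays off it and ends next to it.
    approach : ∀ {S : V → Set} → (∀ v → Dec (S v)) → ∀ {x y} → Walk D x y → ¬ S x → S y →
      ∃ λ z → ∃ λ s → Walk (λ v → D v × ¬ S v) x z × z ~ s × S s × D s
    approach S? (stop d) ¬s s = ⊥-elim (¬s s)
    approach S? (move {y = y} d e w) ¬s s with S? y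
    ... | yes sy = _ , y , stop (d , ¬s) , e , sy , walk-start w
    ... | no ¬sy with approach S? w ¬sy s
    ...   | z , t , w′ , e′ , st , dt = z , t , move (d , ¬s) e w′ , e′ , st , dt

  -- That only the first vertex satisfies `Start` and only the last one `End` is what later allows
  -- the path to be closed up without chords. The path may consist of one vertex.
  record Between (D Start End : V → Set) : Set where
    field
      {vertices}    : List V
      path          : Path vertices
      inside        : ∀ {v} → v ∈ vertices → D v
      {source sink} : V
      source-first  : First vertices source
      sink-last     : Last vertices sink
      start         : Start source
      end           : End sink
      only-source   : ∀ {v} → v ∈ vertices → Start v → v ≡ source
      only-sink     : ∀ {v} → v ∈ vertices → End v → v ≡ sink

  module _ {D End : V → Set} (End? : ∀ v → Dec (End v)) where

    record From (x : V) : Set where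
      field
        {rest}    : List V
        path      : Path (x ∷ rest)
        inside    : ∀ {v} → v ∈ x ∷ rest → D v
        {sink}    : V
        sink-last : Last (x ∷ rest) sink
        end       : End sink
        only-sink : ∀ {v} → v ∈ x ∷ rest → End v → v ≡ sink

    single : ∀ {x} → D x → End x → From x
    single {x} d e = record
      { path = path-[ x ] ; inside = λ { (here refl) → d } ; sink-last = refl ; end = e
      ; only-sink = λ { (here refl) _ → refl } }

    abstract

      -- Jump from x to the last vertex of the remaining path that x equals or sees.
      shorten : ∀ {x y} → Walk D x y → End y → From x
      shorten (stop d) e = single d e
      shorten {x} (move {y = y} d e w) ey with End? x
      ... | yes ex = single d ex
      ... | no ¬ex with shorten w ey
      ... | record { rest = Q ; path = p ; inside = ins ; sink = t ; sink-last = lst ; end = et ; only-sink = only }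
        with last-split (λ v → (x ≟ v) ⊎-dec (x ~? v)) (here {xs = Q} (inj₂ e))
      ... | X , s , Y , eq , near , far = join near
        where
        sub : ∀ {v} → v ∈ s ∷ Y → v ∈ y ∷ Q
        sub {v} m = subst (v ∈_) (sym eq) (∈-++⁺ʳ X m)
        p′ : Path (s ∷ Y)
        p′ = path-++ʳ X (subst Path eq p)
        lst′ : Last (s ∷ Y) t
        lst′ = last-++⁻ X (subst (λ Z → Last Z t) eq lst)
        x∉Y : x ∉ Y
        x∉Y m = All.lookup far m (inj₁ refl)
        join : x ≡ s ⊎ x ~ s → From x
        -- The shortened path returned to x, so it is simply entered there.
        join (inj₁ refl) = record { path = p′ ; inside = ins ∘ sub ; sink-last = lst′ ; end = et ; only-sink = only ∘ sub }
        join (inj₂ xs) = record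
          { path = path-++ path-[ x ] p′
              (λ { (here refl) (here refl) → ~-irr xs ; (here refl) (there m) → x∉Y m })
              (λ { refl refl → xs })
              (λ { (here refl) (here refl) _ → refl , refl
                 ; (here refl) (there m) k → ⊥-elim (All.lookup far m (inj₂ k)) })
          ; inside = λ { (here refl) → d ; (there m) → ins (sub m) }
          ; sink-last = lst′ ; end = et
          ; only-sink = λ { (here refl) k → ⊥-elim (¬ex k) ; (there m) k → only (sub m) k } }

      between : ∀ {Start : V → Set} → (∀ v → Dec (Start v)) → ∀ {x y} → Walk D x y → Start x → End y → Between D Start End
      between {Start} Start? {x} w sx ey with shorten w ey
      ... | record { rest = Q ; path = p ; inside = ins ; sink = t ; sink-last = lst ; end = et ; only-sink = only }
        -- The path may meet `Start` again after its first vertex, hence the cut at the last such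
        -- vertex.
        with last-split Start? (here {xs = Q} sx)
      ... | X , s , Y , eq , ss , none = record
        { path = path-++ʳ X (subst Path eq p) ; inside = ins ∘ sub
        ; source-first = refl ; sink-last = last-++⁻ X (subst (λ Z → Last Z t) eq lst)
        ; start = ss ; end = et
        ; only-source = λ { (here refl) _ → refl ; (there m) k → ⊥-elim (All.lookup none m k) }
        ; only-sink = only ∘ sub }
        where
        sub : ∀ {v} → v ∈ s ∷ Y → v ∈ x ∷ Q
        sub {v} m = subst (v ∈_) (sym eq) (∈-++⁺ʳ X m)

-- Connected sets with three attachments on a hole.

module Connections {n : ℕ} (R : Graph n)
  (isk4-free : ¬ HasInducedSubdivK4 R) (wheel-free : ¬ HasInducedWheel R) where
  open Attachments R isk4-free wheel-free public
  open Walks R public using (Walk; stop; move; walk-start; walk-++; walk-snoc; walk-sym; walk-map; approach; Between; between; From; shorten; _∈?_)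

  meets : ∀ {u v P} → v ∈ P → u ~ v → Meets u P
  meets m e = lose m e

  module _ {L : List V} {D : V → Set} {b : V} (hole : Hole L) (L#D : ∀ {v} → v ∈ L → D v → ⊥) (b∈ : b ∈ L)
    {W : List V} {t z : V} (pathʷ : Path W) (W⊂D : ∀ {v} → v ∈ W → D v) (fstʷ : First W t) (lstʷ : Last W z)
    (b~t : b ~ t) (only-t : ∀ {v} → v ∈ W → b ~ v → v ≡ t) where

    -- S is a spine from a to c and W a leg from b whose last vertex z is the only one that sees S.
    -- The spine and the arc from a through b to c form a hole. If z has one neighbour on S there is
    -- a tripod with leg W; if two, W has three attachments on that hole; if three, z is the centre
    -- of a wheel.
    tripod-ordered : ∀ {a c S f l} → CyclicOrder L a b c → ¬ a ~ c → Path S → (∀ {v} → v ∈ S → D v) → Apart W S →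
      First S f → Last S l → a ~ f → c ~ l → (∀ {v} → v ∈ S → a ~ v → v ≡ f) → (∀ {v} → v ∈ S → c ~ v → v ≡ l) →
      ¬ Meets b S → Meets z S → (∀ {v} → v ∈ W → Meets v S → v ≡ z) →
      ¬ Meets a W → ¬ Meets c W →
      (∀ {u v} → u ∈ L → D v → u ~ v → u ≡ a ⊎ u ≡ b ⊎ u ≡ c) → ⊥
    -- With γ empty, a and c would be adjacent, and this edge could be a chord of the cycle through
    -- the spine.
    tripod-ordered {a} {c} {S} {f} {l} (order α β [] h sub) a≁c _ _ _ _ _ _ _ _ _ _ _ _ _ _ _ =
      a≁c (~-sym (Hole.edge h (inj₂ (last-++ʳ (a ∷ α) (last-++ʳ (b ∷ β) refl) , refl))))
    tripod-ordered {a} {c} {S} {f} {l} (order α β (g ∷ γ) h sub) a≁c pathˢ S⊂D W#S fst lst a~f c~l only-f only-l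
                   b≁S z-S only-z a≁W c≁W cross =
      finish (occurrences (z ~?_) (Path.uniq pathˢ) z-S)
      where
      L′ : List V
      L′ = a ∷ α ++ b ∷ β ++ c ∷ g ∷ γ
      L′#S : Apart L′ S
      L′#S p q = L#D (sub p) (S⊂D q)
      L′#W : Apart L′ W
      L′#W p q = L#D (sub p) (W⊂D q)
      onS : ∀ {u v} → u ∈ L → v ∈ S → u ~ v → (u ≡ a × v ≡ f) ⊎ (u ≡ c × v ≡ l)
      onS u∈ v∈ e with cross u∈ (S⊂D v∈) e
      ... | inj₁ refl        = inj₁ (refl , only-f v∈ e)
      ... | inj₂ (inj₁ refl) = ⊥-elim (b≁S (meets v∈ e))
      ... | inj₂ (inj₂ refl) = inj₂ (refl , only-l v∈ e)
      onW : ∀ {u v} → u ∈ L → v ∈ W → u ~ v → u ≡ b × v ≡ t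
      onW u∈ v∈ e with cross u∈ (W⊂D v∈) e
      ... | inj₁ refl        = ⊥-elim (a≁W (meets v∈ e))
      ... | inj₂ (inj₁ refl) = refl , only-t v∈ e
      ... | inj₂ (inj₂ refl) = ⊥-elim (c≁W (meets v∈ e))
      arc : List V
      arc = a ∷ α ++ b ∷ β ++ [ c ]
      eq : L′ ≡ arc ++ g ∷ γ
      eq = cong (a ∷_) (sym (trans (++-assoc α (b ∷ β ++ [ c ]) (g ∷ γ)) (cong (λ Z → α ++ b ∷ Z) (++-assoc β [ c ] (g ∷ γ)))))
      arc⊂L : ∀ {u} → u ∈ arc → u ∈ L
      arc⊂L {u} m = sub (subst (u ∈_) (sym eq) (∈-++⁺ˡ m))
      arc-last : Last arc c
      arc-last = last-++ʳ (a ∷ α) (last-++ʳ (b ∷ β) refl)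
      a≢b : a ≢ b
      a≢b refl = unique-apart [ a ] (Hole.uniq h) (here refl) (∈-insert α)
      rim : Hole (arc ++ reverse S)
      rim = hole-glue (hole-path arc (g ∷ γ) (here refl) (subst Hole eq h)) (path-reverse pathˢ)
        (λ p q → L#D (arc⊂L p) (S⊂D (∈-reverse q))) (here refl) (∈-reverse⁺ (first-∈ fst))
        (three-members (here refl) (∈-++⁺ˡ (∈-insert (a ∷ α))) (∈-++⁺ʳ arc (∈-reverse⁺ (first-∈ fst)))
           a≢b (λ { refl → L#D (arc⊂L (here refl)) (S⊂D (first-∈ fst)) }) (λ { refl → L#D b∈ (S⊂D (first-∈ fst)) }))
        (λ p q → subst₂ _~_ (last-unique arc arc-last p) (last-unique S lst (first-reverse⁻ S q)) c~l)
        (λ { refl q → subst (a ~_) (first-unique S fst (last-reverse⁻ S q)) a~f })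
        (λ u∈ v∈ e → cr (onS (arc⊂L u∈) (∈-reverse v∈) e))
        where
        cr : ∀ {u v} → (u ≡ a × v ≡ f) ⊎ (u ≡ c × v ≡ l) →
             (Last arc u × First (reverse S) v) ⊎ (First arc u × Last (reverse S) v)
        cr (inj₁ (refl , refl)) = inj₂ (refl , last-reverse S fst)
        cr (inj₂ (refl , refl)) = inj₁ (arc-last , first-reverse S lst)
      rim#W : Apart (arc ++ reverse S) W
      rim#W p q = Sum.[ (λ k → L#D (arc⊂L k) (W⊂D q)) , (λ k → W#S q (∈-reverse k)) ]′ (∈-++⁻ arc p)
      inRim : ∀ {v} → v ∈ S → v ∈ arc ++ reverse S
      inRim m = ∈-++⁺ʳ arc (∈-reverse⁺ m)
      finish : Occurrences (z ~_) S → ⊥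
      finish (one X s Y z~s only) = isk4-free (hole-tripod-isk4 {W = W} h pathˢ (Path.uniq pathʷ) L′#S L′#W (λ p q → W#S q p)
        fst lst a~f c~l leg (λ p q e → Sum.map₂ inj₁ (onS (sub p) q e))
        (λ p q e → legᵇ (onW (sub p) q e)) legˢ (Path.chordless pathʷ))
        where
        leg : ∀ {u v} → Consec (b ∷ W ++ [ s ]) u v → u ~ v
        leg k with consec-++⁻ (b ∷ W) k
        ... | inj₂ (inj₂ (p , refl)) = subst (_~ s) (last-unique W lstʷ (last-∷⁻ fstʷ p)) z~s
        ... | inj₁ k′ with consec-++⁻ [ b ] k′
        ...   | inj₂ (inj₁ k″)       = Path.edge pathʷ k″
        ...   | inj₂ (inj₂ (refl , p)) = subst (b ~_) (first-unique W fstʷ p) b~t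
        legᵇ : ∀ {u v} → u ≡ b × v ≡ t → Consec (b ∷ W ++ [ s ]) u v
        legᵇ (refl , refl) = consec-++ᵐ [ b ] refl (first-++ˡ fstʷ)
        legˢ : ∀ {u v} → u ∈ X ++ s ∷ Y → v ∈ W → u ~ v → Consec (b ∷ W ++ [ s ]) v u
        legˢ u∈ v∈ e with only-z v∈ (meets u∈ (~-sym e))
        ... | refl with only u∈ (~-sym e)
        ...   | refl = consec-++ᵐ (b ∷ W) (last-∷ fstʷ lstʷ) refl
      finish (many x∈ y∈ w∈ p q r zx zy zw) =
        no-wheel rim (λ m → rim#W m (last-∈ lstʷ)) (inRim x∈) (inRim y∈) (inRim w∈) p q r zx zy zw
      finish (two X x Y y Z z~x z~y x≢y only) =
        three-attachments rim pathʷ rim#W (∈-++⁺ˡ (∈-insert (a ∷ α))) (inRim x∈) (inRim y∈)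
          (λ { refl → L#D b∈ (S⊂D x∈) }) (λ { refl → L#D b∈ (S⊂D y∈) }) x≢y
          cr (meets (first-∈ fstʷ) b~t) (meets (last-∈ lstʷ) (~-sym z~x)) (meets (last-∈ lstʷ) (~-sym z~y))
        where
        x∈ : x ∈ S
        x∈ = ∈-insert X
        y∈ : y ∈ S
        y∈ = ∈-++⁺ʳ X (∈-insert (x ∷ Y))
        cr : ∀ {u v} → u ∈ arc ++ reverse S → v ∈ W → u ~ v → u ≡ b ⊎ u ≡ x ⊎ u ≡ y
        cr u∈ v∈ e with ∈-++⁻ arc u∈
        ... | inj₁ k = inj₁ (proj₁ (onW (arc⊂L k) v∈ e))
        ... | inj₂ k with only-z v∈ (meets (∈-reverse {P = S} k) (~-sym e))
        ...   | refl = inj₂ (only (∈-reverse {P = S} k) (~-sym e))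

    -- Otherwise W, continued along S from the last neighbour of z, would be a chordless path with
    -- the three attachments a, b and c.
    leg-misses-end : ∀ {a c S l} → a ∈ L → c ∈ L → a ≢ b → a ≢ c → b ≢ c →
      Path S → (∀ {v} → v ∈ S → D v) → Apart W S → Last S l → c ~ l →
      Meets z S → (∀ {v} → v ∈ W → Meets v S → v ≡ z) →
      (∀ {u v} → u ∈ L → D v → u ~ v → u ≡ a ⊎ u ≡ b ⊎ u ≡ c) → ¬ Meets a W
    leg-misses-end {a} {c} {S} {l} a∈ c∈ a≢b a≢c b≢c pathˢ S⊂D W#S lst c~l z-S only-z cross a-W
      with last-split (z ~?_) z-S
    ... | X , s , Y , refl , z~s , z≁Y =
      three-attachments hole (path-++ pathʷ (path-++ʳ X pathˢ) (λ p q → W#S p (∈-++⁺ʳ X q))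
          (λ { p refl → subst (_~ s) (last-unique W lstʷ p) z~s }) cr)
        (λ p q → L#D p (inD q)) a∈ b∈ c∈ a≢b a≢c b≢c (λ p q → cross p (inD q))
        (Any.++⁺ˡ a-W) (Any.++⁺ˡ (meets (first-∈ fstʷ) b~t)) (Any.++⁺ʳ W (meets (last-∈ (last-++⁻ X lst)) c~l))
      where
      inD : ∀ {v} → v ∈ W ++ s ∷ Y → D v
      inD m = Sum.[ W⊂D , (λ k → S⊂D (∈-++⁺ʳ X k)) ]′ (∈-++⁻ W m)
      cr : ∀ {u v} → u ∈ W → v ∈ s ∷ Y → u ~ v → Last W u × First (s ∷ Y) v
      cr u∈ v∈ e with only-z u∈ (meets (∈-++⁺ʳ X v∈) e)
      cr u∈ (here refl) e | refl = lstʷ , refl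
      cr u∈ (there m)   e | refl = ⊥-elim (All.lookup z≁Y m e)

  -- A chordless spine joins a to c inside D. If b sees it, the result for paths applies; if not, a
  -- shortest leg joins b to the spine, and neither a nor c sees that leg.
  three-attachments-connected : ∀ {L D a b c xa xb xc} → Hole L → (∀ {v} → v ∈ L → D v → ⊥) →
    (∀ {p q} → D p → D q → Walk D p q) →
    a ∈ L → b ∈ L → c ∈ L → a ≢ b → a ≢ c → b ≢ c → ¬ a ~ c →
    (∀ {u v} → u ∈ L → D v → u ~ v → u ≡ a ⊎ u ≡ b ⊎ u ≡ c) →
    D xa → D xb → D xc → a ~ xa → b ~ xb → c ~ xc → ⊥
  three-attachments-connected {L} {D} {a} {b} {c} {xa} {xb} {xc} hole L#D conn a∈ b∈ c∈ a≢b a≢c b≢c a≁c cross da db dc axa bxb cxc =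
    main (meets? b S)
    where
    spine : Between D (a ~_) (c ~_)
    spine = between (c ~?_) (a ~?_) (conn da dc) axa cxc
    open Between spine renaming (vertices to S; path to pathˢ; inside to S⊂D)
    main : Dec (Meets b S) → ⊥
    main (yes m) = three-attachments hole pathˢ (λ p q → L#D p (S⊂D q)) a∈ b∈ c∈ a≢b a≢c b≢c
      (λ p q → cross p (S⊂D q)) (meets (first-∈ source-first) start) m (meets (last-∈ sink-last) end)
    main (no b≁S) with approach {D} {S = _∈ S} (_∈? S) (conn db (S⊂D (first-∈ source-first)))
                         (λ m → b≁S (meets m bxb)) (first-∈ source-first)
    ... | z , s , w , z~s , s∈ , _ = done (cyclic-order hole a∈ b∈ c∈ a≢b a≢c b≢c)
      where
      leg : Between (λ v → D v × ¬ v ∈ S) (b ~_) (λ v → Meets v S)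
      leg = between (λ v → meets? v S) (b ~?_) w bxb (meets s∈ z~s)
      module Leg = Between leg
      W⊂D : ∀ {v} → v ∈ Leg.vertices → D v
      W⊂D m = proj₁ (Leg.inside m)
      W#S : Apart Leg.vertices S
      W#S m = proj₂ (Leg.inside m)
      reflect : ∀ {u : V} → u ≡ a ⊎ u ≡ b ⊎ u ≡ c → u ≡ c ⊎ u ≡ b ⊎ u ≡ a
      reflect (inj₁ e)        = inj₂ (inj₂ e)
      reflect (inj₂ (inj₁ e)) = inj₂ (inj₁ e)
      reflect (inj₂ (inj₂ e)) = inj₁ e
      a≁W : ¬ Meets a Leg.vertices
      a≁W = leg-misses-end hole L#D b∈ Leg.path W⊂D Leg.source-first Leg.sink-last Leg.start Leg.only-source
        a∈ c∈ a≢b a≢c b≢c pathˢ S⊂D W#S sink-last end Leg.end Leg.only-sink cross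
      unrev : ∀ {v} → Meets v (reverse S) → Meets v S
      unrev = Any.reverse⁻
      c≁W : ¬ Meets c Leg.vertices
      c≁W = leg-misses-end hole L#D b∈ Leg.path W⊂D Leg.source-first Leg.sink-last Leg.start Leg.only-source
        c∈ a∈ (b≢c ∘ sym) (a≢c ∘ sym) (a≢b ∘ sym) (path-reverse pathˢ) (S⊂D ∘ ∈-reverse) (λ p q → W#S p (∈-reverse q))
        (last-reverse S source-first) start (Any.reverse⁺ Leg.end) (λ p → Leg.only-sink p ∘ unrev)
        (λ p q e → reflect (cross p q e))
      done : CyclicOrder L a b c ⊎ CyclicOrder L c b a → ⊥
      done (inj₁ o) = tripod-ordered hole L#D b∈ Leg.path W⊂D Leg.source-first Leg.sink-last Leg.start Leg.only-source
        o a≁c pathˢ S⊂D W#S source-first sink-last start end only-source only-sink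
        b≁S Leg.end Leg.only-sink a≁W c≁W cross
      done (inj₂ o) = tripod-ordered hole L#D b∈ Leg.path W⊂D Leg.source-first Leg.sink-last Leg.start Leg.only-source
        o (a≁c ∘ ~-sym) (path-reverse pathˢ) (S⊂D ∘ ∈-reverse) (λ p q → W#S p (∈-reverse q))
        (first-reverse S sink-last) (last-reverse S source-first) end start (only-sink ∘ ∈-reverse) (only-source ∘ ∈-reverse)
        (b≁S ∘ unrev) (Any.reverse⁺ Leg.end) (λ p → Leg.only-sink p ∘ unrev) c≁W a≁W
        (λ p q e → reflect (cross p q e))

-- K₃,₃ from a path with two attachments at each end.

triple : ∀ {A : Set} → A → A → A → Fin 3 → A
triple x y z zero             = x
triple x y z (suc zero)       = y
triple x y z (suc (suc zero)) = z

module Bipartite {n : ℕ} (R : Graph n)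
  (isk4-free : ¬ HasInducedSubdivK4 R) (wheel-free : ¬ HasInducedWheel R) where
  open Connections R isk4-free wheel-free public

  record K₃₃ : Set where
    field
      a b        : Fin 3 → V
      a-distinct : ∀ {i j} → i ≢ j → a i ≢ a j
      b-distinct : ∀ {i j} → i ≢ j → b i ≢ b j
      a-stable   : ∀ i j → ¬ a i ~ a j
      b-stable   : ∀ i j → ¬ b i ~ b j
      complete   : ∀ i j → a i ~ b j

  triple-distinct : ∀ {x y z : V} → x ≢ y → x ≢ z → y ≢ z → ∀ {i j} → i ≢ j → triple x y z i ≢ triple x y z j
  triple-distinct p q r {zero}           {zero}           i≢j = ⊥-elim (i≢j refl)
  triple-distinct p q r {zero}           {suc zero}       i≢j = p
  triple-distinct p q r {zero}           {suc (suc zero)} i≢j = q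
  triple-distinct p q r {suc zero}       {zero}           i≢j = p ∘ sym
  triple-distinct p q r {suc zero}       {suc zero}       i≢j = ⊥-elim (i≢j refl)
  triple-distinct p q r {suc zero}       {suc (suc zero)} i≢j = r
  triple-distinct p q r {suc (suc zero)} {zero}           i≢j = q ∘ sym
  triple-distinct p q r {suc (suc zero)} {suc zero}       i≢j = r ∘ sym
  triple-distinct p q r {suc (suc zero)} {suc (suc zero)} i≢j = ⊥-elim (i≢j refl)

  triple-stable : ∀ {x y z : V} → ¬ x ~ y → ¬ x ~ z → ¬ y ~ z → ∀ i j → ¬ triple x y z i ~ triple x y z j
  triple-stable p q r zero             zero             = ~-irr
  triple-stable p q r zero             (suc zero)       = p
  triple-stable p q r zero             (suc (suc zero)) = q
  triple-stable p q r (suc zero)       zero             = p ∘ ~-sym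
  triple-stable p q r (suc zero)       (suc zero)       = ~-irr
  triple-stable p q r (suc zero)       (suc (suc zero)) = r
  triple-stable p q r (suc (suc zero)) zero             = q ∘ ~-sym
  triple-stable p q r (suc (suc zero)) (suc zero)       = r ∘ ~-sym
  triple-stable p q r (suc (suc zero)) (suc (suc zero)) = ~-irr

  path-edge : ∀ {x y} → x ~ y → Path (x ∷ y ∷ [])
  path-edge {x} {y} e = path-++ path-[ x ] path-[ y ] (λ { (here refl) (here refl) → ~-irr e })
    (λ { refl refl → e }) (λ { (here refl) (here refl) _ → refl , refl })

  path-cherry : ∀ {x y z} → x ~ y → y ~ z → x ≢ z → ¬ x ~ z → Path (x ∷ y ∷ z ∷ [])
  path-cherry {x} {y} {z} e g x≢z x≁z = path-++ path-[ x ] (path-edge g)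
    (λ { (here refl) (here refl) → ~-irr e ; (here refl) (there (here refl)) → x≢z refl })
    (λ { refl refl → e })
    (λ { (here refl) (here refl) _ → refl , refl ; (here refl) (there (here refl)) k → ⊥-elim (x≁z k) })

  square : ∀ {x y z w} → x ~ y → y ~ z → z ~ w → w ~ x → x ≢ z → y ≢ w → ¬ x ~ z → ¬ y ~ w → Hole (x ∷ y ∷ z ∷ w ∷ [])
  square {x} {y} {z} {w} xy yz zw wx x≢z y≢w x≁z y≁w =
    hole-glue (path-cherry xy yz x≢z x≁z) path-[ w ]
      (λ { (here refl) (here refl) → ~-irr wx ; (there (here refl)) (here refl) → y≢w refl
         ; (there (there (here refl))) (here refl) → ~-irr zw })
      (here refl) (here refl) (s≤s (s≤s (s≤s z≤n)))
      (λ { refl refl → zw }) (λ { refl refl → ~-sym wx })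
      (λ { (here refl) (here refl) _ → inj₂ (refl , refl)
         ; (there (here refl)) (here refl) k → ⊥-elim (y≁w k)
         ; (there (there (here refl))) (here refl) _ → inj₁ (refl , refl) })

  -- K₃,₃ without an edge is a subdivision of K₄ with branch vertices x₁, x₂, y₁, y₂. Here it is
  -- seen as a square to which the path y₂, x₃ has three attachments.
  no-k33-minus-edge : ∀ {x₁ x₂ x₃ y₁ y₂ y₃} →
    x₁ ≢ x₂ → x₁ ≢ x₃ → x₂ ≢ x₃ → y₁ ≢ y₂ → y₁ ≢ y₃ → y₂ ≢ y₃ →
    ¬ x₁ ~ x₂ → ¬ x₁ ~ x₃ → ¬ x₂ ~ x₃ → ¬ y₁ ~ y₂ → ¬ y₁ ~ y₃ → ¬ y₂ ~ y₃ →
    x₁ ~ y₁ → x₁ ~ y₂ → x₁ ~ y₃ → x₂ ~ y₁ → x₂ ~ y₂ → x₂ ~ y₃ → x₃ ~ y₁ → x₃ ~ y₂ → ¬ x₃ ~ y₃ → ⊥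
  no-k33-minus-edge {x₁} {x₂} {x₃} {y₁} {y₂} {y₃} x₁≢x₂ x₁≢x₃ x₂≢x₃ y₁≢y₂ y₁≢y₃ y₂≢y₃
    x₁≁x₂ x₁≁x₃ x₂≁x₃ y₁≁y₂ y₁≁y₃ y₂≁y₃ x₁y₁ x₁y₂ x₁y₃ x₂y₁ x₂y₂ x₂y₃ x₃y₁ x₃y₂ x₃≁y₃ =
    three-attachments (square x₁y₁ (~-sym x₂y₁) x₂y₃ (~-sym x₁y₃) x₁≢x₂ y₁≢y₃ x₁≁x₂ y₁≁y₃)
      (path-edge (~-sym x₃y₂)) apart (here refl) (there (here refl)) (there (there (here refl)))
      (~⇒≢ x₁y₁) x₁≢x₂ (~⇒≢ (~-sym x₂y₁)) cross
      (here x₁y₂) (there (here (~-sym x₃y₁))) (here x₂y₂)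
    where
    apart : Apart (x₁ ∷ y₁ ∷ x₂ ∷ y₃ ∷ []) (y₂ ∷ x₃ ∷ [])
    apart (here refl) (here refl) = ~-irr x₁y₂
    apart (here refl) (there (here refl)) = x₁≢x₃ refl
    apart (there (here refl)) (here refl) = y₁≢y₂ refl
    apart (there (here refl)) (there (here refl)) = ~-irr x₃y₁
    apart (there (there (here refl))) (here refl) = ~-irr x₂y₂
    apart (there (there (here refl))) (there (here refl)) = x₂≢x₃ refl
    apart (there (there (there (here refl)))) (here refl) = y₂≢y₃ refl
    apart (there (there (there (here refl)))) (there (here refl)) = x₁≁x₃ x₁y₃
    cross : ∀ {u v} → u ∈ x₁ ∷ y₁ ∷ x₂ ∷ y₃ ∷ [] → v ∈ y₂ ∷ x₃ ∷ [] → u ~ v → u ≡ x₁ ⊎ u ≡ y₁ ⊎ u ≡ x₂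
    cross (here e) _ _ = inj₁ e
    cross (there (here e)) _ _ = inj₂ (inj₁ e)
    cross (there (there (here e))) _ _ = inj₂ (inj₂ e)
    cross (there (there (there (here refl)))) (here refl) k = ⊥-elim (y₂≁y₃ (~-sym k))
    cross (there (there (there (here refl)))) (there (here refl)) k = ⊥-elim (x₃≁y₃ (~-sym k))

  -- X and P close up to a hole on which M has the three attachments x, f and l.
  detour : ∀ {X M P s t x f l} → Path X → Path M → Path P → Apart X M → Apart X P → Apart P M →
    First X s → Last X t → First P f → Last P l → f ≢ l → t ~ f → s ~ l →
    (∀ {u p} → u ∈ X → p ∈ P → u ~ p → (u ≡ t × p ≡ f) ⊎ (u ≡ s × p ≡ l)) →
    x ∈ X → (∀ {u m} → u ∈ X → m ∈ M → u ~ m → u ≡ x) → Meets x M →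
    (∀ {p m} → p ∈ P → m ∈ M → p ~ m → p ≡ f ⊎ p ≡ l) → Meets f M → Meets l M → ⊥
  detour {X} {M} {P} {s} {t} {x} {f} {l} pathˣ pathᵐ pathᵖ X#M X#P P#M fstˣ lstˣ fstᵖ lstᵖ f≢l t~f s~l XP x∈ XM xM PM fM lM =
    three-attachments
      (hole-glue pathˣ pathᵖ X#P (first-∈ fstˣ) f∈
        (three-members (∈-++⁺ˡ (first-∈ fstˣ)) (∈-++⁺ʳ X f∈) (∈-++⁺ʳ X l∈)
          (λ { refl → X#P (first-∈ fstˣ) f∈ }) (λ { refl → X#P (first-∈ fstˣ) l∈ }) f≢l)
        (λ p q → subst₂ _~_ (last-unique X lstˣ p) (first-unique P fstᵖ q) t~f)
        (λ p q → subst₂ _~_ (first-unique X fstˣ p) (last-unique P lstᵖ q) s~l)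
        (λ u∈ p∈ e → ends (XP u∈ p∈ e)))
      pathᵐ (λ p q → Sum.[ (λ k → X#M k q) , (λ k → P#M k q) ]′ (∈-++⁻ X p))
      (∈-++⁺ˡ x∈) (∈-++⁺ʳ X f∈) (∈-++⁺ʳ X l∈)
      (λ { refl → X#P x∈ f∈ }) (λ { refl → X#P x∈ l∈ }) f≢l cross xM fM lM
    where
    f∈ : f ∈ P
    f∈ = first-∈ fstᵖ
    l∈ : l ∈ P
    l∈ = last-∈ lstᵖ
    ends : ∀ {u p} → (u ≡ t × p ≡ f) ⊎ (u ≡ s × p ≡ l) → (Last X u × First P p) ⊎ (First X u × Last P p)
    ends (inj₁ (refl , refl)) = inj₁ (lstˣ , fstᵖ)
    ends (inj₂ (refl , refl)) = inj₂ (fstˣ , lstᵖ)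
    cross : ∀ {u m} → u ∈ X ++ P → m ∈ M → u ~ m → u ≡ x ⊎ u ≡ f ⊎ u ≡ l
    cross u∈ m∈ e with ∈-++⁻ X u∈
    ... | inj₁ k = inj₁ (XM k m∈ e)
    ... | inj₂ k = inj₂ (PM k m∈ e)

  module _ {P : List V} {f l : V} (pathᵖ : Path P) (fstᵖ : First P f) (lstᵖ : Last P l) (f≢l : f ≢ l) where

    -- The attachment of P that the count of three does not exclude: f sees v and w, l sees y and z.
    -- Nonadjacency is required of v and w only; for y and z it will follow from the shape of the
    -- hole.
    record Pairs (L : List V) (v w y z : V) : Set where
      field
        L#P   : Apart L P
        v≁w   : ¬ v ~ w
        v≢w   : v ≢ w
        v≢y   : v ≢ y
        v≢z   : v ≢ z
        w≢y   : w ≢ y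
        w≢z   : w ≢ z
        y≢z   : y ≢ z
        v~f   : v ~ f
        w~f   : w ~ f
        y~l   : y ~ l
        z~l   : z ~ l
        cross : ∀ {u p} → u ∈ L → p ∈ P → u ~ p → ((u ≡ v ⊎ u ≡ w) × p ≡ f) ⊎ ((u ≡ y ⊎ u ≡ z) × p ≡ l)

    swap-vw : ∀ {L v w y z} → Pairs L v w y z → Pairs L w v y z
    swap-vw p = record
      { L#P = L#P ; v≁w = v≁w ∘ ~-sym ; v≢w = v≢w ∘ sym ; v≢y = w≢y ; v≢z = w≢z ; w≢y = v≢y ; w≢z = v≢z ; y≢z = y≢z
      ; v~f = w~f ; w~f = v~f ; y~l = y~l ; z~l = z~l
      ; cross = λ a b e → Sum.map₁ (λ (k , q) → Sum.swap k , q) (cross a b e) }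
      where open Pairs p
    swap-yz : ∀ {L v w y z} → Pairs L v w y z → Pairs L v w z y
    swap-yz p = record
      { L#P = L#P ; v≁w = v≁w ; v≢w = v≢w ; v≢y = v≢z ; v≢z = v≢y ; w≢y = w≢z ; w≢z = w≢y ; y≢z = y≢z ∘ sym
      ; v~f = v~f ; w~f = w~f ; y~l = z~l ; z~l = y~l
      ; cross = λ a b e → Sum.map₂ (λ (k , q) → Sum.swap k , q) (cross a b e) }
      where open Pairs p
    restrict : ∀ {L L′ v w y z} → (∀ {u} → u ∈ L′ → u ∈ L) → Pairs L v w y z → Pairs L′ v w y z
    restrict sub p = record
      { L#P = λ q → L#P (sub q) ; v≁w = v≁w ; v≢w = v≢w ; v≢y = v≢y ; v≢z = v≢z ; w≢y = w≢y ; w≢z = w≢z ; y≢z = y≢z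
      ; v~f = v~f ; w~f = w~f ; y~l = y~l ; z~l = z~l ; cross = λ q → cross (sub q) }
      where open Pairs p

    MeetsEnds : List V → Set
    MeetsEnds M = Meets f M × Meets l M

    -- An arc X of the hole with one end attached to f and the other to l.
    data Bridge (v w y z : V) (X : List V) : V → V → Set where
      fl : ∀ {s t} → s ~ f → t ~ l → (∀ {u} → u ∈ X → u ≡ v ⊎ u ≡ w → u ≡ s) → (∀ {u} → u ∈ X → u ≡ y ⊎ u ≡ z → u ≡ t) → Bridge v w y z X s t
      lf : ∀ {s t} → s ~ l → t ~ f → (∀ {u} → u ∈ X → u ≡ v ⊎ u ≡ w → u ≡ t) → (∀ {u} → u ∈ X → u ≡ y ⊎ u ≡ z → u ≡ s) → Bridge v w y z X s t

    bridge-detour : ∀ {L v w y z X M s t x} → Pairs L v w y z → Bridge v w y z X s t → MeetsEnds M →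
      (∀ {u} → u ∈ X → u ∈ L) → (∀ {u} → u ∈ M → u ∈ L) → Path X → Path M → Apart X M → First X s → Last X t →
      x ∈ X → (∀ {u m} → u ∈ X → m ∈ M → u ~ m → u ≡ x) → Meets x M → ⊥
    bridge-detour {X = X} {M} p (lf s~l t~f at at′) (fM , lM) X⊂ M⊂ pathˣ pathᵐ X#M fstˣ lstˣ x∈ XM xM =
      detour pathˣ pathᵐ pathᵖ X#M (λ a b → L#P (X⊂ a) b) (λ a b → L#P (M⊂ b) a) fstˣ lstˣ fstᵖ lstᵖ f≢l t~f s~l
        (λ u∈ p∈ e → Sum.map (λ (k , q) → at u∈ k , q) (λ (k , q) → at′ u∈ k , q) (cross (X⊂ u∈) p∈ e))
        x∈ XM xM (λ p∈ m∈ e → Sum.map proj₂ proj₂ (cross (M⊂ m∈) p∈ (~-sym e))) fM lM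
      where open Pairs p
    bridge-detour {X = X} {M} p (fl s~f t~l at at′) (fM , lM) X⊂ M⊂ pathˣ pathᵐ X#M fstˣ lstˣ x∈ XM xM =
      detour pathˣ pathᵐ (path-reverse pathᵖ) X#M (λ a b → L#P (X⊂ a) (∈-reverse b)) (λ a b → L#P (M⊂ b) (∈-reverse a))
        fstˣ lstˣ (first-reverse P lstᵖ) (last-reverse P fstᵖ) (f≢l ∘ sym) t~l s~f
        (λ u∈ p∈ e → Sum.swap (Sum.map (λ (k , q) → at u∈ k , q) (λ (k , q) → at′ u∈ k , q) (cross (X⊂ u∈) (∈-reverse p∈) e)))
        x∈ XM xM (λ p∈ m∈ e → Sum.swap (Sum.map proj₂ proj₂ (cross (M⊂ m∈) (∈-reverse p∈) (~-sym e)))) lM fM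
      where open Pairs p

    -- X and P form a hole. The gap `e ∷ E` keeps M away from s, so M touches X in t only; together
    -- with f and l this makes three attachments.
    detour-after : ∀ {v w y z X₁ M e E s t} → let X = s ∷ X₁ ++ [ t ] ; L = X ++ M ++ e ∷ E in
      Hole L → Pairs L v w y z → Bridge v w y z X s t → MeetsEnds M → ⊥
    detour-after {X₁ = X₁} {[]} h p br (() , _)
    detour-after {X₁ = X₁} {M@(m ∷ M₁)} {e} {E} {s} {t} h p br me =
      bridge-detour p br me ∈-++⁺ˡ (λ q → ∈-++⁺ʳ X (∈-++⁺ˡ q)) (hole-path X (M ++ e ∷ E) (here refl) h) pathᵐ
        (λ a b → unique-apart X (Hole.uniq h) a (∈-++⁺ˡ b)) refl (last-++ʳ (s ∷ X₁) refl) (∈-insert (s ∷ X₁)) XM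
        (here (Hole.edge h (inj₁ (consec-++ᵐ X (last-++ʳ (s ∷ X₁) refl) refl))))
      where
      X : List V
      X = s ∷ X₁ ++ [ t ]
      pathᵐ : Path M
      pathᵐ = hole-path M ((e ∷ E) ++ X) (here refl) (subst Hole (++-assoc M (e ∷ E) X) (hole-rotate X (M ++ e ∷ E) h))
      XM : ∀ {u m} → u ∈ X → m ∈ M → u ~ m → u ≡ t
      XM u∈ m∈ k with hole-cross X (M ++ e ∷ E) h u∈ (∈-++⁺ˡ m∈) k
      ... | inj₁ (q , _) = last-unique X q (last-++ʳ (s ∷ X₁) refl)
      ... | inj₂ (_ , q) = ⊥-elim (unique-apart M (unique-++ʳ X (Hole.uniq h)) m∈ (last-∈ {P = e ∷ E} (last-++⁻ M q)))

    -- The mirror image: the gap now separates M from t, and M touches X in s.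
    detour-before : ∀ {v w y z X₁ M e E s t} → let X = s ∷ X₁ ++ [ t ] ; L = X ++ (e ∷ E) ++ M in
      Hole L → Pairs L v w y z → Bridge v w y z X s t → MeetsEnds M → ⊥
    detour-before {M = []} h p br (() , _)
    detour-before {X₁ = X₁} {M@(m ∷ M₁)} {e} {E} {s} {t} h p br me =
      bridge-detour p br me ∈-++⁺ˡ (λ q → ∈-++⁺ʳ X (∈-++⁺ʳ (e ∷ E) q)) (hole-path X ((e ∷ E) ++ M) (here refl) h) pathᵐ
        (λ a b → unique-apart X (Hole.uniq h) a (∈-++⁺ʳ (e ∷ E) b)) refl (last-++ʳ (s ∷ X₁) refl) (here refl) XM
        (meets (last-∈ lstᵐ) (~-sym (Hole.edge h (inj₂ (last-++ʳ X (last-++ʳ (e ∷ E) lstᵐ) , refl)))))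
      where
      X : List V
      X = s ∷ X₁ ++ [ t ]
      lstᵐ : Last M (proj₁ (last-exists m M₁))
      lstᵐ = proj₂ (last-exists m M₁)
      pathᵐ : Path M
      pathᵐ = hole-path M (X ++ e ∷ E) (here refl)
        (hole-rotate (X ++ e ∷ E) M (subst Hole (sym (++-assoc X (e ∷ E) M)) h))
      XM : ∀ {u m} → u ∈ X → m ∈ M → u ~ m → u ≡ s
      XM u∈ m∈ k with hole-cross X ((e ∷ E) ++ M) h u∈ (∈-++⁺ʳ (e ∷ E) m∈) k
      ... | inj₁ (_ , refl) = ⊥-elim (unique-apart (e ∷ E) (unique-++ʳ X (Hole.uniq h)) (here refl) m∈)
      ... | inj₂ (q , _)    = q

    bridge-wy : ∀ {L v w y z X} → Pairs L v w y z → v ∉ X → z ∉ X → Bridge v w y z X w y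
    bridge-wy p v∉ z∉ = fl w~f y~l
      (λ { u∈ (inj₁ refl) → ⊥-elim (v∉ u∈) ; _ (inj₂ e) → e })
      (λ { u∈ (inj₂ refl) → ⊥-elim (z∉ u∈) ; _ (inj₁ e) → e })
      where open Pairs p
    bridge-yw : ∀ {L v w y z X} → Pairs L v w y z → v ∉ X → z ∉ X → Bridge v w y z X y w
    bridge-yw p v∉ z∉ = lf y~l w~f
      (λ { u∈ (inj₁ refl) → ⊥-elim (v∉ u∈) ; _ (inj₂ e) → e })
      (λ { u∈ (inj₂ refl) → ⊥-elim (z∉ u∈) ; _ (inj₁ e) → e })
      where open Pairs p

    Paired : (v w y z : V) → List V → Set
    Paired v w y z L = Hole L × Pairs L v w y z

    rotate-paired : ∀ {v w y z} P Q → Paired v w y z (P ++ Q) → Paired v w y z (Q ++ P)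
    rotate-paired P Q (h , p) = hole-rotate P Q h , restrict (∈-resp-↭ (++-comm Q P)) p

    ends-meet : ∀ {L v w y z M} → Pairs L v w y z → v ∈ M → z ∈ M → MeetsEnds M
    ends-meet p v∈ z∈ = meets v∈ (~-sym v~f) , meets z∈ (~-sym z~l)
      where open Pairs p

    -- As v and w are nonadjacent, α is nonempty and can be the gap. The arc from w to y is X, and
    -- the arc after it, through z up to v, is M.
    non-crossing : ∀ {v w y z α β₁ β₂ β₃} → ¬ Paired v w y z (v ∷ α ++ w ∷ β₁ ++ y ∷ β₂ ++ z ∷ β₃)
    non-crossing {α = []} (h , p) = Pairs.v≁w p (Hole.edge h (inj₁ (inj₁ (refl , refl))))
    non-crossing {v} {w} {y} {z} {α = e ∷ E} {β₁} {β₂} {β₃} hp =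
      detour-after {X₁ = β₁} {M = M} h p (bridge-wy p (out v∈) (out z∈)) (ends-meet p v∈ z∈)
      where
      M : List V
      M = β₂ ++ z ∷ β₃ ++ [ v ]
      v∈ : v ∈ M
      v∈ = ∈-++⁺ʳ β₂ (∈-insert (z ∷ β₃))
      z∈ : z ∈ M
      z∈ = ∈-insert β₂
      open MonoidSolver (++-monoid V) using (solve; _⊜_; _⊕_)
      hp′ : Paired v w y z ((w ∷ β₁ ++ [ y ]) ++ M ++ e ∷ E)
      hp′ = subst (Paired v w y z)
        (solve 8 (λ w β₁ y β₂ z β₃ v E → (w ⊕ (β₁ ⊕ (y ⊕ (β₂ ⊕ (z ⊕ β₃))))) ⊕ (v ⊕ E) ⊜
           ((w ⊕ (β₁ ⊕ y)) ⊕ ((β₂ ⊕ (z ⊕ (β₃ ⊕ v))) ⊕ E))) refl [ w ] β₁ [ y ] β₂ [ z ] β₃ [ v ] (e ∷ E))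
        (rotate-paired (v ∷ e ∷ E) (w ∷ β₁ ++ y ∷ β₂ ++ z ∷ β₃) hp)
      h = proj₁ hp′
      p = proj₂ hp′
      out : ∀ {u} → u ∈ M → u ∉ w ∷ β₁ ++ [ y ]
      out u∈ k = unique-apart (w ∷ β₁ ++ [ y ]) (Hole.uniq h) k (∈-++⁺ˡ u∈)

    -- A nonempty α₁ would be the gap between the arc M, which passes z and ends in v, and the arc X
    -- from y to w.
    crossing-tightˡ : ∀ {v w y z α₁ α₂ β₁ β₂} → Paired v w y z (v ∷ α₁ ++ y ∷ α₂ ++ w ∷ β₁ ++ z ∷ β₂) → α₁ ≡ []
    crossing-tightˡ {α₁ = []} _ = refl
    crossing-tightˡ {v} {w} {y} {z} {α₁ = e ∷ E} {α₂} {β₁} {β₂} hp =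
      ⊥-elim (detour-after {X₁ = α₂} {M = M} h p (bridge-yw p (out v∈) (out z∈)) (ends-meet p v∈ z∈))
      where
      M : List V
      M = β₁ ++ z ∷ β₂ ++ [ v ]
      v∈ : v ∈ M
      v∈ = ∈-++⁺ʳ β₁ (∈-insert (z ∷ β₂))
      z∈ : z ∈ M
      z∈ = ∈-insert β₁
      open MonoidSolver (++-monoid V) using (solve; _⊜_; _⊕_)
      hp′ : Paired v w y z ((y ∷ α₂ ++ [ w ]) ++ M ++ e ∷ E)
      hp′ = subst (Paired v w y z)
        (solve 8 (λ w β₁ y β₂ z β₃ v E → (w ⊕ (β₁ ⊕ (y ⊕ (β₂ ⊕ (z ⊕ β₃))))) ⊕ (v ⊕ E) ⊜
           ((w ⊕ (β₁ ⊕ y)) ⊕ ((β₂ ⊕ (z ⊕ (β₃ ⊕ v))) ⊕ E))) refl [ y ] α₂ [ w ] β₁ [ z ] β₂ [ v ] (e ∷ E))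
        (rotate-paired (v ∷ e ∷ E) (y ∷ α₂ ++ w ∷ β₁ ++ z ∷ β₂) hp)
      h = proj₁ hp′
      p = proj₂ hp′
      out : ∀ {u} → u ∈ M → u ∉ y ∷ α₂ ++ [ w ]
      out u∈ k = unique-apart (y ∷ α₂ ++ [ w ]) (Hole.uniq h) k (∈-++⁺ˡ u∈)

    -- A nonempty α₂ would be the gap between the arc X from v to y and the arc M that starts at w
    -- and passes z.
    crossing-tightʳ : ∀ {v w y z α₁ α₂ β₁ β₂} → Paired v w y z (v ∷ α₁ ++ y ∷ α₂ ++ w ∷ β₁ ++ z ∷ β₂) → α₂ ≡ []
    crossing-tightʳ {α₂ = []} _ = refl
    crossing-tightʳ {v} {w} {y} {z} {α₁} {α₂ = e ∷ E} {β₁} {β₂} hp =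
      ⊥-elim (detour-before {X₁ = α₁} {M = M} h (swap-vw p) (bridge-wy (swap-vw p) (out w∈) (out z∈)) (ends-meet (swap-vw p) w∈ z∈))
      where
      M : List V
      M = w ∷ β₁ ++ z ∷ β₂
      w∈ : w ∈ M
      w∈ = here refl
      z∈ : z ∈ M
      z∈ = ∈-insert (w ∷ β₁)
      hp′ : Paired v w y z ((v ∷ α₁ ++ [ y ]) ++ (e ∷ E) ++ M)
      hp′ = subst (Paired v w y z) (cong (v ∷_) (sym (++-assoc α₁ [ y ] _))) hp
      h = proj₁ hp′
      p = proj₂ hp′
      out : ∀ {u} → u ∈ M → u ∉ v ∷ α₁ ++ [ y ]
      out u∈ k = unique-apart (v ∷ α₁ ++ [ y ]) (Hole.uniq h) k (∈-++⁺ʳ (e ∷ E) u∈)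

    -- Exchanging v with w and y with z lets the two tightness results empty β₁ and β₂ as well.
    half-turn : ∀ {v w y z α₁ α₂ β₁ β₂} → Paired v w y z (v ∷ α₁ ++ y ∷ α₂ ++ w ∷ β₁ ++ z ∷ β₂) →
                Paired w v z y (w ∷ β₁ ++ z ∷ β₂ ++ v ∷ α₁ ++ y ∷ α₂)
    half-turn {v} {w} {y} {z} {α₁} {α₂} {β₁} {β₂} hp = proj₁ hp′ , swap-vw (swap-yz (proj₂ hp′))
      where
      hp′ : Paired v w y z (w ∷ β₁ ++ z ∷ β₂ ++ v ∷ α₁ ++ y ∷ α₂)
      hp′ = subst (Paired v w y z) (cong (w ∷_) (++-assoc β₁ (z ∷ β₂) _))
        (rotate-paired (v ∷ α₁ ++ y ∷ α₂) (w ∷ β₁ ++ z ∷ β₂)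
          (subst (Paired v w y z) (cong (v ∷_) (sym (++-assoc α₁ (y ∷ α₂) _))) hp))

    -- With all four gaps empty the hole is the square v, y, w, z. Adding l to the side of v and w
    -- and f to the side of y and z leaves only the edge between f and l in doubt, and its absence
    -- would give K₃,₃ minus an edge.
    crossing : ∀ {v w y z α₁ α₂ β₁ β₂} → Paired v w y z (v ∷ α₁ ++ y ∷ α₂ ++ w ∷ β₁ ++ z ∷ β₂) → K₃₃
    crossing {v} {w} {y} {z} hp with crossing-tightˡ hp | crossing-tightʳ hp | crossing-tightˡ (half-turn hp) | crossing-tightʳ (half-turn hp)
    ... | refl | refl | refl | refl = k33 (f ~? l)
      where
      h = proj₁ hp
      open Pairs (proj₂ hp)
      f∈ : f ∈ P
      f∈ = first-∈ fstᵖ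
      l∈ : l ∈ P
      l∈ = last-∈ lstᵖ
      L : List V
      L = v ∷ y ∷ w ∷ z ∷ []
      v~y : v ~ y
      v~y = Hole.edge h (inj₁ (inj₁ (refl , refl)))
      w~y : w ~ y
      w~y = ~-sym (Hole.edge h (inj₁ (inj₂ (inj₁ (refl , refl)))))
      w~z : w ~ z
      w~z = Hole.edge h (inj₁ (inj₂ (inj₂ (inj₁ (refl , refl)))))
      v~z : v ~ z
      v~z = ~-sym (Hole.edge h (inj₂ (refl , refl)))
      y≁z : ¬ y ~ z
      y≁z e with hole-cross (v ∷ y ∷ []) (w ∷ z ∷ []) h (there (here refl)) (there (here refl)) e
      ... | inj₁ (_ , q) = w≢z (sym q)
      ... | inj₂ (q , _) = v≢y (sym q)
      v≁l : ¬ v ~ l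
      v≁l e with cross (here refl) l∈ e
      ... | inj₁ (_ , q)      = f≢l (sym q)
      ... | inj₂ (inj₁ q , _) = v≢y q
      ... | inj₂ (inj₂ q , _) = v≢z q
      w≁l : ¬ w ~ l
      w≁l e with cross (there (there (here refl))) l∈ e
      ... | inj₁ (_ , q)      = f≢l (sym q)
      ... | inj₂ (inj₁ q , _) = w≢y q
      ... | inj₂ (inj₂ q , _) = w≢z q
      y≁f : ¬ y ~ f
      y≁f e with cross (there (here refl)) f∈ e
      ... | inj₂ (_ , q)      = f≢l q
      ... | inj₁ (inj₁ q , _) = v≢y (sym q)
      ... | inj₁ (inj₂ q , _) = w≢y (sym q)
      z≁f : ¬ z ~ f
      z≁f e with cross (there (there (there (here refl)))) f∈ e
      ... | inj₂ (_ , q)      = f≢l q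
      ... | inj₁ (inj₁ q , _) = v≢z (sym q)
      ... | inj₁ (inj₂ q , _) = w≢z (sym q)
      v≢l : v ≢ l
      v≢l refl = L#P (here refl) l∈
      w≢l : w ≢ l
      w≢l refl = L#P (there (there (here refl))) l∈
      y≢f : y ≢ f
      y≢f refl = L#P (there (here refl)) f∈
      z≢f : z ≢ f
      z≢f refl = L#P (there (there (there (here refl)))) f∈
      k33 : Dec (f ~ l) → K₃₃
      k33 (no f≁l) = ⊥-elim (no-k33-minus-edge v≢w v≢l w≢l y≢z y≢f z≢f v≁w v≁l w≁l y≁z y≁f z≁f
        v~y v~z v~f w~y w~z w~f (~-sym y~l) (~-sym z~l) (f≁l ∘ ~-sym))
      k33 (yes f~l) = record
        { a = triple v w l ; b = triple y z f
        ; a-distinct = triple-distinct v≢w v≢l w≢l ; b-distinct = triple-distinct y≢z y≢f z≢f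
        ; a-stable = triple-stable v≁w v≁l w≁l ; b-stable = triple-stable y≁z y≁f z≁f
        ; complete = comp }
        where
        comp : ∀ i j → triple v w l i ~ triple y z f j
        comp zero             zero             = v~y
        comp zero             (suc zero)       = v~z
        comp zero             (suc (suc zero)) = v~f
        comp (suc zero)       zero             = w~y
        comp (suc zero)       (suc zero)       = w~z
        comp (suc zero)       (suc (suc zero)) = w~f
        comp (suc (suc zero)) zero             = ~-sym y~l
        comp (suc (suc zero)) (suc zero)       = ~-sym z~l
        comp (suc (suc zero)) (suc (suc zero)) = ~-sym f~l

    non-crossing′ : ∀ {v w y z α β} → Paired v w y z (v ∷ α ++ w ∷ β) → y ∈ β → z ∈ β → ⊥
    non-crossing′ {α = α} hp y∈ z∈ with ∈-∃++ y∈
    ... | β₁ , β₂ , refl with ∈-mid β₁ z∈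
    ... | inj₂ (inj₁ e) = Pairs.y≢z (proj₂ hp) (sym e)
    ... | inj₂ (inj₂ z∈β₂) with ∈-∃++ z∈β₂
    ...   | _ , _ , refl = non-crossing {α = α} {β₁} hp
    non-crossing′ {v} {w} {y} {z} {α} hp y∈ z∈ | β₁ , β₂ , refl | inj₁ z∈β₁ with ∈-∃++ z∈β₁
    ...   | γ₁ , γ₂ , refl = non-crossing {α = α} {γ₁} {γ₂} {β₂} (proj₁ hp′ , swap-yz (proj₂ hp′))
      where
      hp′ = subst (Paired v w y z) (cong (λ Z → v ∷ α ++ w ∷ Z) (++-assoc γ₁ (z ∷ γ₂) (y ∷ β₂))) hp

    opposite-pairs : ∀ {v w y z α β} → Paired v w y z (v ∷ α ++ w ∷ β) → y ∈ α → z ∈ β → K₃₃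
    opposite-pairs {v} {w} {y} {z} {α} {β} hp y∈ z∈ with ∈-∃++ y∈ | ∈-∃++ z∈
    ... | α₁ , α₂ , refl | β₁ , β₂ , refl =
      crossing {α₁ = α₁} {α₂} {β₁} {β₂} (subst (Paired v w y z) (cong (v ∷_) (++-assoc α₁ (y ∷ α₂) (w ∷ β₁ ++ z ∷ β₂))) hp)

    two-pairs : ∀ {L v w y z} → Hole L → v ∈ L → w ∈ L → y ∈ L → z ∈ L → Pairs L v w y z → K₃₃
    two-pairs {L} {v} {w} {y} {z} hole v∈ w∈ y∈ z∈ p with hole-from hole v∈
    ... | X , h , sub , sup with restrict sub p | sup w∈ | sup y∈ | sup z∈
    ... | q | here e | _ | _ = ⊥-elim (Pairs.v≢w q (sym e))
    ... | q | _ | here e | _ = ⊥-elim (Pairs.v≢y q (sym e))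
    ... | q | _ | _ | here e = ⊥-elim (Pairs.v≢z q (sym e))
    ... | q | there w∈X | there y∈X | there z∈X with ∈-∃++ w∈X
    ... | α , β , refl with ∈-mid α y∈X | ∈-mid α z∈X
    ... | inj₂ (inj₁ e) | _             = ⊥-elim (Pairs.w≢y q (sym e))
    ... | _             | inj₂ (inj₁ e) = ⊥-elim (Pairs.w≢z q (sym e))
    ... | inj₂ (inj₂ y∈β) | inj₂ (inj₂ z∈β) = ⊥-elim (non-crossing′ {α = α} (h , q) y∈β z∈β)
    ... | inj₁ y∈α | inj₂ (inj₂ z∈β) = opposite-pairs {α = α} (h , q) y∈α z∈β
    ... | inj₂ (inj₂ y∈β) | inj₁ z∈α = opposite-pairs {α = α} (h , swap-yz q) z∈α y∈β
    ... | inj₁ y∈α | inj₁ z∈α = ⊥-elim (non-crossing′ {α = β} (proj₁ hp′ , swap-vw (proj₂ hp′)) y∈α z∈α)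
      where
      hp′ : Paired v w y z (w ∷ β ++ v ∷ α)
      hp′ = rotate-paired (v ∷ α) (w ∷ β) (h , q)

-- Graphs without cutsets of size at most two: vertices off a hole that see it.

module ThreeConnected {n : ℕ} (R : Graph n)
  (isk4-free : ¬ HasInducedSubdivK4 R) (wheel-free : ¬ HasInducedWheel R)
  (no-2-cutset : ∀ a b {u v} → u ≢ a → u ≢ b → v ≢ a → v ≢ b → Walks.Walk R (λ x → x ≢ a × x ≢ b) u v) where
  open Bipartite R isk4-free wheel-free public

  triangle : ∀ {a b c} → a ~ b → b ~ c → c ~ a → Hole (a ∷ b ∷ c ∷ [])
  triangle {a} {b} {c} ab bc ca = hole-glue (path-edge ab) path-[ c ]
    (λ { (here refl) (here refl) → ~-irr ca ; (there (here refl)) (here refl) → ~-irr bc })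
    (here refl) (here refl) (s≤s (s≤s (s≤s z≤n))) (λ { refl refl → bc }) (λ { refl refl → ~-sym ca })
    (λ { (here refl) (here refl) _ → inj₂ (refl , refl) ; (there (here refl)) (here refl) _ → inj₁ (refl , refl) })

  -- Since a and b do not separate d from c, a chordless path off the triangle a, b, c leads from d
  -- to a neighbour of c. It has three attachments on that triangle.
  no-diamond : ∀ {a b c d} → a ~ b → c ≢ d → a ~ c → b ~ c → a ~ d → b ~ d → ⊥
  no-diamond {a} {b} {c} {d} ab c≢d ac bc ad bd
    with approach {S = _≡ c} (_≟ c) (no-2-cutset a b {d} {c} (~⇒≢ ad ∘ sym) (~⇒≢ bd ∘ sym) (~⇒≢ ac ∘ sym) (~⇒≢ bc ∘ sym))
           (c≢d ∘ sym) refl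
  ... | z , s , w , z~s , refl , _ =
    three-attachments (triangle ab bc (~-sym ac)) path apart (here refl) (there (here refl)) (there (there (here refl)))
      (~⇒≢ ab) (~⇒≢ ac) (~⇒≢ bc) cross (here ad) (here bd) (meets (last-∈ sink-last) end)
    where
    open From (shorten {End = c ~_} (c ~?_) w (~-sym z~s))
    apart : Apart (a ∷ b ∷ c ∷ []) (d ∷ rest)
    apart (here refl)                 q = proj₁ (proj₁ (inside q)) refl
    apart (there (here refl))         q = proj₂ (proj₁ (inside q)) refl
    apart (there (there (here refl))) q = proj₂ (inside q) refl
    cross : ∀ {u v} → u ∈ a ∷ b ∷ c ∷ [] → v ∈ d ∷ rest → u ~ v → u ≡ a ⊎ u ≡ b ⊎ u ≡ c
    cross (here e)                 _ _ = inj₁ e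
    cross (there (here e))         _ _ = inj₂ (inj₁ e)
    cross (there (there (here e))) _ _ = inj₂ (inj₂ e)

  two-neighbours : ∀ {L x u v w} → Hole L → x ∉ L → u ∈ L → v ∈ L → u ≢ v → x ~ u → x ~ v →
                   w ∈ L → x ~ w → w ≡ u ⊎ w ≡ v
  two-neighbours {u = u} {v} {w} h x∉ u∈ v∈ u≢v xu xv w∈ xw with w ≟ u | w ≟ v
  ... | yes e | _     = inj₁ e
  ... | _     | yes e = inj₂ e
  ... | no p  | no q  = ⊥-elim (no-wheel h x∉ u∈ v∈ w∈ u≢v (p ∘ sym) (q ∘ sym) xu xv xw)

  third-vertex : ∀ {L} → Hole L → ∀ v w → ∃ λ y → y ∈ L × y ≢ v × y ≢ w
  third-vertex {L} h v w with Any.any? (λ y → ¬? (y ≟ v) ×-dec ¬? (y ≟ w)) L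
  ... | yes a = find a
  ... | no ¬a = ⊥-elim (few (Hole.uniq h) (Hole.long h) ¬a)
    where
    few : ∀ {L} → Unique L → 3 ≤ length L → ¬ ¬ Any (λ y → y ≢ v × y ≢ w) L
    few {_ ∷ []} _ (s≤s ())
    few {_ ∷ _ ∷ []} _ (s≤s (s≤s ()))
    few {p ∷ q ∷ r ∷ _} ((p≢q ∷ p≢r ∷ _) ∷ (q≢r ∷ _) ∷ _) _ none with p ≟ v | p ≟ w | q ≟ v | q ≟ w
    ... | no a | no b | _ | _ = none (here (a , b))
    ... | _ | _ | no a | no b = none (there (here (a , b)))
    ... | yes refl | _ | yes refl | _ = p≢q refl
    ... | _ | yes refl | _ | yes refl = p≢q refl
    ... | yes refl | _ | _ | yes refl = none (there (there (here (p≢r ∘ sym , q≢r ∘ sym))))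
    ... | _ | yes refl | yes refl | _ = none (there (there (here (q≢r ∘ sym , p≢r ∘ sym))))

  -- The two vertices may coincide, which describes a single attachment.
  Local : List V → V → V → V → Set
  Local L v w q = q ∉ L × (∀ {l} → l ∈ L → l ~ q → l ≡ v ⊎ l ≡ w)

  Foreign : List V → V → V → V → Set
  Foreign L v w q = q ∈ L ⊎ Any (λ l → (l ≢ v × l ≢ w) × l ~ q) L

  foreign? : ∀ L v w q → Dec (Foreign L v w q)
  foreign? L v w q = (q ∈? L) ⊎-dec Any.any? (λ l → (¬? (l ≟ v) ×-dec ¬? (l ≟ w)) ×-dec (l ~? q)) L

  ¬foreign⇒local : ∀ {L v w q} → ¬ Foreign L v w q → Local L v w q
  ¬foreign⇒local {L} {v} {w} {q} ¬f = (λ m → ¬f (inj₁ m)) , λ {l} l∈ e → near l∈ e (l ≟ v) (l ≟ w)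
    where
    near : ∀ {l} → l ∈ L → l ~ q → Dec (l ≡ v) → Dec (l ≡ w) → l ≡ v ⊎ l ≡ w
    near l∈ e (yes p) _       = inj₁ p
    near l∈ e _       (yes p) = inj₂ p
    near l∈ e (no p)  (no r)  = ⊥-elim (¬f (inj₂ (lose l∈ ((p , r) , e))))

  -- The first vertex u off L, on a walk from x to L, that sees more of L than v and w.
  record Exit (L : List V) (v w : V) (D : V → Set) (x : V) : Set where
    field
      {z u y} : V
      walk    : Walk (λ q → D q × Local L v w q) x z
      z~u     : z ~ u
      u∉L     : u ∉ L
      y∈L     : y ∈ L
      y≢v     : y ≢ v
      y≢w     : y ≢ w
      y~u     : y ~ u

  exit : ∀ {L v w D x c} → Local L v w x → Walk D x c → c ∈ L → (∀ {q} → D q → q ≢ v × q ≢ w) → Exit L v w D x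
  exit {L} {v} {w} {D} {x} {c} (x∉ , loc) walk c∈ avoid with approach (foreign? L v w) walk ¬fx (inj₁ c∈)
    where
    ¬fx : ¬ Foreign L v w x
    ¬fx (inj₁ m) = x∉ m
    ¬fx (inj₂ a) with find a
    ... | l , l∈ , (p , q) , e = Sum.[ p , q ]′ (loc l∈ e)
  ... | z , u , walk′ , z~u , fu , du = leave fu
    where
    local : ∀ {y} → Walk (λ q → D q × ¬ Foreign L v w q) y z → ¬ Foreign L v w z
    local (stop (_ , k))  = k
    local (move _ _ more) = local more
    leave : Foreign L v w u → Exit L v w D x
    -- If u lay on L, its predecessor z would already see a vertex of L other than v and w.
    leave (inj₁ u∈) = ⊥-elim (local walk′ (inj₂ (lose u∈ (avoid du , ~-sym z~u))))
    leave (inj₂ a) with u ∈? L | find a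
    ... | yes u∈ | _ = leave (inj₁ u∈)
    ... | no u∉  | y , y∈ , (p , q) , e = record
      { walk = walk-map (λ (d , k) → d , ¬foreign⇒local k) walk′ ; z~u = z~u ; u∉L = u∉
      ; y∈L = y∈ ; y≢v = p ; y≢w = q ; y~u = e }

  -- In `narrow` the vertex u adds just one new attachment y. The outcome `apex` is what eventually
  -- calls for a triangle cutset.
  data Escape (L : List V) (v w : V) (D : V → Set) (u y : V) : Set where
    narrow : (∀ {l} → l ∈ L → l ~ u → l ≡ v ⊎ l ≡ w ⊎ l ≡ y) → Escape L v w D u y
    k33    : K₃₃ → Escape L v w D u y
    apex   : ∀ {t} → v ~ w → D t → v ~ t → w ~ t → Escape L v w D u y

  -- If u sees a further y′, wheel-freeness leaves it exactly y and y′ on L. A shortest path from u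
  -- through D to a vertex that sees v or w then has y and y′ at one end. If its other end sees only
  -- one of v and w, there are three attachments; if it sees both, they are adjacent and it is an
  -- apex, or `two-pairs` applies.
  escape : ∀ {L v w D u y z x} → Hole L → v ∈ L → w ∈ L → v ≢ w → u ∉ L → y ∈ L → y ≢ v → y ≢ w → y ~ u →
    (∀ {q} → D q → Local L v w q) → u ~ z → Walk D z x → v ~ x → Escape L v w D u y
  escape {L} {v} {w} {D} {u} {y} {z} {x} hole v∈ w∈ v≢w u∉ y∈ y≢v y≢w y~u local u~z walk v~x
    with Any.any? (λ l → ((¬? (l ≟ v) ×-dec ¬? (l ≟ w)) ×-dec ¬? (l ≟ y)) ×-dec (l ~? u)) L
  ... | no ¬a = narrow (λ {l} l∈ e → near l∈ e (l ≟ v) (l ≟ w) (l ≟ y))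
    where
    near : ∀ {l} → l ∈ L → l ~ u → Dec (l ≡ v) → Dec (l ≡ w) → Dec (l ≡ y) → l ≡ v ⊎ l ≡ w ⊎ l ≡ y
    near l∈ e (yes p) _       _       = inj₁ p
    near l∈ e _       (yes p) _       = inj₂ (inj₁ p)
    near l∈ e _       _       (yes p) = inj₂ (inj₂ p)
    near l∈ e (no p)  (no q)  (no r)  = ⊥-elim (¬a (lose l∈ (((p , q) , r) , e)))
  ... | yes a with find a
  ... | y′ , y′∈ , ((y′≢v , y′≢w) , y′≢y) , y′~u = split (v ~? sink) (w ~? sink) (v ~? w)
    where
    End : V → Set
    End q = v ~ q ⊎ w ~ q
    End? : ∀ q → Dec (End q)
    End? q = (v ~? q) ⊎-dec (w ~? q)
    atU : ∀ {l} → l ∈ L → l ~ u → l ≡ y ⊎ l ≡ y′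
    atU l∈ e = two-neighbours hole u∉ y∈ y′∈ (y′≢y ∘ sym) (~-sym y~u) (~-sym y′~u) l∈ (~-sym e)
    ¬End-u : ¬ End u
    ¬End-u (inj₁ e) = Sum.[ (λ k → y≢v (sym k)) , (λ k → y′≢v (sym k)) ]′ (atU v∈ e)
    ¬End-u (inj₂ e) = Sum.[ (λ k → y≢w (sym k)) , (λ k → y′≢w (sym k)) ]′ (atU w∈ e)
    open From (shorten {D = λ q → q ≡ u ⊎ D q} {End = End} End? (move (inj₁ refl) u~z (walk-map inj₂ walk)) (inj₁ v~x))
    restD : ∀ {q} → q ∈ rest → D q
    restD m with inside (there m)
    ... | inj₁ refl = ⊥-elim (unique-apart [ u ] (Path.uniq path) (here refl) m)
    ... | inj₂ d    = d
    sink∈ : sink ∈ rest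
    sink∈ with last-∈ {P = u ∷ rest} sink-last
    ... | here e  = ⊥-elim (¬End-u (subst End e end))
    ... | there m = m
    u≢sink : u ≢ sink
    u≢sink e = ¬End-u (subst End (sym e) end)
    L#P : Apart L (u ∷ rest)
    L#P p (here refl) = u∉ p
    L#P p (there m)   = proj₁ (local (restD m)) p
    side : ∀ {l} → l ∈ L → ∀ {q} → q ∈ u ∷ rest → l ~ q → ((l ≡ v ⊎ l ≡ w) × q ≡ sink) ⊎ ((l ≡ y ⊎ l ≡ y′) × q ≡ u)
    side l∈ (here refl) e = inj₂ (atU l∈ e , refl)
    side l∈ (there m)   e with proj₂ (local (restD m)) l∈ e
    ... | inj₁ refl = inj₁ (inj₁ refl , only-sink (there m) (inj₁ e))
    ... | inj₂ refl = inj₁ (inj₂ refl , only-sink (there m) (inj₂ e))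
    lone : ∀ {v′} → v′ ∈ L → v′ ≢ y → v′ ≢ y′ → v′ ~ sink → (∀ {l} → l ≡ v ⊎ l ≡ w → l ~ sink → l ≡ v′) → ⊥
    lone v′∈ v′≢y v′≢y′ v′~s only = three-attachments hole path L#P v′∈ y∈ y′∈ v′≢y v′≢y′ (y′≢y ∘ sym)
      cr (meets (there sink∈) v′~s) (here y~u) (here y′~u)
      where
      cr : ∀ {l q} → l ∈ L → q ∈ u ∷ rest → l ~ q → l ≡ _ ⊎ l ≡ y ⊎ l ≡ y′
      cr l∈ q∈ e with side l∈ q∈ e
      ... | inj₁ (k , refl) = inj₁ (only k e)
      ... | inj₂ (k , _)    = inj₂ k
    split : Dec (v ~ sink) → Dec (w ~ sink) → Dec (v ~ w) → Escape L v w D u y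
    split (yes vs) (yes ws) (yes vw) = apex vw (restD sink∈) vs ws
    split (yes vs) (yes ws) (no v≁w) = k33 (two-pairs (path-reverse path) (first-reverse (u ∷ rest) sink-last)
      (last-reverse (u ∷ rest) refl) (u≢sink ∘ sym) hole v∈ w∈ y∈ y′∈ (record
        { L#P = λ p q → L#P p (∈-reverse q) ; v≁w = v≁w ; v≢w = v≢w ; v≢y = y≢v ∘ sym ; v≢z = y′≢v ∘ sym
        ; w≢y = y≢w ∘ sym ; w≢z = y′≢w ∘ sym ; y≢z = y′≢y ∘ sym
        ; v~f = vs ; w~f = ws ; y~l = y~u ; z~l = y′~u ; cross = λ p q e → side p (∈-reverse q) e }))
    split (yes vs) (no w≁s) _ = ⊥-elim (lone v∈ (y≢v ∘ sym) (y′≢v ∘ sym) vs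
      (λ { (inj₁ k) _ → k ; (inj₂ refl) e → ⊥-elim (w≁s e) }))
    split (no v≁s) (yes ws) _ = ⊥-elim (lone w∈ (y≢w ∘ sym) (y′≢w ∘ sym) ws
      (λ { (inj₂ k) _ → k ; (inj₁ refl) e → ⊥-elim (v≁s e) }))
    split (no v≁s) (no w≁s) _ = ⊥-elim (Sum.[ v≁s , w≁s ]′ end)

  -- A walk from x towards the rest of L that avoids v and w leaves the local vertices at some u. As
  -- v and w are nonadjacent there is no apex, and in the case `narrow` a path from u to x would
  -- have the three attachments v, w and y.
  opposite-neighbours⇒K₃₃ : ∀ {L x v w} → Hole L → x ∉ L → v ∈ L → w ∈ L → v ≢ w → ¬ v ~ w → x ~ v → x ~ w → K₃₃
  opposite-neighbours⇒K₃₃ {L} {x} {v} {w} hole x∉ v∈ w∈ v≢w v≁w xv xw with third-vertex hole v w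
  ... | c , c∈ , c≢v , c≢w = conclude
    (escape hole v∈ w∈ v≢w u∉L y∈L y≢v y≢w y~u (λ d → d) (~-sym z~u) (walk-sym (walk-map proj₂ walk)) (~-sym xv))
    where
    here-local : Local L v w x
    here-local = x∉ , λ l∈ e → two-neighbours hole x∉ v∈ w∈ v≢w xv xw l∈ (~-sym e)
    open Exit (exit here-local (no-2-cutset v w (~⇒≢ xv) (~⇒≢ xw) c≢v c≢w) c∈ (λ d → d))
    conclude : Escape L v w (Local L v w) u y → K₃₃
    conclude (k33 k)        = k
    conclude (apex vw _ _ _) = ⊥-elim (v≁w vw)
    conclude (narrow nar)   = ⊥-elim (three-attachments hole path apart v∈ w∈ y∈L v≢w (y≢v ∘ sym) (y≢w ∘ sym) cross
        (meets (last-∈ sink-last) (subst (v ~_) (sym end) (~-sym xv)))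
        (meets (last-∈ sink-last) (subst (w ~_) (sym end) (~-sym xw))) (here y~u))
      where
      open From (shorten {D = λ q → q ≡ u ⊎ Local L v w q} {End = _≡ x} (_≟ x)
        (move (inj₁ refl) (~-sym z~u) (walk-map (inj₂ ∘ proj₂) (walk-sym walk))) refl)
      apart : Apart L (u ∷ rest)
      apart p q with inside q
      ... | inj₁ refl = u∉L p
      ... | inj₂ k    = proj₁ k p
      cross : ∀ {l q} → l ∈ L → q ∈ u ∷ rest → l ~ q → l ≡ v ⊎ l ≡ w ⊎ l ≡ y
      cross l∈ q∈ e with inside q∈
      ... | inj₁ refl = nar l∈ e
      ... | inj₂ k    = Sum.map₂ inj₁ (proj₂ k l∈ e)

  -- The predicate `Walk D x` serves as the component of x in D; a walk in D from x never leaves it.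
  component-walk : ∀ {D x y} → Walk D x y → Walk (Walk D x) x y
  component-walk {D} {x} w = go (stop (walk-start w)) w
    where
    go : ∀ {p q} → Walk D x p → Walk D p q → Walk (Walk D x) p q
    go pre (stop _)     = stop pre
    go pre (move d e w) = move pre e (go (walk-snoc pre e (walk-start w)) w)

  walk-end : ∀ {D x y} → Walk D x y → D y
  walk-end = walk-start ∘ walk-sym

  -- For a hole this says that it is no triangle, so that among any three attachments there is a
  -- nonadjacent pair, as `three-attachments-connected` demands.
  TriangleFree : List V → Set
  TriangleFree L = ∀ {a b c} → a ∈ L → b ∈ L → c ∈ L → a ~ b → a ~ c → b ~ c → ⊥

  module Pendant {L : List V} {v x : V} (hole : Hole L) (triangle-free : TriangleFree L)
    (v∈ : v ∈ L) (x∉ : x ∉ L) (x~v : x ~ v) (only-v : ∀ {l} → l ∈ L → l ~ x → l ≡ v) where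

    -- In the case `narrow`, the component of x among the local vertices, enlarged by u, is
    -- connected and sees exactly v through x, w through `u₁` and y through u. Hence only K₃,₃ or an
    -- apex in D remains.
    reach-apex : ∀ {D w u₁ c} → w ∈ L → v ≢ w → Walk (Local L v w) x u₁ → w ~ u₁ →
      (∀ {q} → D q → q ≢ v × q ≢ w) → Walk D x c → c ∈ L → K₃₃ ⊎ ∃ λ t → D t × v ~ w × v ~ t × w ~ t × t ∉ L
    reach-apex {D} {w} {u₁} {c} w∈ v≢w walk₁ w~u₁ avoid walk c∈ =
      conclude (escape {D = λ q → D q × Local L v w q} hole v∈ w∈ v≢w u∉L y∈L y≢v y≢w y~u proj₂ (~-sym z~u)
        (walk-sym exit-walk) (~-sym x~v))
      where
      local-x : Local L v w x
      local-x = x∉ , λ l∈ e → inj₁ (only-v l∈ e)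
      open Exit (exit local-x walk c∈ avoid) renaming (walk to exit-walk)
      -- C is not confined to D: the walk to `u₁` may use vertices that D excludes, such as the
      -- first apex when a second one is sought.
      C : V → Set
      C q = Walk (Local L v w) x q ⊎ q ≡ u
      toX : ∀ {q} → C q → Walk C x q
      toX (inj₁ k)    = walk-map inj₁ (component-walk k)
      toX (inj₂ refl) = walk-snoc (walk-map inj₁ (component-walk (walk-map proj₂ exit-walk))) z~u (inj₂ refl)
      conclude : Escape L v w (λ q → D q × Local L v w q) u y → _
      conclude (k33 k) = inj₁ k
      conclude (apex vw (d , k) vt wt) = inj₂ (_ , d , vw , vt , wt , proj₁ k)
      conclude (narrow nar) = ⊥-elim (nonadjacent (v ~? w) (v ~? y))
        where
        L#C : ∀ {q} → q ∈ L → C q → ⊥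
        L#C m (inj₁ k)    = proj₁ (walk-end k) m
        L#C m (inj₂ refl) = u∉L m
        conn : ∀ {p q} → C p → C q → Walk C p q
        conn p q = walk-++ (walk-sym (toX p)) (toX q)
        cross : ∀ {l q} → l ∈ L → C q → l ~ q → l ≡ v ⊎ l ≡ w ⊎ l ≡ y
        cross l∈ (inj₁ k)    e = Sum.map₂ inj₁ (proj₂ (walk-end k) l∈ e)
        cross l∈ (inj₂ refl) e = nar l∈ e
        cx : C x
        cx = inj₁ (stop local-x)
        nonadjacent : Dec (v ~ w) → Dec (v ~ y) → ⊥
        nonadjacent (no v≁w) _ = three-attachments-connected hole L#C conn v∈ y∈L w∈ (y≢v ∘ sym) v≢w y≢w v≁w
          (λ p q e → Sum.map₂ Sum.swap (cross p q e)) cx (inj₂ refl) (inj₁ walk₁) (~-sym x~v) y~u w~u₁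
        nonadjacent (yes vw) (no v≁y) = three-attachments-connected hole L#C conn v∈ w∈ y∈L v≢w (y≢v ∘ sym) (y≢w ∘ sym) v≁y
          cross cx (inj₁ walk₁) (inj₂ refl) (~-sym x~v) w~u₁ y~u
        nonadjacent (yes vw) (yes vy) = three-attachments-connected hole L#C conn w∈ v∈ y∈L (v≢w ∘ sym) (y≢w ∘ sym) (y≢v ∘ sym)
          (triangle-free v∈ w∈ y∈L vw vy)
          (λ p q e → Sum.assocʳ (Sum.map₁ Sum.swap (Sum.assocˡ (cross p q e)))) (inj₁ walk₁) cx (inj₂ refl) w~u₁ (~-sym x~v) y~u

    -- Taking v in both places, `exit` gives the first vertex u that sees some y other than v. A
    -- neighbour l of u on L besides v and y would give a path from u with the attachments v, y and
    -- l, so u itself is local for v and y.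
    second-attachment : ∃ λ w → ∃ λ u → w ∈ L × v ≢ w × Walk (Local L v w) x u × w ~ u
    second-attachment with third-vertex hole v v
    ... | c , c∈ , c≢v , _ = y , u , y∈L , y≢v ∘ sym ,
        walk-snoc (walk-map (λ (_ , k) → proj₁ k , λ l∈ e → inj₁ (collapse (proj₂ k l∈ e))) walk) z~u local-u , y~u
      where
      collapse : ∀ {l : V} → l ≡ v ⊎ l ≡ v → l ≡ v
      collapse = Sum.[ (λ k → k) , (λ k → k) ]′
      local-x : Local L v v x
      local-x = x∉ , λ l∈ e → inj₁ (only-v l∈ e)
      open Exit (exit local-x (no-2-cutset v v (~⇒≢ x~v) (~⇒≢ x~v) c≢v c≢v) c∈ (λ d → d))
      open From (shorten {D = λ q → q ≡ u ⊎ Local L v v q} {End = v ~_} (v ~?_)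
        (move (inj₁ refl) (~-sym z~u) (walk-map (inj₂ ∘ proj₂) (walk-sym walk))) (~-sym x~v))
      local-u : Local L v y u
      local-u = u∉L , near
        where
        near : ∀ {l} → l ∈ L → l ~ u → l ≡ v ⊎ l ≡ y
        near {l} l∈ e with l ≟ v | l ≟ y
        ... | yes p | _     = inj₁ p
        ... | _     | yes p = inj₂ p
        ... | no p  | no q  = ⊥-elim (three-attachments hole path apart v∈ y∈L l∈ (y≢v ∘ sym) (p ∘ sym) (q ∘ sym)
              cross (meets (last-∈ sink-last) end) (here y~u) (here e))
          where
          apart : Apart L (u ∷ rest)
          apart m q′ with inside q′
          ... | inj₁ refl = u∉L m
          ... | inj₂ k    = proj₁ k m
          cross : ∀ {l′ q′} → l′ ∈ L → q′ ∈ u ∷ rest → l′ ~ q′ → l′ ≡ v ⊎ l′ ≡ y ⊎ l′ ≡ l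
          cross l′∈ q′∈ e′ with inside q′∈
          ... | inj₁ refl = inj₂ (two-neighbours hole u∉L y∈L l∈ (q ∘ sym) (~-sym y~u) (~-sym e) l′∈ (~-sym e′))
          ... | inj₂ k    = inj₁ (collapse (proj₂ k l′∈ e′))

    -- The first attempt ends in K₃,₃ or in a triangle v, w, t. This triangle separates neither x
    -- from c nor any other vertices, so the attempt is repeated along a walk that avoids t; a
    -- second apex would put the edge from v to w into two triangles.
    pendant⇒K₃₃ : (∀ {a b c p q} → a ~ b → a ~ c → b ~ c → p ≢ a → p ≢ b → p ≢ c → q ≢ a → q ≢ b → q ≢ c →
        Walk (λ z → z ≢ a × z ≢ b × z ≢ c) p q) → K₃₃
    pendant⇒K₃₃ no-triangle-cutset with second-attachment
    ... | w , u₁ , w∈ , v≢w , walk₁ , w~u₁ with third-vertex hole v w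
    ... | c , c∈ , c≢v , c≢w
      with reach-apex w∈ v≢w walk₁ w~u₁ (λ d → d) (no-2-cutset v w (~⇒≢ x~v) x≢w c≢v c≢w) c∈
      where
      x≢w : x ≢ w
      x≢w refl = x∉ w∈
    ... | inj₁ k = k
    ... | inj₂ (t , _ , vw , vt , wt , t∉)
      with reach-apex w∈ v≢w walk₁ w~u₁ (λ (p , q , _) → p , q)
             (no-triangle-cutset vw vt wt (~⇒≢ x~v) (λ { refl → x∉ w∈ }) (λ { refl → v≢w (sym (only-v w∈ wt)) })
               c≢v c≢w (λ { refl → t∉ c∈ })) c∈
    ... | inj₁ k = k
    ... | inj₂ (t′ , (_ , _ , t′≢t) , _ , vt′ , wt′ , _) = ⊥-elim (no-diamond vw (t′≢t ∘ sym) vt wt vt′ wt′)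

-- A claw yields a K₃,₃.

module Claws {n : ℕ} (R : Graph n)
  (isk4-free : ¬ HasInducedSubdivK4 R) (wheel-free : ¬ HasInducedWheel R)
  (no-2-cutset : ∀ a b {u v} → u ≢ a → u ≢ b → v ≢ a → v ≢ b → Walks.Walk R (λ x → x ≢ a × x ≢ b) u v) where
  open ThreeConnected R isk4-free wheel-free no-2-cutset public

  path-triangle-free : ∀ {P} → Path P → TriangleFree P
  path-triangle-free {x ∷ P} path {a} {b} {c} a∈ b∈ c∈ ab ac bc with a∈ | b∈ | c∈
  ... | here refl | here refl | _         = ~-irr ab
  ... | here refl | _         | here refl = ~-irr ac
  ... | _         | here refl | here refl = ~-irr bc
  ... | here refl | there p   | there q   = ~⇒≢ bc (first-unique P (next p ab) (next q ac))
    where next = λ {v} (m : v ∈ P) e → proj₂ (path-cross [ x ] path (here refl) m e)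
  ... | there p   | here refl | there q   = ~⇒≢ ac (first-unique P (next p (~-sym ab)) (next q bc))
    where next = λ {v} (m : v ∈ P) e → proj₂ (path-cross [ x ] path (here refl) m e)
  ... | there p   | there q   | here refl = ~⇒≢ ab (first-unique P (next p (~-sym ac)) (next q (~-sym bc)))
    where next = λ {v} (m : v ∈ P) e → proj₂ (path-cross [ x ] path (here refl) m e)
  ... | there p   | there q   | there r   = path-triangle-free (path-++ʳ [ x ] path) p q r ab ac bc

  record Claw : Set where
    field
      {v a b c}      : V
      va             : v ~ a
      vb             : v ~ b
      vc             : v ~ c
      a≢b            : a ≢ b
      a≢c            : a ≢ c
      b≢c            : b ≢ c
      a≁b            : ¬ a ~ b
      a≁c            : ¬ a ~ c
      b≁c            : ¬ b ~ c

  -- A shortest path off v between two components of the neighbourhood of v closes up to a hole through v.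
  claw⇒K₃₃ : (∀ {a b c p q} → a ~ b → a ~ c → b ~ c → p ≢ a → p ≢ b → p ≢ c → q ≢ a → q ≢ b → q ≢ c →
        Walk (λ z → z ≢ a × z ≢ b × z ≢ c) p q) → Claw → K₃₃
  claw⇒K₃₃ no-triangle-cutset claw = leaf
    where
    open Claw claw
    -- By `no-diamond` the neighbourhood of v is a disjoint union of cliques. `Start` is the one
    -- that contains a, and `End` is the union of the others.
    Start : V → Set
    Start z = z ≡ a ⊎ (z ~ a × z ~ v)
    Start? : ∀ z → Dec (Start z)
    Start? z = (z ≟ a) ⊎-dec ((z ~? a) ×-dec (z ~? v))
    End : V → Set
    End z = v ~ z × ¬ Start z
    End? : ∀ z → Dec (End z)
    End? z = (v ~? z) ×-dec ¬? (Start? z)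
    v≢ : ∀ {z} → v ~ z → z ≢ v
    v≢ e = ~⇒≢ e ∘ sym
    P : Between (λ z → z ≢ v × z ≢ v) Start End
    -- The separator here is the single vertex v, entered twice.
    P = between End? Start? (no-2-cutset v v (v≢ va) (v≢ va) (v≢ vb) (v≢ vb)) (inj₁ refl)
      (vb , λ { (inj₁ e) → a≢b (sym e) ; (inj₂ (e , _)) → a≁b (~-sym e) })
    open Between P
    L : List V
    L = v ∷ vertices
    start-v : ∀ {z} → Start z → v ~ z
    start-v (inj₁ refl)    = va
    start-v (inj₂ (_ , e)) = ~-sym e
    neighbour : ∀ {z} → z ∈ vertices → v ~ z → z ≡ source ⊎ z ≡ sink
    neighbour {z} m e with Start? z
    ... | yes s = inj₁ (only-source m s)
    ... | no ¬s = inj₂ (only-sink m (e , ¬s))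
    source≢sink : source ≢ sink
    source≢sink e = proj₂ end (subst Start e start)
    source≁sink : ¬ source ~ sink
    source≁sink e with start
    ... | inj₁ s≡a       = proj₂ end (inj₂ (~-sym (subst (_~ sink) s≡a e) , ~-sym (proj₁ end)))
    ... | inj₂ (sa , sv) = no-diamond (~-sym sv) (λ { k → proj₂ end (inj₁ (sym k)) }) va sa (proj₁ end) e
    hole : Hole L
    hole = hole-glue path-[ v ] path (λ { (here refl) m → proj₁ (inside m) refl }) (here refl) (first-∈ source-first)
      (three-members (here refl) (there (first-∈ source-first)) (there (last-∈ sink-last))
        (~⇒≢ (start-v start)) (~⇒≢ (proj₁ end)) source≢sink)
      (λ { refl q → subst (v ~_) (first-unique vertices source-first q) (start-v start) })
      (λ { refl q → subst (v ~_) (last-unique vertices sink-last q) (proj₁ end) })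
      cross
      where
      cross : ∀ {u z} → u ∈ [ v ] → z ∈ vertices → u ~ z → (Last [ v ] u × First vertices z) ⊎ (First [ v ] u × Last vertices z)
      cross (here refl) m e with neighbour m e
      ... | inj₁ refl = inj₁ (refl , source-first)
      ... | inj₂ refl = inj₂ (refl , sink-last)
    two-ends : ∀ {x y} → x ≡ source ⊎ x ≡ sink → y ≡ source ⊎ y ≡ sink → ¬ x ~ y
    two-ends (inj₁ refl) (inj₁ refl) = ~-irr
    two-ends (inj₁ refl) (inj₂ refl) = source≁sink
    two-ends (inj₂ refl) (inj₁ refl) = source≁sink ∘ ~-sym
    two-ends (inj₂ refl) (inj₂ refl) = ~-irr
    triangle-free : TriangleFree L
    triangle-free (there k)   (there l)   (there m)   pq pr qr = path-triangle-free path k l m pq pr qr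
    triangle-free (here refl) (here refl) _           pq pr qr = ~-irr pq
    triangle-free (here refl) (there _)   (here refl) pq pr qr = ~-irr pr
    triangle-free (there _)   (here refl) (here refl) pq pr qr = ~-irr qr
    triangle-free (here refl) (there k)   (there l)   pq pr qr = two-ends (neighbour k pq) (neighbour l pr) qr
    triangle-free (there k)   (here refl) (there l)   pq pr qr = two-ends (neighbour k (~-sym pq)) (neighbour l qr) pr
    triangle-free (there k)   (there l)   (here refl) pq pr qr = two-ends (neighbour k (~-sym pr)) (neighbour l (~-sym qr)) pq
    Near : V → V → Set
    Near x r = x ≡ r ⊎ x ~ r
    near? : ∀ x r → Dec (Near x r)
    near? x r = (x ≟ r) ⊎-dec (x ~? r)
    -- On the hole v sees only `source` and `sink`, so such an x is off the hole. Either it sees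
    -- another vertex of the hole, necessarily nonadjacent to v, or it sees v alone.
    use : ∀ {x} → v ~ x → ¬ Near x source → ¬ Near x sink → K₃₃
    use {x} vx ¬s ¬t with Any.any? (x ~?_) vertices
    ... | yes m with find m
    ...   | w , w∈ , xw = opposite-neighbours⇒K₃₃ hole x∉ (here refl) (there w∈) (λ { refl → proj₁ (inside w∈) refl })
              (λ e → Sum.[ (λ { refl → ¬s (inj₂ xw) }) , (λ { refl → ¬t (inj₂ xw) }) ]′ (neighbour w∈ e)) (~-sym vx) xw
      where
      x∉ : x ∉ L
      x∉ (here refl) = ~-irr vx
      x∉ (there k)   = Sum.[ ¬s ∘ inj₁ , ¬t ∘ inj₁ ]′ (neighbour k vx)
    use {x} vx ¬s ¬t | no ¬m = Pendant.pendant⇒K₃₃ hole triangle-free (here refl) x∉ (~-sym vx)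
      (λ { (here e) _ → e ; (there k) e → ⊥-elim (¬m (lose k (~-sym e))) }) no-triangle-cutset
      where
      x∉ : x ∉ L
      x∉ (here refl) = ~-irr vx
      x∉ (there k)   = Sum.[ ¬s ∘ inj₁ , ¬t ∘ inj₁ ]′ (neighbour k vx)
    clash : ∀ {x y r} → v ~ r → v ~ x → v ~ y → x ≢ y → ¬ x ~ y → Near x r → Near y r → ⊥
    clash vr vx vy x≢y x≁y (inj₁ refl) (inj₁ e)    = x≢y (sym e)
    clash vr vx vy x≢y x≁y (inj₁ refl) (inj₂ e)    = x≁y (~-sym e)
    clash vr vx vy x≢y x≁y (inj₂ e)    (inj₁ refl) = x≁y e
    clash vr vx vy x≢y x≁y (inj₂ e)    (inj₂ e′)   = no-diamond vr x≢y vx (~-sym e) vy (~-sym e′)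
    s-clash : ∀ {x y} → v ~ x → v ~ y → x ≢ y → ¬ x ~ y → Near x source → Near y source → ⊥
    s-clash = clash (start-v start)
    t-clash : ∀ {x y} → v ~ x → v ~ y → x ≢ y → ¬ x ~ y → Near x sink → Near y sink → ⊥
    t-clash = clash (proj₁ end)
    leaf : K₃₃
    -- Each of `source` and `sink` is equal or adjacent to at most one leaf, so one of the three
    -- leaves is near neither.
    leaf with near? a source | near? a sink | near? b source | near? b sink | near? c source | near? c sink
    ... | no p | no q | _ | _ | _ | _ = use va p q
    ... | _ | _ | no p | no q | _ | _ = use vb p q
    ... | _ | _ | _ | _ | no p | no q = use vc p q
    ... | yes p | _ | yes q | _ | _ | _ = ⊥-elim (s-clash va vb a≢b a≁b p q)
    ... | yes p | _ | _ | _ | yes q | _ = ⊥-elim (s-clash va vc a≢c a≁c p q)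
    ... | _ | _ | yes p | _ | yes q | _ = ⊥-elim (s-clash vb vc b≢c b≁c p q)
    ... | _ | yes p | _ | yes q | _ | _ = ⊥-elim (t-clash va vb a≢b a≁b p q)
    ... | _ | yes p | _ | _ | _ | yes q = ⊥-elim (t-clash va vc a≢c a≁c p q)
    ... | _ | _ | _ | yes p | _ | yes q = ⊥-elim (t-clash vb vc b≢c b≁c p q)

  -- A K₃,₃ extends to a complete bipartite graph that spans everything.

  flip : K₃₃ → K₃₃
  flip K = record
    { a = b ; b = a ; a-distinct = b-distinct ; b-distinct = a-distinct ; a-stable = b-stable ; b-stable = a-stable
    ; complete = λ i j → ~-sym (complete j i) }
    where open K₃₃ K

  avoid-two : ∀ (g : Fin 3 → V) → (∀ {i j} → i ≢ j → g i ≢ g j) → ∀ p q → ∃ λ i → g i ≢ p × g i ≢ q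
  avoid-two g distinct p q with Fin.any? (λ i → ¬? (g i ≟ p) ×-dec ¬? (g i ≟ q))
  ... | yes r = r
  ... | no ¬r with g zero ≟ p | g zero ≟ q | g (suc zero) ≟ p | g (suc zero) ≟ q
  ... | no x | no y | _ | _ = ⊥-elim (¬r (_ , x , y))
  ... | _ | _ | no x | no y = ⊥-elim (¬r (_ , x , y))
  ... | yes refl | _ | yes e | _ = ⊥-elim (distinct {zero} {suc zero} (λ ()) (sym e))
  ... | _ | yes refl | _ | yes e = ⊥-elim (distinct {zero} {suc zero} (λ ()) (sym e))
  ... | yes refl | _ | _ | yes refl = suc (suc zero) , distinct (λ ()) , distinct (λ ())
  ... | _ | yes refl | yes refl | _ = suc (suc zero) , distinct (λ ()) , distinct (λ ())

  path-walk : ∀ {P} → Path P → ∀ {p q} → p ∈ P → q ∈ P → Walk (_∈ P) p q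
  path-walk {x ∷ P} path p∈ q∈ = walk-++ (walk-sym (from x P path p∈)) (from x P path q∈)
    where
    from : ∀ x P → Path (x ∷ P) → ∀ {p} → p ∈ x ∷ P → Walk (_∈ x ∷ P) x p
    from x P path (here refl) = stop (here refl)
    from x (y ∷ P) path (there m) = move (here refl) (Path.edge path (inj₁ (refl , refl)))
      (walk-map there (from y P (path-++ʳ [ x ] path) m))

  -- The maximal extension of the side `a`; `InA (flip K)` is that of the side `b`.
  InA : K₃₃ → V → Set
  InA K x = ∀ i → x ~ K₃₃.b K i

  inA? : ∀ K x → Dec (InA K x)
  inA? K x = Fin.all? (λ i → x ~? K₃₃.b K i)

  Outside : K₃₃ → V → Set
  Outside K x = ¬ InA K x × ¬ InA (flip K) x

  module Side (K : K₃₃) where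
    open K₃₃ K

    a∈A : ∀ i → InA K (a i)
    a∈A i j = complete i j

    b∈B : ∀ i → InA (flip K) (b i)
    b∈B i j = ~-sym (complete j i)

    A-stable : ∀ {x y} → InA K x → InA K y → ¬ x ~ y
    A-stable p q e = no-diamond e (b-distinct {zero} {suc zero} (λ ())) (p zero) (q zero) (p (suc zero)) (q (suc zero))

    A#B : ∀ {x} → InA K x → InA (flip K) x → ⊥
    A#B p q = no-diamond (p zero) (a-distinct {zero} {suc zero} (λ ())) (q zero) (~-sym (complete zero zero))
      (q (suc zero)) (~-sym (complete (suc zero) zero))

  module Spanning (K : K₃₃) where
    open K₃₃ K
    open Side K
    open Side (flip K) using () renaming (A-stable to B-stable)

    -- If x and y were nonadjacent, they and two vertices from each side of K would form K₃,₃ minus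
    -- an edge.
    A-complete-B : ∀ {x y} → InA K x → InA (flip K) y → x ~ y
    A-complete-B {x} {y} x∈ y∈ with x ~? y
    ... | yes e  = e
    ... | no x≁y = ⊥-elim (no-k33-minus-edge (a-distinct {zero} {suc zero} (λ ()))
      (λ { refl → x≁y (~-sym (y∈ zero)) }) (λ { refl → x≁y (~-sym (y∈ (suc zero))) })
      (b-distinct {zero} {suc zero} (λ ())) (λ { refl → x≁y (x∈ zero) }) (λ { refl → x≁y (x∈ (suc zero)) })
      (a-stable _ _) (A-stable (a∈A zero) x∈) (A-stable (a∈A (suc zero)) x∈)
      (b-stable _ _) (B-stable (b∈B zero) y∈) (B-stable (b∈B (suc zero)) y∈)
      (complete _ _) (complete _ _) (~-sym (y∈ zero)) (complete _ _) (complete _ _) (~-sym (y∈ (suc zero)))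
      (x∈ zero) (x∈ (suc zero)) x≁y)

    -- No `b j` is seen by x, because that edge would lie in triangles with u and with u′. Some
    -- `a i` is not seen either, and then x with two of the `b j` against u, u′ and `a i` is K₃,₃
    -- minus an edge.
    outside-one-neighbour : ∀ {x u u′} → Outside K x → InA K u → InA K u′ → u ≢ u′ → x ~ u → x ~ u′ → ⊥
    outside-one-neighbour {x} {u} {u′} (x∉A , x∉B) u∈ u′∈ u≢u′ xu xu′
      with Fin.¬∀⟶∃¬ 3 (λ i → x ~ a i) (λ i → x ~? a i) x∉B
    ... | i , x≁a = no-k33-minus-edge (b-distinct {zero} {suc zero} (λ ()))
        (λ { refl → x∉B (b∈B zero) }) (λ { refl → x∉B (b∈B (suc zero)) })
        u≢u′ (λ { refl → x≁a xu }) (λ { refl → x≁a xu′ })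
        (b-stable _ _) (x≁b zero ∘ ~-sym) (x≁b (suc zero) ∘ ~-sym)
        (A-stable u∈ u′∈) (A-stable u∈ (a∈A i)) (A-stable u′∈ (a∈A i))
        (~-sym (u∈ zero)) (~-sym (u′∈ zero)) (~-sym (complete i zero))
        (~-sym (u∈ (suc zero))) (~-sym (u′∈ (suc zero))) (~-sym (complete i (suc zero))) xu xu′ x≁a
      where
      x≁b : ∀ j → ¬ x ~ b j
      x≁b j e = no-diamond e u≢u′ xu (~-sym (u∈ j)) xu′ (~-sym (u′∈ j))

    OtherB : V → V → Set
    OtherB β q = ∃ λ β′ → (InA (flip K) β′ × β′ ≢ β) × β′ ~ q

    otherB? : ∀ β q → Dec (OtherB β q)
    otherB? β q = Fin.any? (λ β′ → (inA? (flip K) β′ ×-dec ¬? (β′ ≟ β)) ×-dec (β′ ~? q))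

  module _ (K : K₃₃) where
    open K₃₃ K
    open Side K
    open Spanning K
    open Side (flip K) using () renaming (A-stable to B-stable)

    -- Q closed up by β′, `a i` and β is a hole. Another `a j` that sees Q also sees β and β′, which
    -- gives a wheel. If `a j` misses Q, the edge from it to a third `b k` has exactly the
    -- attachments β′, `a i` and β.
    detached-side-clash : ∀ {D β} → (∀ {q} → D q → Outside K q) → InA (flip K) β →
      (Q : Between D (β ~_) (OtherB β)) → ∀ i → ¬ Meets (a i) (Between.vertices Q) → ⊥
    detached-side-clash {D} {β} outside β∈ Q i a≁Q with Between.end Q
    ... | β′ , (β′∈ , β′≢β) , β′~sink = conclude
      where
      open Between Q
      out : ∀ {q} → q ∈ vertices → Outside K q
      out = outside ∘ inside
      T : List V
      T = β′ ∷ a i ∷ β ∷ []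
      Q#T : Apart vertices T
      Q#T m (here refl)                 = proj₂ (out m) β′∈
      Q#T m (there (here refl))         = proj₁ (out m) (a∈A i)
      Q#T m (there (there (here refl))) = proj₂ (out m) β∈
      rim : Hole (vertices ++ T)
      rim = hole-glue path (path-cherry (β′∈ i) (~-sym (β∈ i)) β′≢β (B-stable β′∈ β∈)) Q#T (first-∈ source-first) (here refl)
        (three-members (∈-++⁺ʳ vertices (here refl)) (∈-++⁺ʳ vertices (there (here refl))) (∈-++⁺ʳ vertices (there (there (here refl))))
          (~⇒≢ (β′∈ i)) β′≢β (~⇒≢ (~-sym (β∈ i))))
        (λ { p refl → ~-sym (subst (β′ ~_) (last-unique vertices sink-last p) β′~sink) })
        (λ { p refl → ~-sym (subst (β ~_) (first-unique vertices source-first p) start) })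
        cross
        where
        cross : ∀ {q t} → q ∈ vertices → t ∈ T → q ~ t → (Last vertices q × First T t) ⊎ (First vertices q × Last T t)
        cross m (here refl) e with only-sink m (β′ , (β′∈ , β′≢β) , ~-sym e)
        ... | refl = inj₁ (sink-last , refl)
        cross m (there (here refl)) e = ⊥-elim (a≁Q (meets m (~-sym e)))
        cross m (there (there (here refl))) e with only-source m (~-sym e)
        ... | refl = inj₂ (source-first , refl)
      T⊂ : ∀ {t} → t ∈ T → t ∈ vertices ++ T
      T⊂ = ∈-++⁺ʳ vertices
      other : ∃ λ j → i ≢ j
      other = next i
        where
        next : ∀ (i : Fin 3) → ∃ λ j → i ≢ j
        next zero    = suc zero , λ ()
        next (suc _) = zero , λ ()
      j = proj₁ other
      i≢j = proj₂ other
      aj∉T : a j ∉ T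
      aj∉T (here e)                 = A#B (a∈A j) (subst (InA (flip K)) (sym e) β′∈)
      aj∉T (there (here e))         = a-distinct i≢j (sym e)
      aj∉T (there (there (here e))) = A#B (a∈A j) (subst (InA (flip K)) (sym e) β∈)
      conclude : ⊥
      conclude with meets? (a j) vertices
      ... | yes m with find m
      ...   | q , q∈ , e = no-wheel rim (λ k → Sum.[ (λ k′ → proj₁ (out k′) (a∈A j)) , aj∉T ]′ (∈-++⁻ vertices k))
              (∈-++⁺ˡ q∈) (T⊂ (here refl)) (T⊂ (there (there (here refl))))
              (λ { refl → Q#T q∈ (here refl) }) (λ { refl → Q#T q∈ (there (there (here refl))) }) β′≢β
              e (~-sym (β′∈ j)) (~-sym (β∈ j))
      conclude | no aj≁Q with avoid-two b b-distinct β β′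
      ... | k , bk≢β , bk≢β′ = three-attachments rim (path-edge (complete j k)) apart
          (T⊂ (here refl)) (T⊂ (there (here refl))) (T⊂ (there (there (here refl))))
          (~⇒≢ (β′∈ i)) β′≢β (~⇒≢ (~-sym (β∈ i))) cross
          (here (β′∈ j)) (there (here (complete i k))) (here (β∈ j))
        where
        bk≁Q : ∀ {q} → q ∈ vertices → ¬ b k ~ q
        bk≁Q m e with only-sink m (b k , (b∈B k , bk≢β) , e)
        ... | refl = Spanning.outside-one-neighbour (flip K) (proj₂ (out m) , proj₁ (out m)) (b∈B k) β′∈ bk≢β′ (~-sym e) (~-sym β′~sink)
        apart : Apart (vertices ++ T) (a j ∷ b k ∷ [])
        apart p (here refl) = Sum.[ (λ m → proj₁ (out m) (a∈A j)) , aj∉T ]′ (∈-++⁻ vertices p)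
        apart p (there (here refl)) with ∈-++⁻ vertices p
        ... | inj₁ m                         = proj₂ (out m) (b∈B k)
        ... | inj₂ (here e)                  = bk≢β′ e
        ... | inj₂ (there (here e))          = A#B (a∈A i) (subst (InA (flip K)) e (b∈B k))
        ... | inj₂ (there (there (here e))) = bk≢β e
        cross : ∀ {u w} → u ∈ vertices ++ T → w ∈ a j ∷ b k ∷ [] → u ~ w → u ≡ β′ ⊎ u ≡ a i ⊎ u ≡ β
        cross p w∈ e with ∈-++⁻ vertices p
        cross p (here refl)         e | inj₁ m = ⊥-elim (aj≁Q (meets m (~-sym e)))
        cross p (there (here refl)) e | inj₁ m = ⊥-elim (bk≁Q m (~-sym e))
        ... | inj₂ (here k)                  = inj₁ k
        ... | inj₂ (there (here k))          = inj₂ (inj₁ k)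
        ... | inj₂ (there (there (here k))) = inj₂ (inj₂ k)

  -- If every `a i` sees Q, the sides are exchanged: a path inside Q joins two vertices of the side
  -- of `a`. Only the sink of Q sees that side of `b` beyond β, and it sees one vertex there, so
  -- some `b k` misses Q and plays the detached vertex.
  two-B-attachments : ∀ K {D q q′ β β′} → (∀ {q} → D q → Outside K q) → Walk D q q′ →
    InA (flip K) β → InA (flip K) β′ → β′ ≢ β → β ~ q → β′ ~ q′ → ⊥
  two-B-attachments K {D} {q} {q′} {β} {β′} outside walk β∈ β′∈ β′≢β β~q β′~q′ = split (Fin.any? (λ i → ¬? (meets? (a i) vertices)))
    where
    open K₃₃ K
    open Side K
    Q : Between D (β ~_) (Spanning.OtherB K β)
    Q = between (Spanning.otherB? K β) (β ~?_) walk β~q (β′ , (β′∈ , β′≢β) , β′~q′)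
    open Between Q
    out : ∀ {q} → q ∈ vertices → Outside (flip K) q
    out m = proj₂ (outside (inside m)) , proj₁ (outside (inside m))
    attached : ¬ (∃ λ i → ¬ Meets (a i) vertices) → ∀ i → ∃ λ p → p ∈ vertices × a i ~ p
    attached ¬m i with meets? (a i) vertices
    ... | yes m = find m
    ... | no ¬k = ⊥-elim (¬m (i , ¬k))
    subpath : (∀ i → ∃ λ p → p ∈ vertices × a i ~ p) → Between (_∈ vertices) (a zero ~_) (Spanning.OtherB (flip K) (a zero))
    subpath at with at zero | at (suc zero)
    ... | p , p∈ , ap | p′ , p′∈ , ap′ = between (Spanning.otherB? (flip K) (a zero)) (a zero ~?_) (path-walk path p∈ p′∈) ap
          (a (suc zero) , (a∈A (suc zero) , a-distinct (λ ())) , ap′)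
    misses : ∀ {k} (P : Between (_∈ vertices) (a zero ~_) (Spanning.OtherB (flip K) (a zero))) →
             b k ≢ β → b k ≢ proj₁ end → ¬ Meets (b k) (Between.vertices P)
    misses {k} P bk≢β bk≢β″ m with find m
    ... | r , r∈ , e = Spanning.outside-one-neighbour (flip K) (out (Between.inside P r∈)) (b∈B k) (proj₁ (proj₁ (proj₂ end))) bk≢β″ (~-sym e)
          (~-sym (subst (proj₁ end ~_) (sym (only-sink (Between.inside P r∈) (b k , (b∈B k , bk≢β) , e))) (proj₂ (proj₂ end))))
    split : Dec (∃ λ i → ¬ Meets (a i) vertices) → ⊥
    split (yes (i , a≁)) = detached-side-clash K outside β∈ Q i a≁
    split (no ¬m) with avoid-two b b-distinct β (proj₁ end)
    ... | k , bk≢β , bk≢β″ = let P = subpath (attached ¬m) in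
          detached-side-clash (flip K) out (a∈A zero) P k (misses P bk≢β bk≢β″)

  -- No two vertices cut an outside x off from K, so its outside component has three distinct
  -- attachments, and two of them lie on the same side.
  spanning : ∀ K x → InA K x ⊎ InA (flip K) x
  spanning K x with inA? K x | inA? (flip K) x
  ... | yes p | _     = inj₁ p
  ... | _     | yes p = inj₂ p
  -- No attachment is known yet; `b zero` fills both places of the vertices to be avoided.
  ... | no x∉A | no x∉B = ⊥-elim (contradict (attach (b zero) (b zero) (inj₂ (b∈B zero)) (inj₂ (b∈B zero))))
    where
    open K₃₃ K
    open Side K
    InK : V → Set
    InK v = InA K v ⊎ InA (flip K) v
    Out : V → Set
    Out v = ¬ InK v
    outside : ∀ {v} → Out v → Outside K v
    outside o = o ∘ inj₁ , o ∘ inj₂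
    x∉K : Out x
    x∉K = Sum.[ x∉A , x∉B ]′
    Attach : V → V → Set
    Attach k k′ = ∃ λ z → ∃ λ c → Walk Out x z × z ~ c × InK c × c ≢ k × c ≢ k′
    attach : ∀ k k′ → InK k → InK k′ → Attach k k′
    attach k k′ k∈ k′∈ with avoid-two a a-distinct k k′
    ... | i , p , q with approach (λ v → inA? K v ⊎-dec inA? (flip K) v)
                           (no-2-cutset k k′ {x} {a i} (λ { refl → x∉K k∈ }) (λ { refl → x∉K k′∈ }) p q) x∉K (inj₁ (a∈A i))
    ...   | z , c , w , e , c∈ , (c≢k , c≢k′) = z , c , walk-map proj₂ w , e , c∈ , c≢k , c≢k′
    same : ∀ {z z′ c c′} → Walk Out x z → Walk Out x z′ → z ~ c → z′ ~ c′ → c′ ≢ c →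
      (InA K c × InA K c′) ⊎ (InA (flip K) c × InA (flip K) c′) → ⊥
    same w w′ e e′ ne (inj₂ (p , q)) = two-B-attachments K outside (walk-++ (walk-sym w) w′) p q ne (~-sym e) (~-sym e′)
    same w w′ e e′ ne (inj₁ (p , q)) = two-B-attachments (flip K) (λ o → o ∘ inj₂ , o ∘ inj₁) (walk-++ (walk-sym w) w′) p q ne (~-sym e) (~-sym e′)
    contradict : Attach (b zero) (b zero) → ⊥
    contradict (z₁ , c₁ , w₁ , e₁ , k₁ , _) with attach c₁ c₁ k₁ k₁
    ... | z₂ , c₂ , w₂ , e₂ , k₂ , n₂₁ , _ with attach c₁ c₂ k₁ k₂
    ...   | z₃ , c₃ , w₃ , e₃ , k₃ , n₃₁ , n₃₂ with k₁ | k₂ | k₃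
    ...     | inj₁ p | inj₁ q | _      = same w₁ w₂ e₁ e₂ n₂₁ (inj₁ (p , q))
    ...     | inj₂ p | inj₂ q | _      = same w₁ w₂ e₁ e₂ n₂₁ (inj₂ (p , q))
    ...     | inj₁ p | _      | inj₁ q = same w₁ w₃ e₁ e₃ n₃₁ (inj₁ (p , q))
    ...     | inj₂ p | _      | inj₂ q = same w₁ w₃ e₁ e₃ n₃₁ (inj₂ (p , q))
    ...     | _      | inj₁ p | inj₁ q = same w₂ w₃ e₂ e₃ n₃₂ (inj₁ (p , q))
    ...     | _      | inj₂ p | inj₂ q = same w₂ w₃ e₂ e₃ n₃₂ (inj₂ (p , q))

-- The root graph of a claw-free graph.

funToFin-cong : ∀ {m n} {f g : Fin m → Fin n} → (∀ i → f i ≡ g i) → funToFin f ≡ funToFin g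
funToFin-cong {ℕ.zero} e = refl
funToFin-cong {suc m}  e = cong₂ combine (e zero) (funToFin-cong (e ∘ suc))

bit : ∀ {A : Set} → Dec A → Fin 2
bit (yes _) = suc zero
bit (no _)  = zero

bit-cong : ∀ {A B : Set} (a : Dec A) (b : Dec B) → (A → B) → (B → A) → bit a ≡ bit b
bit-cong (yes _) (yes _) _ _ = refl
bit-cong (no _)  (no _)  _ _ = refl
bit-cong (yes p) (no ¬q) f _ = ⊥-elim (¬q (f p))
bit-cong (no ¬p) (yes q) _ g = ⊥-elim (¬p (g q))

bit-transfer : ∀ {A B : Set} (a : Dec A) (b : Dec B) → bit a ≡ bit b → A → B
bit-transfer (yes _) (yes q) _ _ = q
bit-transfer (no ¬p) _       _ p = ⊥-elim (¬p p)

sameEdge? : ∀ {h} (p q : Fin h × Fin h) → Dec (SameEdge p q)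
sameEdge? (a , b) (c , d) = ((a ≟ c) ×-dec (b ≟ d)) ⊎-dec ((a ≟ d) ×-dec (b ≟ c))

-- The vertices of the root graph are the maximal cliques of R, coded as subsets of Fin n.
module RootGraph {n : ℕ} (R : Graph n)
  (no-diamond : ∀ {a b c d} → adj R a b ≡ true → c ≢ d →
    adj R a c ≡ true → adj R b c ≡ true → adj R a d ≡ true → adj R b d ≡ true → ⊥)
  (claw-free : ∀ {v a b c} → adj R v a ≡ true → adj R v b ≡ true → adj R v c ≡ true →
    a ≢ b → a ≢ c → b ≢ c → adj R a b ≢ true → adj R a c ≢ true → adj R b c ≢ true → ⊥)
  (split : ∀ v → ∃ λ a → ∃ λ b → adj R v a ≡ true × adj R v b ≡ true × b ≢ a × adj R a b ≢ true) where
  open Certificates R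

  -- By `no-diamond` adjacent u and v have at most one common neighbour, so for an edge this is the
  -- only maximal clique that contains it.
  Clique : V → V → V → Set
  Clique u v i = i ≡ u ⊎ i ≡ v ⊎ (i ~ u × i ~ v)

  clique? : ∀ u v i → Dec (Clique u v i)
  clique? u v i = (i ≟ u) ⊎-dec ((i ≟ v) ⊎-dec ((i ~? u) ×-dec (i ~? v)))

  -- Several pairs generate the same clique. Its characteristic function, numbered by `funToFin`,
  -- gives it one name in a `Fin`, the vertex type of a `Graph`.
  code : V → V → Fin (2 ^ n)
  code u v = funToFin (λ i → bit (clique? u v i))

  code-cong : ∀ {u v u′ v′} → (∀ {i} → Clique u v i → Clique u′ v′ i) → (∀ {i} → Clique u′ v′ i → Clique u v i) → code u v ≡ code u′ v′
  code-cong {u} {v} {u′} {v′} f g = funToFin-cong (λ i → bit-cong (clique? u v i) (clique? u′ v′ i) f g)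

  code-transfer : ∀ {u v u′ v′} → code u v ≡ code u′ v′ → ∀ {i} → Clique u v i → Clique u′ v′ i
  code-transfer {u} {v} {u′} {v′} e {i} = bit-transfer (clique? u v i) (clique? u′ v′ i)
    (trans (sym (finToFun-funToFin (λ j → bit (clique? u v j)) i))
      (trans (cong (λ c → finToFun c i) e) (finToFun-funToFin (λ j → bit (clique? u′ v′ j)) i)))

  clique-adjacent : ∀ {u v i j} → u ~ v → Clique u v i → Clique u v j → i ≢ j → i ~ j
  clique-adjacent uv (inj₁ refl)             (inj₁ refl)             i≢j = ⊥-elim (i≢j refl)
  clique-adjacent uv (inj₁ refl)             (inj₂ (inj₁ refl))      i≢j = uv
  clique-adjacent uv (inj₁ refl)             (inj₂ (inj₂ (ju , jv))) i≢j = ~-sym ju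
  clique-adjacent uv (inj₂ (inj₁ refl))      (inj₁ refl)             i≢j = ~-sym uv
  clique-adjacent uv (inj₂ (inj₁ refl))      (inj₂ (inj₁ refl))      i≢j = ⊥-elim (i≢j refl)
  clique-adjacent uv (inj₂ (inj₁ refl))      (inj₂ (inj₂ (ju , jv))) i≢j = ~-sym jv
  clique-adjacent uv (inj₂ (inj₂ (iu , iv))) (inj₁ refl)             i≢j = iu
  clique-adjacent uv (inj₂ (inj₂ (iu , iv))) (inj₂ (inj₁ refl))      i≢j = iv
  clique-adjacent uv (inj₂ (inj₂ (iu , iv))) (inj₂ (inj₂ (ju , jv))) i≢j =
    ⊥-elim (no-diamond uv i≢j (~-sym iu) (~-sym iv) (~-sym ju) (~-sym jv))

  clique-⊆ : ∀ {u v p q} → u ~ v → Clique u v p → Clique u v q → ∀ {i} → Clique u v i → Clique p q i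
  clique-⊆ {p = p} {q} uv p∈ q∈ {i} i∈ with i ≟ p | i ≟ q
  ... | yes e | _     = inj₁ e
  ... | _     | yes e = inj₂ (inj₁ e)
  ... | no x  | no y  = inj₂ (inj₂ (clique-adjacent uv i∈ p∈ x , clique-adjacent uv i∈ q∈ y))

  code-of-pair : ∀ {u v p q} → u ~ v → Clique u v p → Clique u v q → p ≢ q → code p q ≡ code u v
  code-of-pair uv p∈ q∈ p≢q = code-cong
    (clique-⊆ (clique-adjacent uv p∈ q∈ p≢q) (clique-⊆ uv p∈ q∈ (inj₁ refl)) (clique-⊆ uv p∈ q∈ (inj₂ (inj₁ refl))))
    (clique-⊆ uv p∈ q∈)

  left right : V → V
  left v  = proj₁ (split v)
  right v = proj₁ (proj₂ (split v))

  v~left : ∀ v → v ~ left v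
  v~left v = proj₁ (proj₂ (proj₂ (split v)))

  v~right : ∀ v → v ~ right v
  v~right v = proj₁ (proj₂ (proj₂ (proj₂ (split v))))

  end₁ end₂ : V → Fin (2 ^ n)
  end₁ v = code v (left v)
  end₂ v = code v (right v)

  ends : V → Fin (2 ^ n) × Fin (2 ^ n)
  ends v = end₁ v , end₂ v

  ends-distinct : ∀ v → end₁ v ≢ end₂ v
  ends-distinct v e with split v | code-transfer {v} {right v} {v} {left v} (sym e) (inj₂ (inj₁ refl))
  ... | a , b , va , vb , b≢a , a≁b | inj₁ refl           = ~-irr vb
  ... | a , b , va , vb , b≢a , a≁b | inj₂ (inj₁ k)       = b≢a k
  ... | a , b , va , vb , b≢a , a≁b | inj₂ (inj₂ (_ , k)) = a≁b (~-sym k)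

  -- A neighbour j outside both cliques would form a claw at v with `left v` and `right v`.
  neighbour-end : ∀ {v j} → v ~ j → code v j ≡ end₁ v ⊎ code v j ≡ end₂ v
  neighbour-end {v} {j} vj = Sum.map
    (λ k → code-of-pair (v~left v) (inj₁ refl) k (~⇒≢ vj)) (λ k → code-of-pair (v~right v) (inj₁ refl) k (~⇒≢ vj)) side
    where
    side : Clique v (left v) j ⊎ Clique v (right v) j
    side with split v
    ... | a , b , va , vb , b≢a , a≁b with j ≟ a | j ≟ b | j ~? a | j ~? b
    ... | yes e | _ | _ | _ = inj₁ (inj₂ (inj₁ e))
    ... | _ | yes e | _ | _ = inj₂ (inj₂ (inj₁ e))
    ... | _ | _ | yes e | _ = inj₁ (inj₂ (inj₂ (~-sym vj , e)))
    ... | _ | _ | _ | yes e = inj₂ (inj₂ (inj₂ (~-sym vj , e)))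
    ... | no p | no q | no r | no s =
      ⊥-elim (claw-free va vb vj (b≢a ∘ sym) (p ∘ sym) (q ∘ sym) a≁b (r ∘ ~-sym) (s ∘ ~-sym))

  code-sym : ∀ {u v} → code u v ≡ code v u
  code-sym = code-cong turn turn
    where
    turn : ∀ {u v i} → Clique u v i → Clique v u i
    turn (inj₁ e)              = inj₂ (inj₁ e)
    turn (inj₂ (inj₁ e))       = inj₁ e
    turn (inj₂ (inj₂ (p , q))) = inj₂ (inj₂ (q , p))

  common : ∀ {i j a b} → code i a ≡ code j b → Clique i a j
  common e = code-transfer (sym e) (inj₁ refl)

  share : ∀ {i j a b} → i ≢ j → i ~ a → code i a ≡ code j b → i ~ j
  share i≢j ia e = clique-adjacent ia (inj₁ refl) (common e) i≢j

  isEdge? : ∀ p q → Dec (∃ λ v → SameEdge (ends v) (p , q))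
  isEdge? p q = Fin.any? (λ v → sameEdge? (ends v) (p , q))

  -- Numbers that are not an end of any vertex become isolated, which leaves the line graph
  -- unchanged.
  root : Graph (2 ^ n)
  root = record { adj = λ p q → does (isEdge? p q) ; adj-sym = symm ; adj-irr = irr }
    where
    symm : ∀ p q → does (isEdge? p q) ≡ does (isEdge? q p)
    symm p q with isEdge? p q | isEdge? q p
    ... | yes _       | yes _ = refl
    ... | no _        | no _  = refl
    ... | yes (v , e) | no ¬e = ⊥-elim (¬e (v , Sum.swap e))
    ... | no ¬e       | yes (v , e) = ⊥-elim (¬e (v , Sum.swap e))
    irr : ∀ p → does (isEdge? p p) ≡ false
    irr p with isEdge? p p
    ... | no _ = refl
    ... | yes (v , inj₁ (a , b)) = ⊥-elim (ends-distinct v (trans a (sym b)))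
    ... | yes (v , inj₂ (a , b)) = ⊥-elim (ends-distinct v (trans a (sym b)))

  root-edge : ∀ i → adj root (end₁ i) (end₂ i) ≡ true
  root-edge i = dec-true (isEdge? (end₁ i) (end₂ i)) (i , inj₁ (refl , refl))

  root-surjective : ∀ p q → adj root p q ≡ true → ∃ λ i → SameEdge (ends i) (p , q)
  root-surjective p q e with isEdge? p q
  ... | yes r = r

  -- Distinct i and j with the same ends would both lie in both cliques; two members determine a
  -- clique, so the two ends of i would coincide.
  ends-injective : ∀ i j → SameEdge (ends i) (ends j) → i ≡ j
  ends-injective i j e with i ≟ j
  ... | yes k  = k
  ... | no i≢j = ⊥-elim (both e)
    where
    clash : Clique i (left i) j → Clique i (right i) j → ⊥
    clash p q = ends-distinct i (trans (sym (code-of-pair (v~left i) (inj₁ refl) p i≢j)) (code-of-pair (v~right i) (inj₁ refl) q i≢j))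
    both : SameEdge (ends i) (ends j) → ⊥
    both (inj₁ (p , q)) = clash (common p) (common q)
    both (inj₂ (p , q)) = clash (common p) (common q)

  ends-adjacent : ∀ i j → i ≢ j → (i ~ j) ⇔ ShareEnd (ends i) (ends j)
  ends-adjacent i j i≢j = mk⇔ to from
    where
    to : i ~ j → ShareEnd (ends i) (ends j)
    to ij with neighbour-end ij | neighbour-end (~-sym ij)
    ... | inj₁ p | inj₁ q = inj₁ (trans (sym p) (trans code-sym q))
    ... | inj₁ p | inj₂ q = inj₂ (inj₁ (trans (sym p) (trans code-sym q)))
    ... | inj₂ p | inj₁ q = inj₂ (inj₂ (inj₁ (trans (sym p) (trans code-sym q))))
    ... | inj₂ p | inj₂ q = inj₂ (inj₂ (inj₂ (trans (sym p) (trans code-sym q))))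
    from : ShareEnd (ends i) (ends j) → i ~ j
    from (inj₁ e)               = share i≢j (v~left i) e
    from (inj₂ (inj₁ e))        = share i≢j (v~left i) e
    from (inj₂ (inj₂ (inj₁ e))) = share i≢j (v~right i) e
    from (inj₂ (inj₂ (inj₂ e))) = share i≢j (v~right i) e

-- Deleting a pair, and counting vertices.

_≟ᶿ_ : ∀ (x y : Adjacency) → Dec (x ≡ y)
strongAdj  ≟ᶿ strongAdj  = yes refl
strongAdj  ≟ᶿ semiAdj    = no λ ()
strongAdj  ≟ᶿ strongAnti = no λ ()
semiAdj    ≟ᶿ strongAdj  = no λ ()
semiAdj    ≟ᶿ semiAdj    = yes refl
semiAdj    ≟ᶿ strongAnti = no λ ()
strongAnti ≟ᶿ strongAdj  = no λ ()
strongAnti ≟ᶿ semiAdj    = no λ ()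
strongAnti ≟ᶿ strongAnti = yes refl

SamePair : ∀ {n} → Fin n → Fin n → Fin n → Fin n → Set
SamePair a b u v = (u ≡ a × v ≡ b) ⊎ (u ≡ b × v ≡ a)

samePair? : ∀ {n} (a b u v : Fin n) → Dec (SamePair a b u v)
samePair? a b u v = ((u ≟ a) ×-dec (v ≟ b)) ⊎-dec ((u ≟ b) ×-dec (v ≟ a))

pair-sym : ∀ {n} {a b u v : Fin n} → SamePair a b u v → SamePair a b v u
pair-sym (inj₁ (p , q)) = inj₂ (q , p)
pair-sym (inj₂ (p , q)) = inj₁ (q , p)

-- Applied to the full realization and a semi-adjacent pair, this is another realization of the same
-- trigraph.
deleteEdge : ∀ {n} → Graph n → Fin n → Fin n → Graph n
deleteEdge F a b = record { adj = del ; adj-sym = del-sym ; adj-irr = del-irr }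
  where
  del : _ → _ → Bool
  del u v with samePair? a b u v
  ... | yes _ = false
  ... | no _  = adj F u v
  del-sym : ∀ u v → del u v ≡ del v u
  del-sym u v with samePair? a b u v | samePair? a b v u
  ... | yes _ | yes _ = refl
  ... | no _  | no _  = adj-sym F u v
  ... | yes p | no ¬p = ⊥-elim (¬p (pair-sym p))
  ... | no ¬p | yes p = ⊥-elim (¬p (pair-sym p))
  del-irr : ∀ v → del v v ≡ false
  del-irr v with samePair? a b v v
  ... | yes _ = refl
  ... | no _  = adj-irr F v

module _ {n} (F : Graph n) (a b : Fin n) where

  del-⊆ : ∀ {u v} → adj (deleteEdge F a b) u v ≡ true → adj F u v ≡ true
  del-⊆ {u} {v} e with samePair? a b u v
  ... | no _ = e

  del-keeps : ∀ {u v} → ¬ SamePair a b u v → adj F u v ≡ true → adj (deleteEdge F a b) u v ≡ true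
  del-keeps {u} {v} ¬p e with samePair? a b u v
  ... | yes p = ⊥-elim (¬p p)
  ... | no _  = e

  del-edge : adj (deleteEdge F a b) a b ≢ true
  del-edge e with samePair? a b a b
  ... | no ¬p = ¬p (inj₁ (refl , refl))

  del-false : ∀ {u v} → adj F u v ≡ false → adj (deleteEdge F a b) u v ≡ false
  del-false {u} {v} e with samePair? a b u v
  ... | yes _ = refl
  ... | no _  = e

unique-length : ∀ {n} {S : List (Fin n)} → Unique S → length S ≤ n
unique-length u = injective⇒≤ (lookup-injective u)

fresh : ∀ {n} → 4 ≤ n → ∀ (a b c : Fin n) → ∃ λ d → d ≢ a × d ≢ b × d ≢ c
fresh {n} 4≤n a b c with Fin.any? (λ d → ¬? (d ≟ a) ×-dec (¬? (d ≟ b) ×-dec ¬? (d ≟ c)))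
... | yes r = r
... | no ¬r = ⊥-elim (ℕ.<⇒≱ 4≤n (injective⇒≤ {f = label} label-inj))
  where
  label : Fin n → Fin 3
  label d with d ≟ a | d ≟ b
  ... | yes _ | _     = zero
  ... | no _  | yes _ = suc zero
  ... | no _  | no _  = suc (suc zero)
  label-inj : ∀ {d e} → label d ≡ label e → d ≡ e
  label-inj {d} {e} eq with d ≟ a | d ≟ b | e ≟ a | e ≟ b
  ... | yes p | _     | yes q | _     = trans p (sym q)
  ... | no _  | yes p | no _  | yes q = trans p (sym q)
  label-inj () | yes _ | _     | no _  | yes _
  label-inj () | yes _ | _     | no _  | no _
  label-inj () | no _  | yes _ | yes _ | _
  label-inj () | no _  | yes _ | no _  | no _
  label-inj () | no _  | no _  | yes _ | _
  label-inj () | no _  | no _  | no _  | yes _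
  label-inj {d} {e} eq | no p  | no q  | no r  | no s  with d ≟ c | e ≟ c
  ...   | yes x | yes y = trans x (sym y)
  ...   | no x  | _     = ⊥-elim (¬r (d , p , q , x))
  ...   | _     | no y  = ⊥-elim (¬r (e , r , s , y))

small⇒seriesParallel : ∀ {n} (G : Trigraph n) → ¬ 4 ≤ n → SeriesParallel G
small⇒seriesParallel G small (m , H , sub , f , f-inj , _) =
  small (injective⇒≤ {f = f ∘ IsSubdivK4.branch sub} (IsSubdivK4.branch-inj sub ∘ f-inj))

-- Decidable reachability, cutsets, and the passage between a trigraph and its realizations.

module Reachability {n : ℕ} (G : Trigraph n) (C : Subset n) (u : Fin n) (u∉C : u ∉ₛ C) where
  open Certificates (full G)
  open DecMembership (_≟_ {n}) using (_∈?_)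

  Closed : List V → Set
  Closed S = ∀ {x y} → x ∈ S → x ~ y → y ∉ₛ C → y ∈ S

  Reached : List V → Set
  Reached S = u ∈ S × (∀ {x} → x ∈ S → ReachOutside G C u x)

  -- The bound makes k sufficient fuel: at zero, S already has n distinct entries, so no new vertex
  -- can be added.
  grow : ∀ k S → n ≤ k + length S → Unique S → Reached S → ∃ λ S′ → Reached S′ × Closed S′
  grow k S bound uq (u∈ , reach) with Fin.any? (λ y → (¬? (y ∈? S) ×-dec ¬? (y ∈ₛ? C)) ×-dec Any.any? (_~? y) S)
  ... | no ¬r = S , (u∈ , reach) , closed
    where
    closed : Closed S
    closed {x} {y} x∈ e y∉C with y ∈? S
    ... | yes m = m
    ... | no ¬m = ⊥-elim (¬r (y , (¬m , y∉C) , lose x∈ e))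
  grow zero S bound uq _ | yes (y , (y∉S , _) , _) =
    ⊥-elim (ℕ.<⇒≱ (unique-length (∉⇒unique-∷ y∉S uq)) bound)
  grow (suc k) S bound uq (u∈ , reach) | yes (y , (y∉S , y∉C) , a) with find a
  ... | x , x∈ , e = grow k (y ∷ S) (subst (n ≤_) (sym (ℕ.+-suc k (length S))) bound) (∉⇒unique-∷ y∉S uq)
        (there u∈ , λ { (here refl) → step (reach x∈) e y∉C ; (there m) → reach m })

  reach? : ∀ v → Dec (ReachOutside G C u v)
  reach? v with grow n [ u ] (ℕ.m≤m+n n 1) ([] ∷ []) (here refl , λ { (here refl) → here u∉C })
  ... | S , (u∈ , reach) , closed with v ∈? S
  ...   | yes m = yes (reach m)
  ...   | no ¬m = no (¬m ∘ inside)
    where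
    inside : ∀ {w} → ReachOutside G C u w → w ∈ S
    inside (here _)     = u∈
    inside (step r e k) = closed (inside r) e k

module _ {n : ℕ} (G : Trigraph n) where

  cutset? : ∀ C → Dec (Cutset G C)
  cutset? C = Fin.any? (λ u → Fin.any? (λ v → separated? u v))
    where
    separated? : ∀ u v → Dec (u ∉ₛ C × v ∉ₛ C × ¬ ReachOutside G C u v)
    separated? u v with u ∈ₛ? C
    ... | yes p = no (λ (q , _) → q p)
    ... | no ¬p with v ∈ₛ? C
    ...   | yes q = no (λ (_ , r , _) → r q)
    ...   | no ¬q with Reachability.reach? G C u ¬p v
    ...     | yes r = no (λ (_ , _ , k) → k r)
    ...     | no ¬r = yes (¬p , ¬q , ¬r)

  open Walks (full G)

  -- A `ReachOutside` grows at its far end and a `Walk` at its near end, hence the reversed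
  -- direction.
  reach⇒walk : ∀ {C u v} → ReachOutside G C u v → Walk (_∉ₛ C) v u
  reach⇒walk (here p)     = stop p
  reach⇒walk (step {v = v} {w} r e p) = move p (~-sym {v} {w} e) (reach⇒walk r)

  connected : ∀ {C} → ¬ Cutset G C → ∀ {u v} → u ∉ₛ C → v ∉ₛ C → Walk (_∉ₛ C) u v
  connected {C} ¬cut {u} {v} p q with Reachability.reach? G C v q u
  ... | yes r = reach⇒walk r
  ... | no ¬r = ⊥-elim (¬cut (v , u , q , p , ¬r))

  ∉pair : ∀ {x a b : Fin n} → x ≢ a → x ≢ b → x ∉ₛ ⁅ a ⁆ ∪ ⁅ b ⁆
  ∉pair {a = a} {b} p q m = Sum.[ p ∘ x∈⁅y⁆⇒x≡y a , q ∘ x∈⁅y⁆⇒x≡y b ]′ (x∈p∪q⁻ ⁅ a ⁆ ⁅ b ⁆ m)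

  ∉pair⁻ : ∀ {x a b : Fin n} → x ∉ₛ ⁅ a ⁆ ∪ ⁅ b ⁆ → x ≢ a × x ≢ b
  ∉pair⁻ {x} ∉ = (λ { refl → ∉ (x∈p∪q⁺ (inj₁ (x∈⁅x⁆ x))) }) , (λ { refl → ∉ (x∈p∪q⁺ (inj₂ (x∈⁅x⁆ x))) })

  ∉triple : ∀ {x a b c : Fin n} → x ≢ a → x ≢ b → x ≢ c → x ∉ₛ ⁅ a ⁆ ∪ (⁅ b ⁆ ∪ ⁅ c ⁆)
  ∉triple {a = a} {b} {c} p q r m = Sum.[ p ∘ x∈⁅y⁆⇒x≡y a , ∉pair q r ]′ (x∈p∪q⁻ ⁅ a ⁆ (⁅ b ⁆ ∪ ⁅ c ⁆) m)

  ∉triple⁻ : ∀ {x a b c : Fin n} → x ∉ₛ ⁅ a ⁆ ∪ (⁅ b ⁆ ∪ ⁅ c ⁆) → x ≢ a × x ≢ b × x ≢ c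
  ∉triple⁻ {x} ∉ = (λ { refl → ∉ (x∈p∪q⁺ (inj₁ (x∈⁅x⁆ x))) }) , ∉pair⁻ (λ m → ∉ (x∈p∪q⁺ (inj₂ m)))

  -- Repetitions among a, b and c are allowed, so cliques of one or two vertices are covered too.
  small-clique : ∀ {a b c} → (a ≢ b → θ G a b ≡ strongAdj) → (a ≢ c → θ G a c ≡ strongAdj) → (b ≢ c → θ G b c ≡ strongAdj) →
    ∀ u v → u ∈ₛ ⁅ a ⁆ ∪ (⁅ b ⁆ ∪ ⁅ c ⁆) → v ∈ₛ ⁅ a ⁆ ∪ (⁅ b ⁆ ∪ ⁅ c ⁆) → u ≢ v → θ G u v ≡ strongAdj
  small-clique {a} {b} {c} ab ac bc u v u∈ v∈ = pairs (one-of u∈) (one-of v∈)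
    where
    one-of : ∀ {x} → x ∈ₛ ⁅ a ⁆ ∪ (⁅ b ⁆ ∪ ⁅ c ⁆) → x ≡ a ⊎ x ≡ b ⊎ x ≡ c
    one-of m = Sum.map (x∈⁅y⁆⇒x≡y a) (Sum.map (x∈⁅y⁆⇒x≡y b) (x∈⁅y⁆⇒x≡y c) ∘ x∈p∪q⁻ ⁅ b ⁆ ⁅ c ⁆)
                 (x∈p∪q⁻ ⁅ a ⁆ (⁅ b ⁆ ∪ ⁅ c ⁆) m)
    pairs : u ≡ a ⊎ u ≡ b ⊎ u ≡ c → v ≡ a ⊎ v ≡ b ⊎ v ≡ c → u ≢ v → θ G u v ≡ strongAdj
    pairs (inj₁ refl)        (inj₁ refl)        ne = ⊥-elim (ne refl)
    pairs (inj₁ refl)        (inj₂ (inj₁ refl)) ne = ab ne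
    pairs (inj₁ refl)        (inj₂ (inj₂ refl)) ne = ac ne
    pairs (inj₂ (inj₁ refl)) (inj₁ refl)        ne = trans (θ-sym G u v) (ab (ne ∘ sym))
    pairs (inj₂ (inj₁ refl)) (inj₂ (inj₁ refl)) ne = ⊥-elim (ne refl)
    pairs (inj₂ (inj₁ refl)) (inj₂ (inj₂ refl)) ne = bc ne
    pairs (inj₂ (inj₂ refl)) (inj₁ refl)        ne = trans (θ-sym G u v) (ac (ne ∘ sym))
    pairs (inj₂ (inj₂ refl)) (inj₂ (inj₁ refl)) ne = trans (θ-sym G u v) (bc (ne ∘ sym))
    pairs (inj₂ (inj₂ refl)) (inj₂ (inj₂ refl)) ne = ⊥-elim (ne refl)

  cutset-resp : ∀ {C C′} → (∀ {x} → x ∈ₛ C′ → x ∈ₛ C) → (∀ {x} → x ∈ₛ C → x ∈ₛ C′) → Cutset G C → Cutset G C′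
  cutset-resp f g (u , v , p , q , r) = u , v , p ∘ f , q ∘ f , r ∘ back
    where
    back : ∀ {v} → ReachOutside G _ u v → ReachOutside G _ u v
    back (here k)     = here (k ∘ g)
    back (step w e k) = step (back w) e (k ∘ g)

  pair-cutset : ∀ {a b} → Cutset G (⁅ a ⁆ ∪ ⁅ b ⁆) → CliqueCutset G ⊎ Stable2Cutset G
  pair-cutset {a} {b} cut with a ≟ b | θ G a b ≟ᶿ strongAdj
  ... | no a≢b | no weak = inj₂ (a , b , a≢b , weak , cut)
  -- The two vertices may coincide, and a single vertex is a strong clique.
  ... | yes refl | _ = inj₁ (⁅ a ⁆ ∪ (⁅ a ⁆ ∪ ⁅ a ⁆) , small-clique (λ k → ⊥-elim (k refl)) (λ k → ⊥-elim (k refl)) (λ k → ⊥-elim (k refl)) ,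
        cutset-resp (λ m → Sum.[ (λ k → x∈p∪q⁺ (inj₁ k)) , (λ k → k) ]′ (x∈p∪q⁻ ⁅ a ⁆ (⁅ a ⁆ ∪ ⁅ a ⁆) m)) (λ m → x∈p∪q⁺ (inj₂ m)) cut)
  ... | _ | yes strong = inj₁ (⁅ a ⁆ ∪ (⁅ a ⁆ ∪ ⁅ b ⁆) , small-clique (λ k → ⊥-elim (k refl)) (λ _ → strong) (λ _ → strong) ,
        cutset-resp (λ m → Sum.[ (λ k → x∈p∪q⁺ (inj₁ k)) , (λ k → k) ]′ (x∈p∪q⁻ ⁅ a ⁆ (⁅ a ⁆ ∪ ⁅ b ⁆) m)) (λ m → x∈p∪q⁺ (inj₂ m)) cut)

  fullAdj-≢ : ∀ {u v} → u ≢ v → fullAdj G u v ≡ notAnti (θ G u v)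
  fullAdj-≢ {u} {v} ne with u ≟ v
  ... | yes e = ⊥-elim (ne e)
  ... | no _  = refl

  full-realization : IsRealization G (full G)
  full-realization u v ne = (λ e → trans (fullAdj-≢ ne) (cong notAnti e)) , (λ e → trans (fullAdj-≢ ne) (cong notAnti e))

  deletion-realization : ∀ {a b} → θ G a b ≡ semiAdj → IsRealization G (deleteEdge (full G) a b)
  deletion-realization {a} {b} semi u v ne =
    (λ e → del-keeps (full G) a b (other e) (proj₁ (full-realization u v ne) e)) ,
    (λ e → del-false (full G) a b {u} {v} (proj₂ (full-realization u v ne) e))
    where
    other : θ G u v ≡ strongAdj → ¬ SamePair a b u v
    other e (inj₁ (refl , refl)) with trans (sym e) semi
    ... | ()
    other e (inj₂ (refl , refl)) with trans (sym e) (trans (θ-sym G u v) semi)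
    ... | ()

  adjacent⇒weak : ∀ {u v} → u ~ v → θ G u v ≢ strongAnti
  adjacent⇒weak {u} {v} e k with trans (sym e) (trans (fullAdj-≢ (~⇒≢ e)) (cong notAnti k))
  ... | ()

  weak⇒adjacent : ∀ {u v} → u ≢ v → θ G u v ≢ strongAnti → u ~ v
  weak⇒adjacent {u} {v} ne k = trans (fullAdj-≢ ne) (lemma (θ G u v) k)
    where
    lemma : ∀ x → x ≢ strongAnti → notAnti x ≡ true
    lemma strongAdj  _ = refl
    lemma semiAdj    _ = refl
    lemma strongAnti k = ⊥-elim (k refl)

  nonadjacent⇒anti : ∀ {u v} → u ≢ v → ¬ u ~ v → θ G u v ≡ strongAnti
  nonadjacent⇒anti {u} {v} ne k with θ G u v ≟ᶿ strongAnti
  ... | yes e = e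
  ... | no ¬e = ⊥-elim (k (weak⇒adjacent ne ¬e))

  adjacent-not-semi⇒strong : ∀ {u v} → u ~ v → θ G u v ≢ semiAdj → θ G u v ≡ strongAdj
  adjacent-not-semi⇒strong {u} {v} e k with θ G u v in eq
  ... | strongAdj  = refl
  ... | semiAdj    = ⊥-elim (k refl)
  ... | strongAnti = ⊥-elim (adjacent⇒weak e eq)

-- Semi-adjacent pairs lie neither in triangles nor across a K₃,₃.

module WeakEdge {n : ℕ} (F F⁻ : Graph n)
  (isk4-free : ¬ HasInducedSubdivK4 F) (wheel-free : ¬ HasInducedWheel F)
  (isk4-free⁻ : ¬ HasInducedSubdivK4 F⁻) (wheel-free⁻ : ¬ HasInducedWheel F⁻)
  (no-2-cutset : ∀ a b {u v} → u ≢ a → u ≢ b → v ≢ a → v ≢ b → Walks.Walk F (λ x → x ≢ a × x ≢ b) u v)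
  (a b : Fin n) (F⁻⊆F : ∀ {u v} → adj F⁻ u v ≡ true → adj F u v ≡ true)
  (F⊆F⁻ : ∀ {u v} → ¬ SamePair a b u v → adj F u v ≡ true → adj F⁻ u v ≡ true)
  (a≁⁻b : adj F⁻ a b ≢ true) where
  open Claws F isk4-free wheel-free no-2-cutset
  private module Del = Bipartite F⁻ isk4-free⁻ wheel-free⁻

  keepˡ : ∀ {u v} → u ≢ a → u ≢ b → u ~ v → u Del.~ v
  keepˡ u≢a u≢b = F⊆F⁻ λ { (inj₁ (e , _)) → u≢a e ; (inj₂ (e , _)) → u≢b e }

  path⁻ : ∀ {P} → Path P → (∀ {v} → v ∈ P → v ≢ a × v ≢ b) → Del.Path P
  path⁻ {P} (mkPath uq ed ch) avoid = Del.mkPath uq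
    (λ c → let (p , q) = avoid (consec-∈ˡ P c) in keepˡ p q (ed c)) (λ u∈ v∈ e → ch u∈ v∈ (F⁻⊆F e))

  -- Off the triangle, the component of d sees a, b and c. A path P in it joins a to b, and c misses
  -- P, since otherwise P has three attachments on the triangle. So P closes up through the edge ab
  -- in F, and through a, c, b in F⁻. A path Q leads from c to P, and the neighbours of its last
  -- vertex on P are counted.
  no-weak-triangle : ∀ {c d} → a ~ b → a ~ c → b ~ c → d ≢ a → d ≢ b → d ≢ c → ⊥
  no-weak-triangle {c} {d} ab ac bc d≢a d≢b d≢c
    with approach {S = _≡ a} (_≟ a) (no-2-cutset b c {d} {a} d≢b d≢c (~⇒≢ ab) (~⇒≢ ac)) d≢a refl
       | approach {S = _≡ b} (_≟ b) (no-2-cutset a c {d} {b} d≢a d≢c (~⇒≢ (~-sym ab)) (~⇒≢ bc)) d≢b refl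
       | approach {S = _≡ c} (_≟ c) (no-2-cutset a b {d} {c} d≢a d≢b (~⇒≢ (~-sym ac)) (~⇒≢ (~-sym bc))) d≢c refl
  ... | za , _ , wa , za~a , refl , _ | zb , _ , wb , zb~b , refl , _ | zc , _ , wc , zc~c , refl , _ = rest
    where
    D : V → Set
    D x = x ≢ a × x ≢ b × x ≢ c
    fromA : Walk D d za
    fromA = walk-map (λ ((p , q) , r) → r , p , q) wa
    fromB : Walk D d zb
    fromB = walk-map (λ ((p , q) , r) → p , r , q) wb
    fromC : Walk D d zc
    fromC = walk-map (λ ((p , q) , r) → p , q , r) wc
    rung : Between (Walk D d) (a ~_) (b ~_)
    rung = between (b ~?_) (a ~?_) (walk-++ (walk-sym (component-walk fromA)) (component-walk fromB)) (~-sym za~a) (~-sym zb~b)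
    open Between rung renaming (vertices to P; path to pathᵖ)
    inD : ∀ {p} → p ∈ P → D p
    inD m = walk-end (inside m)
    c≁P : ¬ Meets c P
    c≁P m = three-attachments (triangle ab bc (~-sym ac)) pathᵖ apart (here refl) (there (here refl)) (there (there (here refl)))
      (~⇒≢ ab) (~⇒≢ ac) (~⇒≢ bc) cross (meets (first-∈ source-first) start) (meets (last-∈ sink-last) end) m
      where
      apart : Apart (a ∷ b ∷ c ∷ []) P
      apart (here refl)                 m = proj₁ (inD m) refl
      apart (there (here refl))         m = proj₁ (proj₂ (inD m)) refl
      apart (there (there (here refl))) m = proj₂ (proj₂ (inD m)) refl
      cross : ∀ {u v} → u ∈ a ∷ b ∷ c ∷ [] → v ∈ P → u ~ v → u ≡ a ⊎ u ≡ b ⊎ u ≡ c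
      cross (here e)                 _ _ = inj₁ e
      cross (there (here e))         _ _ = inj₂ (inj₁ e)
      cross (there (there (here e))) _ _ = inj₂ (inj₂ e)
    rim : Hole (P ++ b ∷ a ∷ [])
    rim = hole-glue pathᵖ (path-edge (~-sym ab)) apart (first-∈ source-first) (here refl)
      (three-members (∈-++⁺ˡ (first-∈ source-first)) (∈-++⁺ʳ P (here refl)) (∈-++⁺ʳ P (there (here refl)))
        (proj₁ (proj₂ (inD (first-∈ source-first)))) (proj₁ (inD (first-∈ source-first))) (~⇒≢ (~-sym ab)))
      (λ { p refl → ~-sym (subst (b ~_) (last-unique P sink-last p) end) })
      (λ { p refl → ~-sym (subst (a ~_) (first-unique P source-first p) start) })
      cross
      where
      apart : Apart P (b ∷ a ∷ [])
      apart m (here refl)         = proj₁ (proj₂ (inD m)) refl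
      apart m (there (here refl)) = proj₁ (inD m) refl
      cross : ∀ {p v} → p ∈ P → v ∈ b ∷ a ∷ [] → p ~ v → (Last P p × First (b ∷ a ∷ []) v) ⊎ (First P p × Last (b ∷ a ∷ []) v)
      cross m (here refl) e with only-sink m (~-sym e)
      ... | refl = inj₁ (sink-last , refl)
      cross m (there (here refl)) e with only-source m (~-sym e)
      ... | refl = inj₂ (source-first , refl)
    -- Once ab is deleted, b, c, a is a chordless path, so c now lies on the hole.
    rim⁻ : Del.Hole (P ++ b ∷ c ∷ a ∷ [])
    rim⁻ = Del.hole-glue (path⁻ pathᵖ (λ m → proj₁ (inD m) , proj₁ (proj₂ (inD m))))
      (Del.path-cherry (Del.~-sym (keepˡ c≢a c≢b (~-sym bc))) (keepˡ c≢a c≢b (~-sym ac)) (~⇒≢ (~-sym ab)) (λ e → a≁⁻b (Del.~-sym e)))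
      apart (first-∈ source-first) (here refl)
      (three-members (∈-++⁺ʳ P (here refl)) (∈-++⁺ʳ P (there (here refl))) (∈-++⁺ʳ P (there (there (here refl))))
        (~⇒≢ bc) (~⇒≢ (~-sym ab)) c≢a)
      (λ { p refl → let q = inD (last-∈ p) in keepˡ (proj₁ q) (proj₁ (proj₂ q)) (~-sym (subst (b ~_) (last-unique P sink-last p) end)) })
      (λ { p refl → let q = inD (first-∈ p) in keepˡ (proj₁ q) (proj₁ (proj₂ q)) (~-sym (subst (a ~_) (first-unique P source-first p) start)) })
      cross
      where
      c≢a : c ≢ a
      c≢a = ~⇒≢ (~-sym ac)
      c≢b : c ≢ b
      c≢b = ~⇒≢ (~-sym bc)
      apart : Apart P (b ∷ c ∷ a ∷ [])
      apart m (here refl)                 = proj₁ (proj₂ (inD m)) refl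
      apart m (there (here refl))         = proj₂ (proj₂ (inD m)) refl
      apart m (there (there (here refl))) = proj₁ (inD m) refl
      cross : ∀ {p v} → p ∈ P → v ∈ b ∷ c ∷ a ∷ [] → p Del.~ v →
              (Last P p × First (b ∷ c ∷ a ∷ []) v) ⊎ (First P p × Last (b ∷ c ∷ a ∷ []) v)
      cross m (here refl) e with only-sink m (~-sym (F⁻⊆F e))
      ... | refl = inj₁ (sink-last , refl)
      cross m (there (here refl)) e = ⊥-elim (c≁P (meets m (~-sym (F⁻⊆F e))))
      cross m (there (there (here refl))) e with only-source m (~-sym (F⁻⊆F e))
      ... | refl = inj₂ (source-first , refl)
    attached : (Q : Between (λ q → D q × ¬ q ∈ P) (c ~_) (λ q → Meets q P)) → ⊥
    attached Q = count (tally (occurrences (Q.sink ~?_) (Path.uniq pathᵖ) Q.end))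
      where
      module Q = Between Q
      sink∉ : Q.sink ∉ P ++ b ∷ a ∷ []
      sink∉ m with ∈-++⁻ P m
      ... | inj₁ k                   = proj₂ (Q.inside (last-∈ Q.sink-last)) k
      ... | inj₂ (here e)            = proj₁ (proj₂ (proj₁ (Q.inside (last-∈ Q.sink-last)))) e
      ... | inj₂ (there (here e))    = proj₁ (proj₁ (Q.inside (last-∈ Q.sink-last))) e
      rim#Q : ∀ {v} → v ∈ P ++ b ∷ a ∷ [] → v ∈ Q.vertices → ⊥
      rim#Q m q with ∈-++⁻ P m
      ... | inj₁ k                   = proj₂ (Q.inside q) k
      ... | inj₂ (here refl)         = proj₁ (proj₂ (proj₁ (Q.inside q))) refl
      ... | inj₂ (there (here refl)) = proj₁ (proj₁ (Q.inside q)) refl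
      onP : ∀ {p q} → p ∈ P → q ∈ Q.vertices → p ~ q → Q.sink ~ p
      onP p∈ q∈ e = subst (_~ _) (Q.only-sink q∈ (meets p∈ (~-sym e))) (~-sym e)
      count : Tally (Q.sink ~_) P → ⊥
      count (many x∈ y∈ z∈ p q r sx sy sz) = no-wheel rim sink∉ (∈-++⁺ˡ x∈) (∈-++⁺ˡ y∈) (∈-++⁺ˡ z∈) p q r sx sy sz
      -- The path c, Q has the attachments a, b and x on the hole of F.
      count (one {x} x∈ sx only) = three-attachments rim
        (path-++ path-[ c ] Q.path (λ { (here refl) m → proj₂ (proj₂ (proj₁ (Q.inside m))) refl })
          (λ { refl f → subst (c ~_) (first-unique Q.vertices Q.source-first f) Q.start })
          (λ { (here refl) m e → refl , subst (First Q.vertices) (sym (Q.only-source m e)) Q.source-first }))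
        apart (∈-++⁺ʳ P (there (here refl))) (∈-++⁺ʳ P (here refl)) (∈-++⁺ˡ x∈) (~⇒≢ ab)
        (λ { refl → proj₁ (inD x∈) refl }) (λ { refl → proj₁ (proj₂ (inD x∈)) refl }) cross
        (here ac) (here bc) (there (meets (last-∈ Q.sink-last) (~-sym sx)))
        where
        apart : Apart (P ++ b ∷ a ∷ []) (c ∷ Q.vertices)
        apart m (there q) = rim#Q m q
        apart m (here refl) with ∈-++⁻ P m
        ... | inj₁ k                = proj₂ (proj₂ (inD k)) refl
        ... | inj₂ (here e)         = ~⇒≢ bc (sym e)
        ... | inj₂ (there (here e)) = ~⇒≢ ac (sym e)
        cross : ∀ {u v} → u ∈ P ++ b ∷ a ∷ [] → v ∈ c ∷ Q.vertices → u ~ v → u ≡ a ⊎ u ≡ b ⊎ u ≡ x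
        cross m v∈ e with ∈-++⁻ P m
        cross m (here refl) e | inj₁ k = ⊥-elim (c≁P (meets k (~-sym e)))
        cross m (there q)   e | inj₁ k = inj₂ (inj₂ (only k (onP k q e)))
        ... | inj₂ (here k)         = inj₂ (inj₁ k)
        ... | inj₂ (there (here k)) = inj₁ k
      count (two {x} {y} x∈ y∈ sx sy x≢y only) = side (Any.any? (λ q → (a ~? q) ⊎-dec (b ~? q)) Q.vertices)
        where
        side : Dec (Any (λ q → a ~ q ⊎ b ~ q) Q.vertices) → ⊥
        -- If Q misses a and b, it has the attachments c, x and y on the hole of F⁻; here the second
        -- realization is essential.
        side (no ¬m) = Del.three-attachments rim⁻ (path⁻ Q.path (λ m → let (p , q , _) = proj₁ (Q.inside m) in p , q)) apart
          (∈-++⁺ʳ P (there (here refl))) (∈-++⁺ˡ x∈) (∈-++⁺ˡ y∈)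
          (λ { refl → proj₂ (proj₂ (inD x∈)) refl }) (λ { refl → proj₂ (proj₂ (inD y∈)) refl }) x≢y cross
          (lose (first-∈ Q.source-first) (keepˡ (~⇒≢ (~-sym ac)) (~⇒≢ (~-sym bc)) Q.start)) (lose s∈ (keep x∈ sx)) (lose s∈ (keep y∈ sy))
          where
          s∈ : Q.sink ∈ Q.vertices
          s∈ = last-∈ Q.sink-last
          keep : ∀ {p} → p ∈ P → Q.sink ~ p → p Del.~ Q.sink
          keep m e = keepˡ (proj₁ (inD m)) (proj₁ (proj₂ (inD m))) (~-sym e)
          apart : Apart (P ++ b ∷ c ∷ a ∷ []) Q.vertices
          apart m q with ∈-++⁻ P m
          ... | inj₁ k                           = proj₂ (Q.inside q) k
          ... | inj₂ (here refl)                 = proj₁ (proj₂ (proj₁ (Q.inside q))) refl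
          ... | inj₂ (there (here refl))         = proj₂ (proj₂ (proj₁ (Q.inside q))) refl
          ... | inj₂ (there (there (here refl))) = proj₁ (proj₁ (Q.inside q)) refl
          cross : ∀ {u v} → u ∈ P ++ b ∷ c ∷ a ∷ [] → v ∈ Q.vertices → u Del.~ v → u ≡ c ⊎ u ≡ x ⊎ u ≡ y
          cross m q e with ∈-++⁻ P m
          ... | inj₁ k                           = inj₂ (only k (onP k q (F⁻⊆F e)))
          ... | inj₂ (here refl)                 = ⊥-elim (¬m (lose q (inj₂ (F⁻⊆F e))))
          ... | inj₂ (there (here k))            = inj₁ k
          ... | inj₂ (there (there (here refl))) = ⊥-elim (¬m (lose q (inj₁ (F⁻⊆F e))))
        -- From its last vertex s that sees a or b, Q has three attachments on the hole of F: x, y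
        -- and one of a and b. If s saw both, s and c would be two common neighbours of a and b.
        side (yes m) with last-split (λ q → (a ~? q) ⊎-dec (b ~? q)) m
        ... | X₁ , s , Y₁ , eq , near , far = which (a ~? s) (b ~? s)
          where
          tail⊂ : ∀ {v} → v ∈ s ∷ Y₁ → v ∈ Q.vertices
          tail⊂ {v} k = subst (v ∈_) (sym eq) (∈-++⁺ʳ X₁ k)
          s∈ : Q.sink ∈ s ∷ Y₁
          s∈ = last-∈ (last-++⁻ X₁ (subst (λ T → Last T Q.sink) eq Q.sink-last))
          only-s : ∀ {r} → r ~ s → r ≡ a ⊎ r ≡ b → (∀ {r′} → r′ ≡ a ⊎ r′ ≡ b → r′ ~ s → r′ ≡ r) → ⊥
          only-s {r} rs r∈ unique = three-attachments rim (path-++ʳ X₁ (subst Path eq Q.path)) (λ p q → rim#Q p (tail⊂ q))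
            (corner r∈) (∈-++⁺ˡ x∈) (∈-++⁺ˡ y∈) (off r∈ x∈) (off r∈ y∈) x≢y cross
            (here rs) (lose s∈ (~-sym sx)) (lose s∈ (~-sym sy))
            where
            corner : ∀ {r} → r ≡ a ⊎ r ≡ b → r ∈ P ++ b ∷ a ∷ []
            corner (inj₁ refl) = ∈-++⁺ʳ P (there (here refl))
            corner (inj₂ refl) = ∈-++⁺ʳ P (here refl)
            off : ∀ {r p} → r ≡ a ⊎ r ≡ b → p ∈ P → r ≢ p
            off (inj₁ refl) m refl = proj₁ (inD m) refl
            off (inj₂ refl) m refl = proj₁ (proj₂ (inD m)) refl
            end-of : ∀ {u v} → u ≡ a ⊎ u ≡ b → v ∈ s ∷ Y₁ → u ~ v → u ≡ r
            end-of k (here refl) e = unique k e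
            end-of (inj₁ refl) (there q) e = ⊥-elim (All.lookup far q (inj₁ e))
            end-of (inj₂ refl) (there q) e = ⊥-elim (All.lookup far q (inj₂ e))
            cross : ∀ {u v} → u ∈ P ++ b ∷ a ∷ [] → v ∈ s ∷ Y₁ → u ~ v → u ≡ r ⊎ u ≡ x ⊎ u ≡ y
            cross m q e with ∈-++⁻ P m
            ... | inj₁ k                = inj₂ (only k (onP k (tail⊂ q) e))
            ... | inj₂ (here k)         = inj₁ (end-of (inj₂ k) q e)
            ... | inj₂ (there (here k)) = inj₁ (end-of (inj₁ k) q e)
          which : Dec (a ~ s) → Dec (b ~ s) → ⊥
          which (yes as) (yes bs) = no-diamond ab (proj₂ (proj₂ (proj₁ (Q.inside (tail⊂ (here refl))))) ∘ sym) ac bc as bs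
          which (yes as) (no ¬bs) = only-s as (inj₁ refl) (λ { (inj₁ k) _ → k ; (inj₂ refl) e → ⊥-elim (¬bs e) })
          which (no ¬as) (yes bs) = only-s bs (inj₂ refl) (λ { (inj₂ k) _ → k ; (inj₁ refl) e → ⊥-elim (¬as e) })
          which (no ¬as) (no ¬bs) = Sum.[ ¬as , ¬bs ]′ near
    rest : ⊥
    rest with approach {S = _∈ P} (_∈? P) (walk-++ (walk-sym fromC) (inside (first-∈ source-first)))
                (λ m → c≁P (meets m (~-sym zc~c))) (first-∈ source-first)
    ... | z , s , w , z~s , s∈ , _ =
      attached (between (λ q → meets? q P) (c ~?_) w (~-sym zc~c) (meets s∈ z~s))

  -- Two vertices on each side of K other than a and b, together with a and b, induce K₃,₃ minus an
  -- edge in F⁻.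
  no-weak-K₃₃ : ∀ K → InA K a → InA (flip K) b → ⊥
  no-weak-K₃₃ K a∈ b∈ with avoid-two (K₃₃.a K) (K₃₃.a-distinct K) a a | avoid-two (K₃₃.b K) (K₃₃.b-distinct K) b b
  ... | i , xi , _ | k , yk , _ with avoid-two (K₃₃.a K) (K₃₃.a-distinct K) a (K₃₃.a K i) | avoid-two (K₃₃.b K) (K₃₃.b-distinct K) b (K₃₃.b K k)
  ... | j , xj , j≢i | l , yl , l≢k = Del.no-k33-minus-edge
      (j≢i ∘ sym) xi xj (l≢k ∘ sym) yk yl
      (a-stable i j ∘ F⁻⊆F) (A-stable (a∈A i) a∈ ∘ F⁻⊆F) (A-stable (a∈A j) a∈ ∘ F⁻⊆F)
      (b-stable k l ∘ F⁻⊆F) (B-stable (b∈B k) b∈ ∘ F⁻⊆F) (B-stable (b∈B l) b∈ ∘ F⁻⊆F)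
      (keep i xi (complete i k)) (keep i xi (complete i l)) (keep i xi (~-sym (b∈ i)))
      (keep j xj (complete j k)) (keep j xj (complete j l)) (keep j xj (~-sym (b∈ j)))
      (Del.~-sym (keep′ k yk (~-sym (a∈ k)))) (Del.~-sym (keep′ l yl (~-sym (a∈ l)))) a≁⁻b
    where
    open K₃₃ K renaming (a to α; b to β)
    open Side K
    open Side (flip K) using () renaming (A-stable to B-stable)
    keep : ∀ i {v} → α i ≢ a → α i ~ v → α i Del.~ v
    keep i ne = keepˡ ne (λ e → A#B (a∈A i) (subst (InA (flip K)) (sym e) b∈))
    keep′ : ∀ k {v} → β k ≢ b → β k ~ v → β k Del.~ v
    keep′ k ne = keepˡ (λ e → A#B a∈ (subst (InA (flip K)) e (b∈B k))) ne

-- Assembly: claw or line graph, and the return to the trigraph.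

module Decomposition {n : ℕ} (F : Graph n) (4≤n : 4 ≤ n)
  (isk4-free : ¬ HasInducedSubdivK4 F) (wheel-free : ¬ HasInducedWheel F)
  (no-2-cutset : ∀ a b {u v} → u ≢ a → u ≢ b → v ≢ a → v ≢ b → Walks.Walk F (λ x → x ≢ a × x ≢ b) u v) where
  open Claws F isk4-free wheel-free no-2-cutset public

  neighbour-avoiding : ∀ {v} p q → v ≢ p → v ≢ q → ∃ λ y → v ~ y × y ≢ p × y ≢ q
  neighbour-avoiding {v} p q v≢p v≢q with fresh 4≤n v p q
  ... | u , u≢v , u≢p , u≢q with no-2-cutset p q {v} {u} v≢p v≢q u≢p u≢q
  ...   | stop _     = ⊥-elim (u≢v refl)
  ...   | move _ e w = _ , e , walk-start w

  -- Besides a neighbour a, v has a neighbour b that differs from the only possible common neighbour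
  -- t of v and a; if b saw a, it would be a second one.
  two-cliques : ∀ v → ∃ λ a → ∃ λ b → v ~ a × v ~ b × b ≢ a × ¬ a ~ b
  two-cliques v with fresh 4≤n v v v
  ... | u , u≢v , _ with neighbour-avoiding {v} u u (u≢v ∘ sym) (u≢v ∘ sym)
  ... | a , va , _ with Fin.any? (λ t → (v ~? t) ×-dec (a ~? t))
  ... | yes (t , vt , at) with neighbour-avoiding {v} a t (~⇒≢ va) (~⇒≢ vt)
  ...   | b , vb , b≢a , b≢t = a , b , va , vb , b≢a , λ ab → no-diamond va (b≢t ∘ sym) vt at vb ab
  two-cliques v | u , u≢v , _ | a , va , _ | no ¬t with neighbour-avoiding {v} a a (~⇒≢ va) (~⇒≢ va)
  ...   | b , vb , b≢a , _ = a , b , va , vb , b≢a , λ ab → ¬t (b , vb , ab)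

  ClawFree : Set
  ClawFree = ∀ {v a b c} → v ~ a → v ~ b → v ~ c → a ≢ b → a ≢ c → b ≢ c → ¬ a ~ b → ¬ a ~ c → ¬ b ~ c → ⊥

  claw? : Claw ⊎ ClawFree
  claw? with Fin.any? (λ v → Fin.any? (λ a → Fin.any? (λ b → Fin.any? (λ c →
    ((v ~? a) ×-dec ((v ~? b) ×-dec (v ~? c))) ×-dec
    ((¬? (a ≟ b) ×-dec (¬? (a ≟ c) ×-dec ¬? (b ≟ c))) ×-dec (¬? (a ~? b) ×-dec (¬? (a ~? c) ×-dec ¬? (b ~? c))))))))
  ... | yes (v , a , b , c , (va , vb , vc) , (p , q , r) , (x , y , z)) = inj₁ (record
        { va = va ; vb = vb ; vc = vc ; a≢b = p ; a≢c = q ; b≢c = r ; a≁b = x ; a≁c = y ; b≁c = z })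
  ... | no ¬claw = inj₂ (λ va vb vc p q r x y z → ¬claw (_ , _ , _ , _ , (va , vb , vc) , (p , q , r) , (x , y , z)))

module _ {n : ℕ} (G : Trigraph n) (free : ISK4WheelFree G) (4≤n : 4 ≤ n)
  (no-2-cutset : ∀ a b → ¬ Cutset G (⁅ a ⁆ ∪ ⁅ b ⁆)) where

  private
    isk4-free : ¬ HasInducedSubdivK4 (full G)
    isk4-free = proj₁ (free (full G) (full-realization G))

    wheel-free : ¬ HasInducedWheel (full G)
    wheel-free = proj₂ (free (full G) (full-realization G))

    2-connected : ∀ a b {u v} → u ≢ a → u ≢ b → v ≢ a → v ≢ b → Walks.Walk (full G) (λ x → x ≢ a × x ≢ b) u v
    2-connected a b p q r s =
      Walks.walk-map (full G) (∉pair⁻ G) (connected G (no-2-cutset a b) (∉pair G p q) (∉pair G r s))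

  open Decomposition (full G) 4≤n isk4-free wheel-free 2-connected

  module Weak {a b : Fin n} (semi : θ G a b ≡ semiAdj) where
    private
      free⁻ : ¬ HasInducedSubdivK4 (deleteEdge (full G) a b) × ¬ HasInducedWheel (deleteEdge (full G) a b)
      free⁻ = free (deleteEdge (full G) a b) (deletion-realization G semi)
    open WeakEdge (full G) (deleteEdge (full G) a b) isk4-free wheel-free (proj₁ free⁻) (proj₂ free⁻) 2-connected a b
      (λ {u} {v} → del-⊆ (full G) a b {u} {v}) (λ {u} {v} → del-keeps (full G) a b {u} {v}) (del-edge (full G) a b) public

  strong-triangles : ∀ {a b c} → a ~ b → a ~ c → b ~ c → θ G a b ≡ strongAdj
  strong-triangles {a} {b} {c} ab ac bc with fresh 4≤n a b c
  ... | d , d≢a , d≢b , d≢c = adjacent-not-semi⇒strong G {a} {b} ab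
        (λ semi → Weak.no-weak-triangle semi {c} {d} ab ac bc d≢a d≢b d≢c)

  all-triangles-strong : ∀ {a b c} → a ~ b → a ~ c → b ~ c →
    θ G a b ≡ strongAdj × θ G a c ≡ strongAdj × θ G b c ≡ strongAdj
  all-triangles-strong {a} {b} {c} ab ac bc =
    strong-triangles {a} {b} {c} ab ac bc , strong-triangles {a} {c} {b} ac ab (~-sym {b} {c} bc) ,
    strong-triangles {b} {c} {a} bc (~-sym {a} {b} ab) (~-sym {a} {c} ac)

  bipartite : K₃₃ → CompleteBipartite G
  bipartite K = (λ x → does (inA? K x)) , λ u v u≢v → same u v u≢v (inA? K u) (inA? K v) , diff u v (inA? K u) (inA? K v)
    where
    strong : ∀ {u v} → InA K u → InA (flip K) v → θ G u v ≡ strongAdj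
    strong {u} {v} p q = adjacent-not-semi⇒strong G {u} {v} (Spanning.A-complete-B K {u} {v} p q) (λ semi → Weak.no-weak-K₃₃ semi K p q)
    otherwise : ∀ x → ¬ InA K x → InA (flip K) x
    otherwise x ¬p = Sum.[ ⊥-elim ∘ ¬p , (λ q → q) ]′ (spanning K x)
    same : ∀ u v → u ≢ v → (p : Dec (InA K u)) (q : Dec (InA K v)) → does p ≡ does q → θ G u v ≡ strongAnti
    same u v u≢v (yes p) (yes q) _ = nonadjacent⇒anti G u≢v (Side.A-stable K {u} {v} p q)
    same u v u≢v (no p)  (no q)  _ = nonadjacent⇒anti G u≢v (Side.A-stable (flip K) {u} {v} (otherwise u p) (otherwise v q))
    diff : ∀ u v (p : Dec (InA K u)) (q : Dec (InA K v)) → does p ≢ does q → θ G u v ≡ strongAdj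
    diff u v (yes p) (no q)  _ = strong p (otherwise v q)
    diff u v (no p)  (yes q) _ = trans (θ-sym G u v) (strong q (otherwise u p))
    diff u v (yes _) (yes _) e = ⊥-elim (e refl)
    diff u v (no _)  (no _)  e = ⊥-elim (e refl)

  line : ClawFree → LineTrigraph G
  line claw-free = _ , root , (ends , root-edge , ends-injective , root-surjective , ends-adjacent) ,
    λ u v w u≢v u≢w v≢w p q r → all-triangles-strong {u} {v} {w} (weak⇒adjacent G u≢v p) (weak⇒adjacent G u≢w q) (weak⇒adjacent G v≢w r)
    where
    open RootGraph (full G) (λ {a} {b} {c} {d} → no-diamond {a} {b} {c} {d}) (λ {v} {a} {b} {c} → claw-free {v} {a} {b} {c}) two-cliques

  -- All triangles of the full realization are strong, so if this search fails, none of them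
  -- separates, which is the hypothesis of `claw⇒K₃₃`.
  strong-triangle-cutset? : Dec (∃ λ a → ∃ λ b → ∃ λ c →
    (θ G a b ≡ strongAdj × θ G a c ≡ strongAdj × θ G b c ≡ strongAdj) × Cutset G (⁅ a ⁆ ∪ (⁅ b ⁆ ∪ ⁅ c ⁆)))
  strong-triangle-cutset? = Fin.any? λ a → Fin.any? λ b → Fin.any? λ c →
    ((θ G a b ≟ᶿ strongAdj) ×-dec ((θ G a c ≟ᶿ strongAdj) ×-dec (θ G b c ≟ᶿ strongAdj))) ×-dec cutset? G (⁅ a ⁆ ∪ (⁅ b ⁆ ∪ ⁅ c ⁆))

  basic-or-clique-cutset : CompleteBipartite G ⊎ LineTrigraph G ⊎ CliqueCutset G
  basic-or-clique-cutset with strong-triangle-cutset?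
  ... | yes (a , b , c , (p , q , r) , cut) =
        inj₂ (inj₂ (⁅ a ⁆ ∪ (⁅ b ⁆ ∪ ⁅ c ⁆) , small-clique G (λ _ → p) (λ _ → q) (λ _ → r) , cut))
  ... | no ¬cut with claw?
  ...   | inj₂ claw-free = inj₂ (inj₁ (line (λ {v} {a} {b} {c} → claw-free {v} {a} {b} {c})))
  ...   | inj₁ claw      = inj₁ (bipartite (claw⇒K₃₃ triangle-connected claw))
    where
    triangle-connected : ∀ {a b c p q} → a ~ b → a ~ c → b ~ c → p ≢ a → p ≢ b → p ≢ c → q ≢ a → q ≢ b → q ≢ c →
      Walk (λ z → z ≢ a × z ≢ b × z ≢ c) p q
    triangle-connected {a} {b} {c} ab ac bc p₁ p₂ p₃ q₁ q₂ q₃ = walk-map (∉triple⁻ G)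
      (connected G (λ cut → ¬cut (a , b , c , all-triangles-strong {a} {b} {c} ab ac bc , cut)) (∉triple G p₁ p₂ p₃) (∉triple G q₁ q₂ q₃))

theorem4p1 : ∀ (n : ℕ) (G : Trigraph n) → ISK4WheelFree G →
    SeriesParallel G ⊎ CompleteBipartite G ⊎ LineTrigraph G ⊎ CliqueCutset G ⊎ Stable2Cutset G
theorem4p1 n G free with 4 ≤? n
... | no small = inj₁ (small⇒seriesParallel G small)
-- The choice a = b is included, so a negative answer also excludes cut vertices.
... | yes 4≤n with Fin.any? (λ a → Fin.any? (λ b → cutset? G (⁅ a ⁆ ∪ ⁅ b ⁆)))
...   | yes (a , b , cut) = inj₂ (inj₂ (inj₂ (pair-cutset G cut)))
...   | no ¬cut with basic-or-clique-cutset G free 4≤n (λ a b cut → ¬cut (a , b , cut))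
...     | inj₁ p        = inj₂ (inj₁ p)
...     | inj₂ (inj₁ p) = inj₂ (inj₂ (inj₁ p))
...     | inj₂ (inj₂ p) = inj₂ (inj₂ (inj₂ (inj₁ p)))
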